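{- For every $\gamma>0$ there exist $c>0$ and $n_0>0$ such that the following holds. If $(\mathcal H,\phi)$ is an $n$-vertex colored $3$-graph with $2\mid n$, $n\ge n_0$, $\delta_1(\mathcal H)\ge (7/16+\gamma)n^2/2$ and $\Delta_1(\mathcal H_i)\le cn^2$ for every $i\in\mathbb N$, then $(\mathcal H,\phi)$ contains a properly colored loose Hamilton cycle $C_n^{(3)}(1)$.
   Context: A $3$-graph is a $3$-uniform hypergraph. A colored hypergraph is a pair $(\mathcal H,\phi)$ where $\phi:\mathcal H\to\mathbb N$ colors the edges; $\mathcal H_i=\{e\in\mathcal H:\phi(e)=i\}$. For $S\subseteq V(\mathcal H)$, $\deg(S)$ is the number of edges containing $S$; $\delta_s(\mathcal H)=\min\{\deg(S):|S|=s\}$, $\Delta_s(\mathcal H)=\max\{\deg(S):|S|=s\}$. A loose cycle $C_n^{(3)}(1)$ is an $n$-vertex $3$-graph whose vertices can be cyclically ordered so that each edge consists of $3$ consecutive vertices and consecutive edges share exactly one vertex; a Hamilton cycle is a spanning one. A hypergraph is properly colored if every two intersecting edges receive different colors. -}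

module Defs where

open import Data.Nat using (ℕ; zero; suc; _+_; _*_; _<_; _%_)
open import Data.Nat.DivMod using (m%n<n)
open import Data.Fin using (Fin; fromℕ<)
open import Data.Fin.Subset using (Subset; ⁅_⁆; _∪_; _∩_; ∣_∣; Nonempty)
open import Data.Fin.Subset.Properties using (_∈?_)
open import Data.List using (List; length; filter)
open import Data.List.Relation.Unary.All using (All)
open import Data.List.Relation.Unary.Unique.Propositional using (Unique)
open import Data.List.Membership.Propositional using (_∈_)
open import Data.Product using (Σ; ∃; _×_; _,_)
open import Relation.Nullary using (¬_)
open import Relation.Nullary.Decidable using (_×-dec_)
open import Data.Nat using (_≟_)
open import Relation.Binary.PropositionalEquality using (_≡_; _≢_)
open import Function.Definitions using (Injective)
open import Data.Empty using (⊥)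

record ThreeGraph (n : ℕ) : Set where
  field
    edges   : List (Subset n)
    unique  : Unique edges
    uniform : All (λ e → ∣ e ∣ ≡ 3) edges
open ThreeGraph public

-- A colouring of the edges (defined on all subsets; only values on edges matter).
Colouring : ℕ → Set
Colouring n = Subset n → ℕ

deg : ∀ {n} → ThreeGraph n → Fin n → ℕ
deg H v = length (filter (λ e → v ∈? e) (edges H))

degCol : ∀ {n} → ThreeGraph n → Colouring n → ℕ → Fin n → ℕ
degCol H φ i v = length (filter (λ e → (v ∈? e) ×-dec (φ e ≟ i)) (edges H))

triple : ∀ {n} → Fin n → Fin n → Fin n → Subset n
triple a b c = ⁅ a ⁆ ∪ (⁅ b ⁆ ∪ ⁅ c ⁆)

-- Given a cyclic ordering σ (σ(k) = k-th vertex) of Fin (suc m),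
-- the vertex at position k (indices taken modulo the number of vertices).
pos : ∀ {m} → (Fin (suc m) → Fin (suc m)) → ℕ → Fin (suc m)
pos {m} σ k = σ (fromℕ< (m%n<n k (suc m)))

cycEdge : ∀ {m} → (Fin (suc m) → Fin (suc m)) → ℕ → Subset (suc m)
cycEdge σ j = triple (pos σ (2 * j)) (pos σ (2 * j + 1)) (pos σ (2 * j + 2))

HasPCLooseHamCycle : ∀ n → ThreeGraph n → Colouring n → Set
HasPCLooseHamCycle zero    H φ = ⊥
HasPCLooseHamCycle (suc m) H φ =
  Σ ℕ λ ℓ → (suc m ≡ 2 * ℓ) ×
  Σ (Fin (suc m) → Fin (suc m)) λ σ → Injective _≡_ _≡_ σ ×
    ((j : ℕ) → j < ℓ → cycEdge σ j ∈ edges H) ×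
    ((j k : ℕ) → j < ℓ → k < ℓ → j ≢ k →
       Nonempty (cycEdge σ j ∩ cycEdge σ k) → φ (cycEdge σ j) ≢ φ (cycEdge σ k))

{-# OPTIONS --safe #-}
-- The Hamilton cycle is assembled by absorption, with all probabilistic arguments replaced by counting of dense families.
-- In the link of a vertex v the vertices of linear degree form a set of size at least 5n/8 (as 7/16 > (5/8)²), so any two of
-- these sets meet. Hence two ends of paths are joined by a positive proportion of all paths with three edges (two edges would
-- not do, because their colours could be forced to agree), and every pair x, y of vertices has a positive proportion of
-- absorbers; few of them have a colour clash, since every colour is sparse at every vertex. Multiplicative weights yield
-- small disjoint families of connectors and of absorbers that serve all requests.
-- The remaining vertices are tiled by paths of bounded size: as long as many vertices u are uncovered, the link of u induces
-- on m random tiles a graph of density above 7/16, hence by Erdős–Gallai a matching of more than a quarter of the positions;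
-- blowing up a matching that occurs for a positive proportion of the choices, each matching edge together with uncovered
-- vertices spans a zigzag tile, and s copies of each of the m tiles are replaced by ms + 1 tiles.
module Submission where

-- The threshold 7/16 is where Erdős-Gallai meets the tile length. A graph on k vertices with more
-- than 2tk - t² ordered adjacent pairs, up to lower order terms and for t at most 2k/5, has more
-- than t disjoint edges, and t = k/4 gives 7k²/16. Tiles have 4s - 1 vertices: a zigzag takes s
-- copies of each end of one matching edge and 2s - 1 uncovered vertices, so each of ms + 1 matching
-- edges on the m(4s - 1) positions yields a tile, one more than were broken. Properness is local,
-- as only consecutive edges of a loose path meet. A clash of two of them is rare once two vertices
-- of one edge are random given the other edge; the gadgets are designed so that every consecutive
-- pair has this form. The scales are nested: n is about Zw, connectors and absorbers number O(w),
-- and tiles are so long that fewer than w of them fit. Left-over vertices, including those of idle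
-- connectors, are absorbed in pairs. Here n even enters: each edge after the first adds two
-- vertices to a path, so the left-over set is even.

module Development where

  open import Data.Bool using (Bool; true; false; T; _∧_; _∨_; not; if_then_else_)
  open import Data.Bool.Properties using (T-∧)
  open import Data.Empty using (⊥; ⊥-elim)
  open import Data.Fin using (Fin; inject≤; zero; suc; toℕ; fromℕ<; combine; #_)
  open import Data.Fin.Properties using (inject≤-injective; toℕ<n; toℕ-injective; toℕ-fromℕ<; combine-injective) renaming (_≟_ to _≟ᶠ_)
  open import Data.List using (List; []; _∷_; _++_; map; length; concat; concatMap; cartesianProductWith; cartesianProduct; allFin; filter; take; drop; lookup; tabulate; [_])
  open import Data.List.Properties using (tabulate-lookup; map-tabulate; length-map; length-++; ++-assoc; ++-identityʳ; length-tabulate; length-take; length-drop; take++drop≡id)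
  open import Data.List.Membership.Propositional using (_∈_; _∉_; find; lose)
  open import Data.List.Membership.Propositional.Properties using (∈-++⁺ˡ; ∈-++⁺ʳ; ∈-++⁻; ∈-map⁺; ∈-map⁻; ∈-allFin; ∈-cartesianProductWith⁺; ∈-concat⁻′; ∈-filter⁺; ∈-filter⁻; ∈-lookup)
  open import Data.List.Relation.Unary.Any as Any using (Any; here; there)
  open import Data.List.Relation.Unary.All as All using (All; []; _∷_)
  open import Data.List.Relation.Unary.AllPairs as AllPairs using (AllPairs; []; _∷_)
  open import Data.List.Relation.Unary.Unique.Propositional using (Unique)
  open import Data.List.Relation.Binary.Permutation.Propositional using (_↭_; ↭-refl; ↭-sym; ↭-trans; prep; swap; ↭-reflexive; module PermutationReasoning)
  open import Data.List.Relation.Binary.Permutation.Propositional.Properties using (↭-length; shift; shifts; ++⁺; ++⁺ˡ; ++⁺ʳ; ++-comm; map⁺; ∈-resp-↭; drop-∷; All-resp-↭)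
  open import Data.Nat using (ℕ; zero; suc; _+_; _*_; _∸_; _^_; _≤_; _<_; _≥_; _>_; z≤n; s≤s; NonZero; _≡ᵇ_; >-nonZero; >-nonZero⁻¹)
  open import Data.Nat.Properties renaming (_≟_ to _≟ⁿ_)
  open import Data.Nat.Tactic.RingSolver using (solve-∀)
  open import Data.Product using (Σ; ∃; _×_; _,_; proj₁; proj₂)
  open import Data.Sum using (_⊎_; inj₁; inj₂)
  open import Data.Unit using (⊤; tt)
  open import Data.Vec as Vec using (Vec; []; _∷_; _[_]≔_)
  open import Function using (_∘_; id; _$_; Equivalence)
  open import Relation.Binary.PropositionalEquality using (_≡_; _≢_; refl; sym; trans; cong; cong₂; subst; subst₂; module ≡-Reasoning)
  open import Relation.Nullary using (¬_; Dec; yes; no; contradiction)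
  open import Relation.Nullary.Decidable using (_×-dec_; _⊎-dec_; ¬?; T?; ⌊_⌋; toWitness; fromWitness; True)
  open import Data.List.Relation.Unary.Unique.Propositional.Properties using (allFin⁺)
  open import Data.Vec.Properties using (lookup∘update; lookup∘update′; length-toList; lookup-++ˡ; lookup-++ʳ; tabulate-cong; lookup∘tabulate; toList∘fromList)
  open import Data.Vec.Properties using () renaming (≡-dec to ≡-decᵛ)
  open import Data.Maybe using (Maybe; just; nothing; from-just)
  open import Data.List.Relation.Unary.All.Properties using (¬Any⇒All¬) renaming (++⁺ to All-++⁺)
  open import Data.List.Relation.Unary.Any.Properties using (lookup-index)
  open import Data.Nat.DivMod using (m%n<n; m<n⇒m%n≡m; _/_; _%_; m≡m%n+[m/n]*n; m/n*n≤m)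
  import Data.List.Relation.Unary.Unique.Propositional.Properties as Uniqueₚ
  import Data.List.Relation.Unary.AllPairs.Properties as AllPairsₚ
  import Data.List.Relation.Unary.All.Properties as Allₚ
  open import Data.List.Relation.Binary.Disjoint.Propositional using (Disjoint)
  open import Data.List.Membership.Propositional.Properties using (∈-tabulate⁻)

  -- Dense families of tuples

  ∑ : {A : Set} → List A → (A → ℕ) → ℕ
  ∑ []       f = 0
  ∑ (x ∷ xs) f = f x + ∑ xs f

  ⟦_⟧ : Bool → ℕ
  ⟦ true ⟧  = 1
  ⟦ false ⟧ = 0

  ⟦⟧≤1 : ∀ b → ⟦ b ⟧ ≤ 1
  ⟦⟧≤1 true  = ≤-refl
  ⟦⟧≤1 false = z≤n

  ⟦T⟧ : ∀ {b} → T b → ⟦ b ⟧ ≡ 1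
  ⟦T⟧ {true} _ = refl

  ⟦∨⟧ : ∀ a b → ⟦ a ∨ b ⟧ ≤ ⟦ a ⟧ + ⟦ b ⟧
  ⟦∨⟧ true  b = s≤s z≤n
  ⟦∨⟧ false b = ≤-refl

  0<⟦⟧ : ∀ {b} → 0 < ⟦ b ⟧ → T b
  0<⟦⟧ {true} _ = tt

  ⟦⟧-⇒ : ∀ {a b} → (T a → T b) → ⟦ a ⟧ ≤ ⟦ b ⟧
  ⟦⟧-⇒ {false}        h = z≤n
  ⟦⟧-⇒ {true} {true}  h = ≤-refl
  ⟦⟧-⇒ {true} {false} h = ⊥-elim (h tt)

  module _ {A : Set} where

    ∑-mono-∈ : (xs : List A) {f g : A → ℕ} → (∀ {x} → x ∈ xs → f x ≤ g x) → ∑ xs f ≤ ∑ xs g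
    ∑-mono-∈ []       h = z≤n
    ∑-mono-∈ (x ∷ xs) h = +-mono-≤ (h (here refl)) (∑-mono-∈ xs (λ m → h (there m)))

    ∑-mono : (xs : List A) {f g : A → ℕ} → (∀ x → f x ≤ g x) → ∑ xs f ≤ ∑ xs g
    ∑-mono xs h = ∑-mono-∈ xs (λ {x} _ → h x)

    ∑-cong : (xs : List A) {f g : A → ℕ} → (∀ x → f x ≡ g x) → ∑ xs f ≡ ∑ xs g
    ∑-cong []       h = refl
    ∑-cong (x ∷ xs) h = cong₂ _+_ (h x) (∑-cong xs h)

    ∑-+ : (xs : List A) (f g : A → ℕ) → ∑ xs (λ x → f x + g x) ≡ ∑ xs f + ∑ xs g
    ∑-+ []       f g = refl
    ∑-+ (x ∷ xs) f g rewrite ∑-+ xs f g = lem (f x) (g x) (∑ xs f) (∑ xs g)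
      where
      lem : ∀ a b c d → a + b + (c + d) ≡ a + c + (b + d)
      lem = solve-∀

    ∑-* : (xs : List A) (k : ℕ) (f : A → ℕ) → ∑ xs (λ x → k * f x) ≡ k * ∑ xs f
    ∑-* []       k f = sym (*-zeroʳ k)
    ∑-* (x ∷ xs) k f rewrite ∑-* xs k f = sym (*-distribˡ-+ k (f x) (∑ xs f))

    ∑-*ʳ : (xs : List A) (k : ℕ) (f : A → ℕ) → ∑ xs (λ x → f x * k) ≡ ∑ xs f * k
    ∑-*ʳ xs k f = trans (∑-cong xs (λ x → *-comm (f x) k)) (trans (∑-* xs k f) (*-comm k _))

    ∑-const : (xs : List A) (k : ℕ) → ∑ xs (λ _ → k) ≡ length xs * k
    ∑-const []       k = refl
    ∑-const (x ∷ xs) k = cong (k +_) (∑-const xs k)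

    ∑-≤const : (xs : List A) {f : A → ℕ} {k : ℕ} → (∀ x → f x ≤ k) → ∑ xs f ≤ length xs * k
    ∑-≤const xs {k = k} h = ≤-trans (∑-mono xs h) (≤-reflexive (∑-const xs k))

    ∑-≥const : (xs : List A) {f : A → ℕ} {k : ℕ} → (∀ x → k ≤ f x) → length xs * k ≤ ∑ xs f
    ∑-≥const xs {k = k} h = ≤-trans (≤-reflexive (sym (∑-const xs k))) (∑-mono xs h)

    ∑-++ : (xs ys : List A) (f : A → ℕ) → ∑ (xs ++ ys) f ≡ ∑ xs f + ∑ ys f
    ∑-++ []       ys f = refl
    ∑-++ (x ∷ xs) ys f = trans (cong (f x +_) (∑-++ xs ys f)) (sym (+-assoc (f x) _ _))

    ∑-↭ : {xs ys : List A} (f : A → ℕ) → xs ↭ ys → ∑ xs f ≡ ∑ ys f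
    ∑-↭ f _↭_.refl        = refl
    ∑-↭ f (prep x p)      = cong (f x +_) (∑-↭ f p)
    ∑-↭ f (swap {xs} x y p) rewrite ∑-↭ f p = lem (f x) (f y) _
      where
      lem : ∀ a b c → a + (b + c) ≡ b + (a + c)
      lem = solve-∀
    ∑-↭ f (_↭_.trans p q) = trans (∑-↭ f p) (∑-↭ f q)

    ∑-map : {B : Set} (h : B → A) (ys : List B) (f : A → ℕ) → ∑ (map h ys) f ≡ ∑ ys (f ∘ h)
    ∑-map h []       f = refl
    ∑-map h (y ∷ ys) f = cong (f (h y) +_) (∑-map h ys f)

    ∑-concat : (xss : List (List A)) (f : A → ℕ) → ∑ (concat xss) f ≡ ∑ xss (λ xs → ∑ xs f)
    ∑-concat []         f = refl
    ∑-concat (xs ∷ xss) f = trans (∑-++ xs (concat xss) f) (cong (∑ xs f +_) (∑-concat xss f))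

    term≤∑ : {xs : List A} (f : A → ℕ) {x : A} → x ∈ xs → f x ≤ ∑ xs f
    term≤∑ f (here refl) = m≤m+n _ _
    term≤∑ {y ∷ xs} f (there m) = ≤-trans (term≤∑ f m) (m≤n+m _ (f y))

    ∑-exceeds : (xs : List A) (f g : A → ℕ) → ∑ xs f < ∑ xs g → ∃ λ x → x ∈ xs × f x < g x
    ∑-exceeds (x ∷ xs) f g h with f x <? g x
    ... | yes p = x , here refl , p
    ... | no ¬p with ∑-exceeds xs f g (+-cancelˡ-< (f x) _ _ (<-≤-trans h (+-monoˡ-≤ (∑ xs g) (≮⇒≥ ¬p))))
    ...   | y , m , q = y , there m , q

    ∑-average : (xs : List A) (k : ℕ) (f : A → ℕ) → 0 < length xs → length xs * k ≤ ∑ xs f →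
                ∃ λ x → x ∈ xs × k ≤ f x
    ∑-average xs k f pos h
      with ∑-exceeds xs (λ _ → k) (suc ∘ f)
           (≤-<-trans (≤-trans (≤-reflexive (∑-const xs k)) h)
             (<-≤-trans (m<m+n (∑ xs f) pos)
               (≤-reflexive (trans (cong (∑ xs f +_) (sym (trans (∑-const xs 1) (*-identityʳ _))))
                 (trans (sym (∑-+ xs f (λ _ → 1))) (∑-cong xs (λ x → +-comm (f x) 1)))))))
    ... | x , m , s≤s q = x , m , q

  ∑-swap : {A B : Set} (xs : List A) (ys : List B) (f : A → B → ℕ) →
           ∑ xs (λ x → ∑ ys (f x)) ≡ ∑ ys (λ y → ∑ xs (λ x → f x y))
  ∑-swap []       ys f = sym (trans (∑-const ys 0) (*-zeroʳ (length ys)))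
  ∑-swap (x ∷ xs) ys f = trans (cong (∑ ys (f x) +_) (∑-swap xs ys f)) (sym (∑-+ ys (f x) _))

  ∑-cart : {A B C : Set} (g : A → B → C) (xs : List A) (ys : List B) (f : C → ℕ) →
           ∑ (cartesianProductWith g xs ys) f ≡ ∑ xs (λ x → ∑ ys (λ y → f (g x y)))
  ∑-cart g []       ys f = refl
  ∑-cart g (x ∷ xs) ys f = trans (∑-++ (map (g x) ys) _ f) (cong₂ _+_ (∑-map (g x) ys f) (∑-cart g xs ys f))

  length≡∑ : {A : Set} (xs : List A) → length xs ≡ ∑ xs (λ _ → 1)
  length≡∑ xs = sym (trans (∑-const xs 1) (*-identityʳ _))

  length-cart : {A B C : Set} (g : A → B → C) (xs : List A) (ys : List B) →
                length (cartesianProductWith g xs ys) ≡ length xs * length ys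
  length-cart g xs ys = trans (length≡∑ (cartesianProductWith g xs ys)) (trans (∑-cart g xs ys (λ _ → 1))
    (trans (∑-cong xs (λ _ → sym (length≡∑ ys))) (∑-const xs (length ys))))

  -- `test` is a decidable witness, so that P may be an arbitrary type.
  record Dense {A : Set} (xs : List A) (D : ℕ) (P : A → Set) : Set where
    constructor dense
    field
      test  : A → Bool
      sound : ∀ x → T (test x) → P x
      bound : length xs ≤ D * ∑ xs (λ x → ⟦ test x ⟧)

  open Dense public

  module _ {A : Set} {xs : List A} where

    dense-mono : ∀ {D} {P Q : A → Set} → (∀ x → P x → Q x) → Dense xs D P → Dense xs D Q
    dense-mono h (dense t s b) = dense t (λ x p → h x (s x p)) b

    dense-weaken : ∀ {D D'} {P : A → Set} → D ≤ D' → Dense xs D P → Dense xs D' P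
    dense-weaken le (dense t s b) = dense t s (≤-trans b (*-monoˡ-≤ _ le))

    dense-∃ : ∀ {D} {P : A → Set} → 0 < length xs → Dense xs D P → ∃ λ x → x ∈ xs × P x
    dense-∃ {D} pos (dense t s b) with ∑-exceeds xs (λ _ → 0) (λ x → ⟦ t x ⟧) (lem (≤-trans pos b))
      where
      lem : ∀ {c} → 0 < D * c → ∑ xs (λ _ → 0) < c
      lem {zero}  p rewrite *-zeroʳ D = contradiction p (λ ())
      lem {suc c} p rewrite ∑-const xs 0 | *-zeroʳ (length xs) = s≤s z≤n
    ... | x , m , q = x , m , s x (0<⟦⟧ q)

    -- The exceptions make up at most half of the guaranteed proportion 1/D, so doubling the
    -- constant pays for them.
    dense-∖ : ∀ {D} {P : A → Set} (bad : A → Bool) → 2 * D * ∑ xs (λ x → ⟦ bad x ⟧) ≤ length xs →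
              Dense xs D P → Dense xs (2 * D) (λ x → P x × bad x ≡ false)
    dense-∖ {D} {P} bad few (dense t s b) = dense t′ s′ (+-cancelʳ-≤ (length xs) _ _ (begin
      length xs + length xs           ≤⟨ +-mono-≤ b b ⟩
      D * ∑t + D * ∑t                 ≡⟨ lem₁ D ∑t ⟩
      2 * D * ∑t                      ≤⟨ *-monoʳ-≤ (2 * D) (≤-trans (∑-mono xs split) (≤-reflexive (∑-+ xs _ _))) ⟩
      2 * D * (∑ xs (λ x → ⟦ t′ x ⟧) + ∑ xs (λ x → ⟦ bad x ⟧)) ≡⟨ *-distribˡ-+ (2 * D) _ _ ⟩
      _                               ≤⟨ +-monoʳ-≤ _ few ⟩
      2 * D * ∑ xs (λ x → ⟦ t′ x ⟧) + length xs ∎))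
      where
      open ≤-Reasoning
      ∑t = ∑ xs (λ x → ⟦ t x ⟧)
      t′ : A → Bool
      t′ x = t x ∧ not (bad x)
      s′ : ∀ x → T (t′ x) → P x × bad x ≡ false
      s′ x p with t x in e | bad x
      ... | true | false = s x (subst T (sym e) tt) , refl
      split : ∀ x → ⟦ t x ⟧ ≤ ⟦ t′ x ⟧ + ⟦ bad x ⟧
      split x with t x | bad x
      ... | true  | true  = s≤s z≤n
      ... | true  | false = s≤s z≤n
      ... | false | _     = z≤n
      lem₁ : ∀ d c → d * c + d * c ≡ 2 * d * c
      lem₁ = solve-∀

  -- In iterated sampling the second test is known only from a proof that the first one succeeded;
  -- `guard` hands that proof on.
  guard : {B : Set} (b : Bool) → (T b → B → Bool) → B → Bool
  guard true  k y = k tt y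
  guard false k y = false

  guard-sound : {B : Set} (b : Bool) (k : T b → B → Bool) (y : B) → T (guard b k y) → Σ (T b) λ p → T (k p y)
  guard-sound true k y q = tt , q

  module _ {A B C : Set} (g : A → B → C) (π₁ : C → A) (π₂ : C → B) (η : ∀ c → g (π₁ c) (π₂ c) ≡ c)
    (β₁ : ∀ a b → π₁ (g a b) ≡ a) (β₂ : ∀ a b → π₂ (g a b) ≡ b) where

    -- Sequential sampling: proportions multiply. The set from which the second sample is drawn may
    -- depend on what has been learnt about the first.
    dense-cart : ∀ {xs ys D D'} {P : C → Set} → Dense xs D (λ a → Dense ys D' (λ b → P (g a b))) →
                 Dense (cartesianProductWith g xs ys) (D * D') P
    dense-cart {xs} {ys} {D} {D'} {P} (dense t s b) = dense t′ s′ (begin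
      length (cartesianProductWith g xs ys)               ≡⟨ length-cart g xs ys ⟩
      length xs * length ys                               ≤⟨ *-monoˡ-≤ (length ys) b ⟩
      D * ∑ xs (λ x → ⟦ t x ⟧) * length ys                ≡⟨ *-assoc D _ _ ⟩
      D * (∑ xs (λ x → ⟦ t x ⟧) * length ys)              ≡⟨ cong (D *_) (sym (∑-*ʳ xs (length ys) _)) ⟩
      D * ∑ xs (λ x → ⟦ t x ⟧ * length ys)                ≤⟨ *-monoʳ-≤ D (∑-mono xs row) ⟩
      D * ∑ xs (λ x → D' * ∑ ys (λ y → ⟦ t″ x y ⟧))       ≡⟨ cong (D *_) (∑-* xs D' _) ⟩
      D * (D' * ∑ xs (λ x → ∑ ys (λ y → ⟦ t″ x y ⟧)))     ≡⟨ sym (*-assoc D D' _) ⟩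
      D * D' * ∑ xs (λ x → ∑ ys (λ y → ⟦ t″ x y ⟧))       ≡⟨ cong (D * D' *_) (sym (trans (∑-cart g xs ys _)
                                                              (∑-cong xs (λ x → ∑-cong ys (λ y →
                                                                cong₂ (λ u v → ⟦ t″ u v ⟧) (β₁ x y) (β₂ x y)))))) ⟩
      D * D' * ∑ (cartesianProductWith g xs ys) (λ c → ⟦ t′ c ⟧) ∎)
      where
      open ≤-Reasoning
      t″ : A → B → Bool
      t″ a = guard (t a) (λ p → test (s a p))
      t′ : C → Bool
      t′ c = t″ (π₁ c) (π₂ c)
      s′ : ∀ c → T (t′ c) → P c
      s′ c p with guard-sound (t (π₁ c)) (λ q → test (s (π₁ c) q)) (π₂ c) p
      ... | q , r = subst P (η c) (sound (s (π₁ c) q) (π₂ c) r)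
      row : ∀ x → ⟦ t x ⟧ * length ys ≤ D' * ∑ ys (λ y → ⟦ t″ x y ⟧)
      row x with t x | s x
      ... | false | _ = z≤n
      ... | true  | k = ≤-trans (≤-reflexive (*-identityˡ _)) (bound (k tt))

  module _ {A B : Set} (xs : List A) (ys : List B) where

    -- Reverse Markov inequality: rows below the proportion 1/(2D) contain at most half of the
    -- guaranteed pairs, and any other row holds at most `length ys` of them.
    dense-rows : ∀ D (f : A → B → Bool) → 0 < length ys →
                 length xs * length ys ≤ D * ∑ xs (λ x → ∑ ys (λ y → ⟦ f x y ⟧)) →
                 Dense xs (2 * D) (λ x → Dense ys (2 * D) (λ y → T (f x y)))
    dense-rows D f pos h = dense t s (*-cancelʳ-≤ _ _ (length ys) {{>-nonZero pos}} (+-cancelʳ-≤ (length xs * length ys) _ _ (begin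
      length xs * length ys + length xs * length ys ≤⟨ +-mono-≤ h h ⟩
      D * S + D * S                                 ≡⟨ lem₁ D S ⟩
      2 * D * S                                     ≡⟨ sym (∑-* xs (2 * D) _) ⟩
      ∑ xs (λ x → 2 * D * row x)                    ≤⟨ ∑-mono xs bnd ⟩
      ∑ xs (λ x → 2 * D * length ys * ⟦ t x ⟧ + length ys) ≡⟨ trans (∑-+ xs _ _) (cong₂ _+_ (∑-* xs (2 * D * length ys) _) (∑-const xs (length ys))) ⟩
      2 * D * length ys * ∑ xs (λ x → ⟦ t x ⟧) + length xs * length ys ≡⟨ cong (_+ length xs * length ys) (lem₂ (2 * D) (length ys) _) ⟩
      2 * D * ∑ xs (λ x → ⟦ t x ⟧) * length ys + length xs * length ys ∎)))
      where
      open ≤-Reasoning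
      row : A → ℕ
      row x = ∑ ys (λ y → ⟦ f x y ⟧)
      S = ∑ xs row
      t : A → Bool
      t x = ⌊ length ys ≤? 2 * D * row x ⌋
      s : ∀ x → T (t x) → Dense ys (2 * D) (λ y → T (f x y))
      s x p with length ys ≤? 2 * D * row x
      ... | yes q = dense (f x) (λ _ → id) q
      lem₁ : ∀ d c → d * c + d * c ≡ 2 * d * c
      lem₁ = solve-∀
      lem₂ : ∀ a b c → a * b * c ≡ a * c * b
      lem₂ = solve-∀
      bnd : ∀ x → 2 * D * row x ≤ 2 * D * length ys * ⟦ t x ⟧ + length ys
      bnd x with length ys ≤? 2 * D * row x
      ... | yes q rewrite *-identityʳ (2 * D * length ys) = ≤-trans (*-monoʳ-≤ (2 * D)
                    (≤-trans (∑-≤const ys (λ y → ⟦⟧≤1 (f x y))) (≤-reflexive (*-identityʳ _)))) (m≤m+n _ _)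
      ... | no ¬q = ≤-trans (<⇒≤ (≰⇒> ¬q)) (m≤n+m _ _)

  -- Exchanges the order of sampling. It is what allows a second, independent draw of the coordinate
  -- that was originally drawn first, for the same value of the other one.
  dense-fubini : {A B : Set} (xs : List A) (ys : List B) → ∀ {D D'} {P : A → B → Set} → 0 < length xs → Dense xs D (λ x → Dense ys D' (P x)) →
                 Dense ys (2 * (D * D')) (λ y → Dense xs (2 * (D * D')) (λ x → P x y))
  dense-fubini xs ys {D} {D'} {P} pos d = dense-mono (λ y → dense-mono (λ x → sound e (x , y)))
      (dense-rows ys xs (D * D') (λ y x → test e (x , y)) pos (begin
        length ys * length xs                                       ≡⟨ *-comm (length ys) _ ⟩
        length xs * length ys                                       ≡⟨ sym (length-cart _,_ xs ys) ⟩
        length (cartesianProduct xs ys)                             ≤⟨ bound e ⟩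
        D * D' * ∑ (cartesianProduct xs ys) (λ c → ⟦ test e c ⟧)    ≡⟨ cong (D * D' *_) (trans (∑-cart _,_ xs ys _) (∑-swap xs ys _)) ⟩
        D * D' * ∑ ys (λ y → ∑ xs (λ x → ⟦ test e (x , y) ⟧))       ∎))
    where
    open ≤-Reasoning
    e : Dense (cartesianProduct xs ys) (D * D') (λ c → P (proj₁ c) (proj₂ c))
    e = dense-cart _,_ proj₁ proj₂ (λ _ → refl) (λ _ _ → refl) (λ _ _ → refl) d

  vecs : {A : Set} → List A → (N : ℕ) → List (Vec A N)
  vecs xs zero    = [ [] ]
  vecs xs (suc N) = cartesianProductWith _∷_ xs (vecs xs N)

  module _ {A : Set} {xs : List A} where

    length-vecs : ∀ N → length (vecs xs N) ≡ length xs ^ N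
    length-vecs zero    = refl
    length-vecs (suc N) = trans (length-cart _∷_ xs (vecs xs N)) (cong (length xs *_) (length-vecs N))

    ∈-vecs : (∀ a → a ∈ xs) → ∀ {N} (t : Vec A N) → t ∈ vecs xs N
    ∈-vecs h []      = here refl
    ∈-vecs h (a ∷ t) = ∈-cartesianProductWith⁺ _∷_ (h a) (∈-vecs h t)

    0<vecs : 0 < length xs → ∀ N → 0 < length (vecs xs N)
    0<vecs pos N rewrite length-vecs N = >-nonZero⁻¹ _ {{m^n≢0 (length xs) N {{>-nonZero pos}}}}

    ∑-vecs-suc : ∀ N (f : Vec A (suc N) → ℕ) → ∑ (vecs xs (suc N)) f ≡ ∑ xs (λ a → ∑ (vecs xs N) (λ t → f (a ∷ t)))
    ∑-vecs-suc N f = ∑-cart _∷_ xs (vecs xs N) f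

    -- Overwriting coordinate `i` produces every tuple `length xs` times. This replaces
    -- independence: one coordinate is redrawn while everything that avoids it stays fixed.
    ∑-update : ∀ {N} (i : Fin N) (f : Vec A N → ℕ) →
               length xs * ∑ (vecs xs N) f ≡ ∑ (vecs xs N) (λ t → ∑ xs (λ a → f (t [ i ]≔ a)))
    ∑-update {suc N} zero f = begin
      length xs * ∑ (vecs xs (suc N)) f                                     ≡⟨ cong (length xs *_) (trans (∑-vecs-suc N f) (∑-swap xs (vecs xs N) _)) ⟩
      length xs * ∑ (vecs xs N) (λ t → ∑ xs (λ a → f (a ∷ t)))              ≡⟨ sym (∑-const xs _) ⟩
      ∑ xs (λ _ → ∑ (vecs xs N) (λ t → ∑ xs (λ a → f (a ∷ t))))             ≡⟨ sym (∑-vecs-suc N _) ⟩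
      ∑ (vecs xs (suc N)) (λ t → ∑ xs (λ a → f (a ∷ Vec.tail t)))           ≡⟨ ∑-cong (vecs xs (suc N)) (λ { (_ ∷ _) → refl }) ⟩
      ∑ (vecs xs (suc N)) (λ t → ∑ xs (λ a → f (t [ zero ]≔ a)))            ∎
      where open ≡-Reasoning
    ∑-update {suc N} (suc i) f = begin
      length xs * ∑ (vecs xs (suc N)) f                                     ≡⟨ cong (length xs *_) (∑-vecs-suc N f) ⟩
      length xs * ∑ xs (λ b → ∑ (vecs xs N) (λ t → f (b ∷ t)))              ≡⟨ sym (∑-* xs (length xs) _) ⟩
      ∑ xs (λ b → length xs * ∑ (vecs xs N) (λ t → f (b ∷ t)))              ≡⟨ ∑-cong xs (λ b → ∑-update i (λ t → f (b ∷ t))) ⟩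
      ∑ xs (λ b → ∑ (vecs xs N) (λ t → ∑ xs (λ a → f (b ∷ (t [ i ]≔ a)))))  ≡⟨ sym (∑-vecs-suc N _) ⟩
      ∑ (vecs xs (suc N)) (λ t → ∑ xs (λ a → f (t [ suc i ]≔ a)))           ∎
      where open ≡-Reasoning

    dense-∷ : ∀ {N D D'} {P : Vec A (suc N) → Set} → Dense xs D (λ a → Dense (vecs xs N) D' (λ t → P (a ∷ t))) →
              Dense (vecs xs (suc N)) (D * D') P
    dense-∷ = dense-cart _∷_ Vec.head Vec.tail (λ { (_ ∷ _) → refl }) (λ _ _ → refl) (λ _ _ → refl)

    dense-vec1 : ∀ {D} {P : Vec A 1 → Set} → Dense xs D (λ a → P (a ∷ [])) → Dense (vecs xs 1) (D * 1) P
    dense-vec1 d = dense-∷ (dense-mono (λ a p → dense (λ _ → true) (λ { [] _ → p }) ≤-refl) d)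

    dense-uncons : ∀ {N D} {P : Vec A (suc N) → Set} → 0 < length (vecs xs N) → Dense (vecs xs (suc N)) D P →
                   Dense xs (2 * D) (λ a → Dense (vecs xs N) (2 * D) (λ t → P (a ∷ t)))
    dense-uncons {N} {D} pos (dense t s b) = dense-mono (λ a → dense-mono (λ t → s (a ∷ t)))
      (dense-rows xs (vecs xs N) D (λ a u → t (a ∷ u)) pos
        (subst₂ (λ u v → u ≤ D * v) (length-cart _∷_ xs (vecs xs N)) (∑-vecs-suc N _) b))

    ∑-vecs-++ : ∀ N N' (f : Vec A (N + N') → ℕ) →
                ∑ (vecs xs (N + N')) f ≡ ∑ (vecs xs N) (λ t → ∑ (vecs xs N') (λ u → f (t Vec.++ u)))
    ∑-vecs-++ zero    N' f = sym (+-identityʳ _)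
    ∑-vecs-++ (suc N) N' f = trans (∑-vecs-suc (N + N') f)
      (trans (∑-cong xs (λ a → ∑-vecs-++ N N' (λ t → f (a ∷ t)))) (sym (∑-vecs-suc N _)))

    dense-++ : ∀ N {N' D D'} {P : Vec A (N + N') → Set} →
               Dense (vecs xs N) D (λ t → Dense (vecs xs N') D' (λ u → P (t Vec.++ u))) →
               Dense (vecs xs (N + N')) (D * D') P
    dense-++ N {N'} {D} {D'} {P} d = dense (test e ∘ splt) s′
        (subst₂ (λ u v → u ≤ D * D' * v) lengths sums (bound e))
      where
      splt : Vec A (N + N') → Vec A N × Vec A N'
      splt v = Vec.take N v , Vec.drop N v
      take-++ : ∀ {m n} (t : Vec A m) (u : Vec A n) → Vec.take m (t Vec.++ u) ≡ t
      take-++ []      u = refl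
      take-++ (x ∷ t) u = cong (x ∷_) (take-++ t u)
      drop-++ : ∀ {m n} (t : Vec A m) (u : Vec A n) → Vec.drop m (t Vec.++ u) ≡ u
      drop-++ []      u = refl
      drop-++ (x ∷ t) u = drop-++ t u
      join : ∀ m {n} (v : Vec A (m + n)) → Vec.take m v Vec.++ Vec.drop m v ≡ v
      join zero    v       = refl
      join (suc m) (x ∷ v) = cong (x ∷_) (join m v)
      e : Dense (cartesianProduct (vecs xs N) (vecs xs N')) (D * D') (λ c → P (proj₁ c Vec.++ proj₂ c))
      e = dense-cart _,_ proj₁ proj₂ (λ _ → refl) (λ _ _ → refl) (λ _ _ → refl) d
      s′ : ∀ v → T (test e (splt v)) → P v
      s′ v p = subst P (join N v) (sound e (splt v) p)
      lengths : length (cartesianProduct (vecs xs N) (vecs xs N')) ≡ length (vecs xs (N + N'))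
      lengths = trans (length-cart _,_ (vecs xs N) (vecs xs N')) (trans (cong₂ _*_ (length-vecs N) (length-vecs N'))
        (trans (sym (^-distribˡ-+-* (length xs) N N')) (sym (length-vecs (N + N')))))
      sums : ∑ (cartesianProduct (vecs xs N) (vecs xs N')) (λ c → ⟦ test e c ⟧) ≡ ∑ (vecs xs (N + N')) (λ v → ⟦ test e (splt v) ⟧)
      sums = trans (∑-cart _,_ (vecs xs N) (vecs xs N') _) (sym (trans (∑-vecs-++ N N' _)
        (∑-cong (vecs xs N) (λ t → ∑-cong (vecs xs N') (λ u → cong (λ c → ⟦ test e c ⟧) (cong₂ _,_ (take-++ t u) (drop-++ t u)))))))

    dense-power : ∀ N {D} {P : A → Set} → Dense xs D P → Dense (vecs xs N) (D ^ N) (λ t → ∀ i → P (Vec.lookup t i))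
    dense-power zero    d = dense (λ _ → true) (λ { [] _ () }) ≤-refl
    dense-power (suc N) d = dense-∷ (dense-mono (λ a p → dense-mono (λ { t q zero → p ; t q (suc i) → q i }) (dense-power N d)) d)

  -- Properly coloured loose paths and their patterns

  any-count : {A : Set} {P : A → Set} (P? : ∀ x → Dec (P x)) (xs : List A) →
              ⟦ ⌊ Any.any? P? xs ⌋ ⟧ ≤ ∑ xs (λ x → ⟦ ⌊ P? x ⌋ ⟧)
  any-count P? xs with Any.any? P? xs
  ... | no  _ = z≤n
  ... | yes a with find a
  ...   | x , m , p = ≤-trans (≤-reflexive (sym (⟦T⟧ {⌊ P? x ⌋} (fromWitness p)))) (term≤∑ (λ y → ⟦ ⌊ P? y ⌋ ⟧) m)

  module _ {A : Set} {n : ℕ} (h : A → Fin n) (inj : ∀ {x y} → h x ≡ h y → x ≡ y) (v : Fin n) where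

    ∑-absent : (xs : List A) → All (λ y → h y ≢ v) xs → ∑ xs (λ x → ⟦ ⌊ h x ≟ᶠ v ⌋ ⟧) ≡ 0
    ∑-absent []       _ = refl
    ∑-absent (x ∷ xs) (p ∷ ps) with h x ≟ᶠ v
    ... | yes q = contradiction q p
    ... | no  _ = ∑-absent xs ps

    ∑-unique≤1 : (xs : List A) → Unique xs → ∑ xs (λ x → ⟦ ⌊ h x ≟ᶠ v ⌋ ⟧) ≤ 1
    ∑-unique≤1 []       _ = z≤n
    ∑-unique≤1 (x ∷ xs) (x∉ ∷ u) with h x ≟ᶠ v
    ... | yes q = ≤-reflexive (cong suc (∑-absent xs (All.map (λ {y} x≢y hy → x≢y (inj (trans q (sym hy)))) x∉)))
    ... | no  _ = ∑-unique≤1 xs u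

  length-allFin : ∀ n → length (allFin n) ≡ n
  length-allFin n = length-tabulate id

  length-cells : {A B : Set} {q : ℕ} (f : A → List B) → (∀ a → length (f a) ≡ q) → ∀ xs → length (concatMap f xs) ≡ length xs * q
  length-cells f h []       = refl
  length-cells f h (x ∷ xs) = trans (length-++ (f x)) (cong₂ _+_ (h x) (length-cells f h xs))

  record Coloured (n : ℕ) : Set where
    field
      E        : Fin n → Fin n → Fin n → Bool
      col      : Fin n → Fin n → Fin n → ℕ
      E-rot    : ∀ a b c → E a b c ≡ E b c a
      E-swap   : ∀ a b c → E a b c ≡ E a c b
      col-rot  : ∀ a b c → col a b c ≡ col b c a
      col-swap : ∀ a b c → col a b c ≡ col a c b

  module Links {n : ℕ} (H : Coloured n) where

    open Coloured H public

    V : Set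
    V = Fin n

    -- The last edge of a path, in path order: it is all a continuation of the path depends on.
    Port : Set
    Port = V × V × V

    corners : Port → List V
    corners (a , b , c) = a ∷ b ∷ c ∷ []

    IsEdge : Port → Set
    IsEdge (a , b , c) = T (E a b c)

    -- Unequal colours on consecutive edges are all that a loose path requires. Distinctness of the
    -- vertices is kept out of `Link` and is recovered at the end, when the whole cycle is a
    -- permutation of the vertex set.
    Link : Port → List V → Port → Set
    Link e           []          f = e ≡ f
    Link e           (_ ∷ [])    f = ⊥
    Link (a , b , c) (d ∷ x ∷ r) f = T (E c d x) × col a b c ≢ col c d x × Link (c , d , x) r f

    Linked : Port → List V → Port → Set
    Linked e           []          f = e ≡ f
    Linked e           (_ ∷ [])    f = ⊥
    Linked (a , b , c) (d ∷ x ∷ r) f = T (E c d x) × Linked (c , d , x) r f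

    -- Both edge tests are included so that a clash is an edge of a prescribed colour at the shared
    -- vertex, whichever of the two edges is regarded as random.
    clash : Port → List V → Bool
    clash e           []          = false
    clash e           (_ ∷ [])    = false
    clash (a , b , c) (d ∷ x ∷ r) = (E a b c ∧ E c d x ∧ (col a b c ≡ᵇ col c d x)) ∨ clash (c , d , x) r

    Linked⇒Link : ∀ e r {f} → IsEdge e → Linked e r f → clash e r ≡ false → Link e r f
    Linked⇒Link e [] h l _ = l
    Linked⇒Link (a , b , c) (d ∷ x ∷ r) h (k , l) q with E a b c | E c d x in e₂ | col a b c ≡ᵇ col c d x in e₃
    ... | true | true | false = tt , (λ eq → subst T e₃ (≡⇒≡ᵇ (col a b c) (col c d x) eq)) , Linked⇒Link (c , d , x) r (subst T (sym e₂) tt) l q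

    Link-++ : ∀ e r {f} r' {g} → Link e r f → Link f r' g → Link e (r ++ r') g
    Link-++ e           []          r' refl        l' = l'
    Link-++ (a , b , c) (d ∷ x ∷ r) r' (p , q , l) l' = p , q , Link-++ (c , d , x) r r' l l'

    Link-edge : ∀ e r {f} → IsEdge e → Link e r f → IsEdge f
    Link-edge e           []          h refl        = h
    Link-edge (a , b , c) (d ∷ x ∷ r) h (p , q , l) = Link-edge (c , d , x) r p l

    _≟ᵖ_ : (e f : Port) → Dec (e ≡ f)
    (a , b , c) ≟ᵖ (a' , b' , c') with a ≟ᶠ a' | b ≟ᶠ b' | c ≟ᶠ c'
    ... | yes refl | yes refl | yes refl = yes refl
    ... | no ¬p    | _        | _        = no λ { refl → ¬p refl }
    ... | yes _    | no ¬p    | _        = no λ { refl → ¬p refl }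
    ... | yes _    | yes _    | no ¬p    = no λ { refl → ¬p refl }

    Link? : ∀ e r f → Dec (Link e r f)
    Link? e           []          f = e ≟ᵖ f
    Link? e           (_ ∷ [])    f = no λ ()
    Link? (a , b , c) (d ∷ x ∷ r) f = T? (E c d x) ×-dec ¬? (col a b c ≟ⁿ col c d x) ×-dec Link? (c , d , x) r f

    colourCount : V → ℕ → V → V → ℕ
    colourCount w κ a b = ⟦ E w a b ∧ (col w a b ≡ᵇ κ) ⟧

  -- Vertices of a path pattern over random cells t₁, …, t_N ∈ Fin M: `var i p` is the vertex at position p of the
  -- i-th cell, `con k` the k-th vertex of a prescribed vector.
  data Tm (r N q : ℕ) : Set where
    con : Fin r → Tm r N q
    var : Fin N → Fin q → Tm r N q

  module _ {r N q : ℕ} where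

    PortT : Set
    PortT = Tm r N q × Tm r N q × Tm r N q

    Avoids : Fin N → Tm r N q → Set
    Avoids i (con _)   = ⊤
    Avoids i (var j _) = i ≢ j

    Avoids³ : Fin N → PortT → Set
    Avoids³ i (a , b , c) = Avoids i a × Avoids i b × Avoids i c

    -- The colour of the edge spanned by the last vertex of an adjacent edge and the two cells is random given that edge.
    Sep : Tm r N q → Tm r N q → PortT → Set
    Sep (var i _) (var j _) e = i ≢ j × Avoids³ i e × Avoids³ j e
    Sep _         _         e = ⊥

    -- Either edge of a consecutive pair may play the random one. The second alternative serves
    -- paths that run into prescribed vertices, where the earlier edge has to supply the two free
    -- cells.
    Ok : PortT → List (Tm r N q) → Set
    Ok (a , b , c) (d ∷ x ∷ s) = (Sep d x (a , b , c) ⊎ Sep a b (c , d , x)) × Ok (c , d , x) s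
    Ok e           _           = ⊤

    Avoids? : ∀ i τ → Dec (Avoids i τ)
    Avoids? i (con _)   = yes tt
    Avoids? i (var j _) = ¬? (i ≟ᶠ j)

    Avoids³? : ∀ i e → Dec (Avoids³ i e)
    Avoids³? i (a , b , c) = Avoids? i a ×-dec Avoids? i b ×-dec Avoids? i c

    Sep? : ∀ d x e → Dec (Sep d x e)
    Sep? (var i _) (var j _) e = ¬? (i ≟ᶠ j) ×-dec Avoids³? i e ×-dec Avoids³? j e
    Sep? (con _)   _         e = no λ ()
    Sep? (var _ _) (con _)   e = no λ ()

    Ok? : ∀ e s → Dec (Ok e s)
    Ok? (a , b , c) []          = yes tt
    Ok? (a , b , c) (_ ∷ [])    = yes tt
    Ok? (a , b , c) (d ∷ x ∷ s) = (Sep? d x (a , b , c) ⊎-dec Sep? a b (c , d , x)) ×-dec Ok? (c , d , x) s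

  -- Injectivity is demanded position by position only: one vertex may occur in several cells at
  -- different positions. `Fresh` removes such coincidences between the sampled cells.
  module Sampling {n : ℕ} (H : Coloured n) (M q : ℕ) (0<M : 0 < M) (at : Fin M → Fin q → Fin n)
    (at-inj : ∀ p {j j'} → at j p ≡ at j' p → j ≡ j') where

    open Links H

    cellsList : List (Fin M)
    cellsList = allFin M

    ∣M∣ : length cellsList ≡ M
    ∣M∣ = length-allFin M

    tuples : (N : ℕ) → List (Vec (Fin M) N)
    tuples = vecs cellsList

    0<tuples : ∀ N → 0 < length (tuples N)
    0<tuples N = 0<vecs (subst (0 <_) (sym ∣M∣) 0<M) N

    content : Fin M → List V
    content j = map (at j) (allFin q)

    contents : ∀ {N} → Vec (Fin M) N → List V
    contents t = concatMap content (Vec.toList t)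

    Fresh : ∀ {N} → List V → Vec (Fin M) N → Set
    Fresh X []      = ⊤
    Fresh X (j ∷ t) = ¬ Any (λ p → at j p ∈ X ++ contents t) (allFin q) × Fresh X t

    hit? : ∀ L j → Dec (Any (λ p → at j p ∈ L) (allFin q))
    hit? L j = Any.any? (λ p → Any.any? (at j p ≟ᶠ_) L) (allFin q)

    stale : ∀ {N} → List V → Vec (Fin M) N → Bool
    stale X []      = false
    stale X (j ∷ t) = ⌊ hit? (X ++ contents t) j ⌋ ∨ stale X t

    ¬stale⇒Fresh : ∀ {N} X (t : Vec (Fin M) N) → stale X t ≡ false → Fresh X t
    ¬stale⇒Fresh X []      _ = tt
    ¬stale⇒Fresh X (j ∷ t) e with hit? (X ++ contents t) j
    ... | no ¬h = ¬h , ¬stale⇒Fresh X t e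

    -- For each position and each forbidden vertex, at most one cell has that vertex there.
    ∑-hit : ∀ L → ∑ cellsList (λ j → ⟦ ⌊ hit? L j ⌋ ⟧) ≤ q * length L
    ∑-hit L = begin
      ∑ cellsList (λ j → ⟦ ⌊ hit? L j ⌋ ⟧)
        ≤⟨ ∑-mono cellsList (λ j → ≤-trans (any-count (λ p → Any.any? (at j p ≟ᶠ_) L) (allFin q))
             (∑-mono (allFin q) (λ p → any-count (at j p ≟ᶠ_) L))) ⟩
      ∑ cellsList (λ j → ∑ (allFin q) (λ p → ∑ L (λ v → ⟦ ⌊ at j p ≟ᶠ v ⌋ ⟧)))
        ≡⟨ trans (∑-swap cellsList (allFin q) _) (∑-cong (allFin q) (λ p → ∑-swap cellsList L _)) ⟩
      ∑ (allFin q) (λ p → ∑ L (λ v → ∑ cellsList (λ j → ⟦ ⌊ at j p ≟ᶠ v ⌋ ⟧)))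
        ≤⟨ ∑-mono (allFin q) (λ p → ∑-≤const L (λ v → ∑-unique≤1 (λ j → at j p) (at-inj p) v cellsList (allFin⁺ M))) ⟩
      ∑ (allFin q) (λ p → length L * 1)
        ≡⟨ trans (∑-const (allFin q) _) (cong₂ _*_ (length-allFin q) (*-identityʳ _)) ⟩
      q * length L ∎
      where open ≤-Reasoning

    length-contents : ∀ {N} (t : Vec (Fin M) N) → length (contents t) ≡ N * q
    length-contents {N} t = trans (length-cells content (λ j → trans (length-map (at j) (allFin q)) (length-allFin q)) (Vec.toList t))
      (cong (_* q) (length-toList t))

    -- Union bound over the cells. The bound `Y` on blocked choices is a separate parameter, so that
    -- it stays fixed while the induction shortens the tuple.
    ∑-stale : ∀ N X Y → q * (length X + N * q) ≤ Y → M * ∑ (tuples N) (λ t → ⟦ stale X t ⟧) ≤ N * Y * length (tuples N)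
    ∑-stale zero    X Y h = ≤-reflexive (*-zeroʳ M)
    ∑-stale (suc N) X Y h = begin
      M * ∑ (tuples (suc N)) (λ t → ⟦ stale X t ⟧)
        ≡⟨ cong (M *_) (∑-vecs-suc {xs = cellsList} N _) ⟩
      M * ∑ cellsList (λ j → ∑ (tuples N) (λ t → ⟦ stale X (j ∷ t) ⟧))
        ≤⟨ *-monoʳ-≤ M (∑-mono cellsList (λ j → ≤-trans (∑-mono (tuples N) (λ t → ⟦∨⟧ ⌊ hit? (X ++ contents t) j ⌋ (stale X t))) (≤-reflexive (∑-+ (tuples N) _ _)))) ⟩
      M * ∑ cellsList (λ j → ∑ (tuples N) (λ t → ⟦ ⌊ hit? (X ++ contents t) j ⌋ ⟧) + S)
        ≡⟨ cong (M *_) (trans (∑-+ cellsList _ _) (cong₂ _+_ (∑-swap cellsList (tuples N) _) (trans (∑-const cellsList S) (cong (_* S) ∣M∣)))) ⟩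
      M * (∑ (tuples N) (λ t → ∑ cellsList (λ j → ⟦ ⌊ hit? (X ++ contents t) j ⌋ ⟧)) + M * S)
        ≤⟨ *-monoʳ-≤ M (+-mono-≤ (∑-≤const (tuples N) (λ t → ≤-trans (∑-hit (X ++ contents t)) (≤-trans (*-monoʳ-≤ q (len t)) h)))
             (∑-stale N X Y (≤-trans (*-monoʳ-≤ q (+-monoʳ-≤ (length X) (m≤n+m (N * q) q))) h))) ⟩
      M * (length (tuples N) * Y + N * Y * length (tuples N))
        ≡⟨ lem M (length (tuples N)) Y N ⟩
      suc N * Y * (M * length (tuples N))
        ≡⟨ cong (suc N * Y *_) (sym (trans (length-cart _∷_ cellsList (tuples N)) (cong (_* length (tuples N)) ∣M∣))) ⟩
      suc N * Y * length (tuples (suc N)) ∎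
      where
      open ≤-Reasoning
      S = ∑ (tuples N) (λ t → ⟦ stale X t ⟧)
      len : ∀ t → length (X ++ contents t) ≤ length X + (q + N * q)
      len t = ≤-trans (≤-reflexive (trans (length-++ X) (cong (length X +_) (length-contents t)))) (+-monoʳ-≤ (length X) (m≤n+m (N * q) q))
      lem : ∀ m l y k → m * (l * y + k * y * l) ≡ (1 + k) * y * (m * l)
      lem = solve-∀

    module Patterns {r N : ℕ} (K : ℕ)
      (sparse : ∀ w κ p p' → K * ∑ cellsList (λ a → ∑ cellsList (λ b → colourCount w κ (at a p) (at b p'))) ≤ M * M)
      (ρ : Vec V r) where

      eval : Vec (Fin M) N → Tm r N q → V
      eval t (con k)   = Vec.lookup ρ k
      eval t (var i p) = at (Vec.lookup t i) p

      evalP : Vec (Fin M) N → PortT → Port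
      evalP t (a , b , c) = eval t a , eval t b , eval t c

      eval-update : ∀ i τ → Avoids i τ → ∀ t x → eval (t [ i ]≔ x) τ ≡ eval t τ
      eval-update i (con k)   h   t x = refl
      eval-update i (var j p) i≢j t x = cong (λ y → at y p) (lookup∘update′ (i≢j ∘ sym) t x)

      evalP-update : ∀ i e → Avoids³ i e → ∀ t x → evalP (t [ i ]≔ x) e ≡ evalP t e
      evalP-update i (a , b , c) (p , q , s) t x =
        cong₂ _,_ (eval-update i a p t x) (cong₂ _,_ (eval-update i b q t x) (eval-update i c s t x))

      colP : Port → ℕ
      colP (a , b , c) = col a b c

      -- Redrawing cells `i` and `j` leaves the shared vertex and the other edge untouched, so their
      -- two entries range over all pairs for a fixed vertex and a fixed colour, which `sparse`
      -- bounds.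
      ∑-sep : ∀ i j p p' w e → i ≢ j → Avoids i w → Avoids j w → Avoids³ i e → Avoids³ j e →
              K * ∑ (tuples N) (λ t → colourCount (eval t w) (colP (evalP t e)) (eval t (var i p)) (eval t (var j p'))) ≤ length (tuples N)
      ∑-sep i j p p' w e i≢j iw jw ie je = *-cancelˡ-≤ (M * M) {{m*n≢0 M M {{>-nonZero 0<M}} {{>-nonZero 0<M}}}} (begin
        M * M * (K * ∑ (tuples N) f)        ≡⟨ lem M K _ ⟩
        K * (M * (M * ∑ (tuples N) f))      ≡⟨ cong (λ z → K * (M * z)) (upd j f) ⟩
        K * (M * ∑ (tuples N) (λ t → ∑ cellsList (λ b → f (t [ j ]≔ b)))) ≡⟨ cong (K *_) (upd i _) ⟩
        K * ∑ (tuples N) (λ t → ∑ cellsList (λ a → ∑ cellsList (λ b → f (t [ i ]≔ a [ j ]≔ b))))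
          ≡⟨ cong (K *_) (∑-cong (tuples N) (λ t → ∑-cong cellsList (λ a → ∑-cong cellsList (λ b → eqn t a b)))) ⟩
        K * ∑ (tuples N) (λ t → ∑ cellsList (λ a → ∑ cellsList (λ b → colourCount (eval t w) (colP (evalP t e)) (at a p) (at b p'))))
          ≡⟨ sym (∑-* (tuples N) K _) ⟩
        _ ≤⟨ ∑-≤const (tuples N) (λ t → sparse (eval t w) (colP (evalP t e)) p p') ⟩
        length (tuples N) * (M * M)         ≡⟨ *-comm _ (M * M) ⟩
        M * M * length (tuples N)           ∎)
        where
        open ≤-Reasoning
        f : Vec (Fin M) N → ℕ
        f t = colourCount (eval t w) (colP (evalP t e)) (eval t (var i p)) (eval t (var j p'))
        upd : ∀ k (g : Vec (Fin M) N → ℕ) → M * ∑ (tuples N) g ≡ ∑ (tuples N) (λ t → ∑ cellsList (λ b → g (t [ k ]≔ b)))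
        upd k g = trans (cong (_* ∑ (tuples N) g) (sym ∣M∣)) (∑-update k g)
        lem : ∀ m k s → m * m * (k * s) ≡ k * (m * (m * s))
        lem = solve-∀
        eqn : ∀ t a b → f (t [ i ]≔ a [ j ]≔ b) ≡ colourCount (eval t w) (colP (evalP t e)) (at a p) (at b p')
        eqn t a b = trans
          (cong₂ (λ w' κ → colourCount w' κ (eval (t [ i ]≔ a [ j ]≔ b) (var i p)) (eval (t [ i ]≔ a [ j ]≔ b) (var j p')))
            (trans (eval-update j w jw (t [ i ]≔ a) b) (eval-update i w iw t a))
            (cong colP (trans (evalP-update j e je (t [ i ]≔ a) b) (evalP-update i e ie t a))))
          (cong₂ (colourCount (eval t w) (colP (evalP t e)))
            (cong (λ y → at y p) (trans (lookup∘update′ i≢j (t [ i ]≔ a) b) (lookup∘update i t a)))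
            (cong (λ y → at y p') (lookup∘update j (t [ i ]≔ a) b)))

      ∑-clash : ∀ e s → Ok e s → K * ∑ (tuples N) (λ t → ⟦ clash (evalP t e) (map (eval t) s) ⟧) ≤ length s * length (tuples N)
      ∑-clash e           []          _ rewrite ∑-const (tuples N) 0 | *-zeroʳ (length (tuples N)) | *-zeroʳ K = z≤n
      ∑-clash e           (_ ∷ [])    _ rewrite ∑-const (tuples N) 0 | *-zeroʳ (length (tuples N)) | *-zeroʳ K = z≤n
      ∑-clash (a , b , c) (d ∷ x ∷ s) (sp , o) = begin
        K * ∑ (tuples N) (λ t → ⟦ clash (evalP t (a , b , c)) (map (eval t) (d ∷ x ∷ s)) ⟧)
          ≤⟨ *-monoʳ-≤ K (≤-trans (∑-mono (tuples N) (λ t → ⟦∨⟧ (bad t) _)) (≤-reflexive (∑-+ (tuples N) _ _))) ⟩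
        K * (∑ (tuples N) (λ t → ⟦ bad t ⟧) + ∑ (tuples N) (λ t → ⟦ clash (evalP t (c , d , x)) (map (eval t) s) ⟧))
          ≡⟨ *-distribˡ-+ K _ _ ⟩
        _ ≤⟨ +-mono-≤ (one sp) (∑-clash (c , d , x) s o) ⟩
        length (tuples N) + length s * length (tuples N) ≤⟨ m≤n+m _ (length (tuples N)) ⟩
        length (d ∷ x ∷ s) * length (tuples N) ∎
        where
        open ≤-Reasoning
        bad : Vec (Fin M) N → Bool
        bad t = E (eval t a) (eval t b) (eval t c) ∧ E (eval t c) (eval t d) (eval t x)
          ∧ (col (eval t a) (eval t b) (eval t c) ≡ᵇ col (eval t c) (eval t d) (eval t x))
        ≡ᵇ-sym : ∀ m k → T (m ≡ᵇ k) → T (k ≡ᵇ m)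
        ≡ᵇ-sym m k h = ≡⇒≡ᵇ k m (sym (≡ᵇ⇒≡ m k h))
        one : Sep d x (a , b , c) ⊎ Sep a b (c , d , x) → K * ∑ (tuples N) (λ t → ⟦ bad t ⟧) ≤ length (tuples N)
        one (inj₁ sp) = go d x refl refl sp
          where
          go : ∀ d' x' → d ≡ d' → x ≡ x' → Sep d' x' (a , b , c) → K * ∑ (tuples N) (λ t → ⟦ bad t ⟧) ≤ length (tuples N)
          go (var i p) (var j p') refl refl (i≢j , (ia , ib , ic) , (ja , jb , jc)) =
            ≤-trans (*-monoʳ-≤ K (∑-mono (tuples N) (λ t → ⟦⟧-⇒ (imp t))))
              (∑-sep i j p p' c (a , b , c) i≢j ic jc (ia , ib , ic) (ja , jb , jc))
            where
            imp : ∀ t → T (bad t) → T (E (eval t c) (eval t d) (eval t x) ∧ (col (eval t c) (eval t d) (eval t x) ≡ᵇ col (eval t a) (eval t b) (eval t c)))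
            imp t h with Equivalence.to (T-∧ {E (eval t a) (eval t b) (eval t c)}) h
            ... | _ , h₂ with Equivalence.to (T-∧ {E (eval t c) (eval t d) (eval t x)}) h₂
            ...   | h₃ , h₄ = Equivalence.from T-∧ (h₃ , ≡ᵇ-sym (col (eval t a) (eval t b) (eval t c)) _ h₄)
        -- Here the earlier edge is random. Rotating it puts the shared vertex first, the form in
        -- which colours are counted.
        one (inj₂ sp) = go a b refl refl sp
          where
          go : ∀ a' b' → a ≡ a' → b ≡ b' → Sep a' b' (c , d , x) → K * ∑ (tuples N) (λ t → ⟦ bad t ⟧) ≤ length (tuples N)
          go (var i p) (var j p') refl refl (i≢j , (ic , id , ix) , (jc , jd , jx)) =
            ≤-trans (*-monoʳ-≤ K (∑-mono (tuples N) (λ t → ⟦⟧-⇒ (imp t))))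
              (∑-sep i j p p' c (c , d , x) i≢j ic jc (ic , id , ix) (jc , jd , jx))
            where
            imp : ∀ t → T (bad t) → T (E (eval t c) (eval t a) (eval t b) ∧ (col (eval t c) (eval t a) (eval t b) ≡ᵇ col (eval t c) (eval t d) (eval t x)))
            imp t h with Equivalence.to (T-∧ {E (eval t a) (eval t b) (eval t c)}) h
            ... | h₁ , h₂ with Equivalence.to (T-∧ {E (eval t c) (eval t d) (eval t x)}) h₂
            ...   | _ , h₄ = Equivalence.from T-∧ (subst T (sym (E-rot (eval t c) (eval t a) (eval t b))) h₁ ,
                      subst (λ z → T (z ≡ᵇ col (eval t c) (eval t d) (eval t x))) (sym (col-rot (eval t c) (eval t a) (eval t b))) h₄)

      Pattern : Set
      Pattern = PortT {r} {N} {q} × List (Tm r N q) × PortT {r} {N} {q}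

      LinkedT LinkT : Vec (Fin M) N → Pattern → Set
      LinkedT t (e , s , f) = IsEdge (evalP t e) × Linked (evalP t e) (map (eval t) s) (evalP t f)
      LinkT   t (e , s , f) = IsEdge (evalP t e) × Link (evalP t e) (map (eval t) s) (evalP t f)

      clashes : Vec (Fin M) N → List Pattern → Bool
      clashes t []                = false
      clashes t ((e , s , _) ∷ L) = clash (evalP t e) (map (eval t) s) ∨ clashes t L

      size : List Pattern → ℕ
      size L = ∑ L (λ P → length (proj₁ (proj₂ P)))

      ∑-clashes : ∀ L → All (λ P → Ok (proj₁ P) (proj₁ (proj₂ P))) L → K * ∑ (tuples N) (λ t → ⟦ clashes t L ⟧) ≤ size L * length (tuples N)
      ∑-clashes [] _ rewrite ∑-const (tuples N) 0 | *-zeroʳ (length (tuples N)) | *-zeroʳ K = z≤n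
      ∑-clashes ((e , s , f) ∷ L) (o ∷ os) = begin
        K * ∑ (tuples N) (λ t → ⟦ clashes t ((e , s , f) ∷ L) ⟧)
          ≤⟨ *-monoʳ-≤ K (≤-trans (∑-mono (tuples N) (λ t → ⟦∨⟧ (clash (evalP t e) (map (eval t) s)) _)) (≤-reflexive (∑-+ (tuples N) _ _))) ⟩
        _ ≡⟨ *-distribˡ-+ K _ _ ⟩
        _ ≤⟨ +-mono-≤ (∑-clash e s o) (∑-clashes L os) ⟩
        length s * length (tuples N) + size L * length (tuples N) ≡⟨ sym (*-distribʳ-+ (length (tuples N)) (length s) (size L)) ⟩
        size ((e , s , f) ∷ L) * length (tuples N) ∎
        where open ≤-Reasoning

      LinkedT⇒LinkT : ∀ t L → All (LinkedT t) L → clashes t L ≡ false → All (LinkT t) L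
      LinkedT⇒LinkT t []                _              _ = []
      LinkedT⇒LinkT t ((e , s , f) ∷ L) ((h , l) ∷ ls) q with clash (evalP t e) (map (eval t) s) in eq
      ... | false = (h , Linked⇒Link (evalP t e) (map (eval t) s) h l eq) ∷ LinkedT⇒LinkT t L ls q

      -- Overlapping cells and colour clashes are each bounded by a 1/(4D) fraction of all tuples,
      -- so together they remove at most half of the good ones.
      dense-patterns : ∀ {D} (L : List Pattern) X → All (λ P → Ok (proj₁ P) (proj₁ (proj₂ P))) L → 0 < K →
        4 * D * size L ≤ K → 4 * D * (N * (q * (length X + N * q))) ≤ M →
        Dense (tuples N) D (λ t → All (LinkedT t) L) → Dense (tuples N) (2 * D) (λ t → Fresh X t × All (LinkT t) L)
      dense-patterns {D} L X ok 0<K hK hM d = dense-mono fin (dense-∖ bad few d)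
        where
        open ≤-Reasoning
        bad : Vec (Fin M) N → Bool
        bad t = stale X t ∨ clashes t L
        fin : ∀ t → All (LinkedT t) L × bad t ≡ false → Fresh X t × All (LinkT t) L
        fin t (ls , q) with stale X t in e
        ... | false = ¬stale⇒Fresh X t e , LinkedT⇒LinkT t L ls q
        half : ∀ k c y b → 0 < k → 4 * D * y ≤ k → k * b ≤ y * c → 4 * D * b ≤ c
        half k c y b pos h₁ h₂ = *-cancelˡ-≤ k {{>-nonZero pos}} (begin
          k * (4 * D * b)   ≡⟨ lem₁ k (4 * D) b ⟩
          4 * D * (k * b)   ≤⟨ *-monoʳ-≤ (4 * D) h₂ ⟩
          4 * D * (y * c)   ≡⟨ sym (*-assoc (4 * D) y c) ⟩
          4 * D * y * c     ≤⟨ *-monoˡ-≤ c h₁ ⟩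
          k * c ∎)
          where
          lem₁ : ∀ k d b → k * (d * b) ≡ d * (k * b)
          lem₁ = solve-∀
        few : 2 * D * ∑ (tuples N) (λ t → ⟦ bad t ⟧) ≤ length (tuples N)
        few = *-cancelˡ-≤ 2 (begin
          2 * (2 * D * ∑ (tuples N) (λ t → ⟦ bad t ⟧)) ≡⟨ lem₂ D _ ⟩
          4 * D * ∑ (tuples N) (λ t → ⟦ bad t ⟧) ≤⟨ *-monoʳ-≤ (4 * D) (≤-trans (∑-mono (tuples N) (λ t → ⟦∨⟧ (stale X t) (clashes t L))) (≤-reflexive (∑-+ (tuples N) _ _))) ⟩
          _ ≡⟨ *-distribˡ-+ (4 * D) _ _ ⟩
          _ ≤⟨ +-mono-≤ (half M _ (N * (q * (length X + N * q))) _ 0<M hM (∑-stale N X _ ≤-refl)) (half K _ (size L) _ 0<K hK (∑-clashes L ok)) ⟩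
          length (tuples N) + length (tuples N) ≡⟨ cong (length (tuples N) +_) (sym (+-identityʳ _)) ⟩
          2 * length (tuples N) ∎)
          where
          lem₂ : ∀ d b → 2 * (2 * d * b) ≡ 4 * d * b
          lem₂ = solve-∀

  -- Small disjoint families that serve every request.

  bernoulli : ∀ b k → b ^ k * (b + k) ≤ (1 + b) ^ k * b
  bernoulli b zero    = *-monoʳ-≤ 1 (≤-reflexive (+-identityʳ b))
  bernoulli b (suc k) = begin
    b * b ^ k * (b + suc k)     ≤⟨ m≤m+n _ (b ^ k * k) ⟩
    b * b ^ k * (b + suc k) + b ^ k * k ≡⟨ lem b (b ^ k) k ⟩
    (1 + b) * (b ^ k * (b + k)) ≤⟨ *-monoʳ-≤ (1 + b) (bernoulli b k) ⟩
    (1 + b) * ((1 + b) ^ k * b) ≡⟨ sym (*-assoc (1 + b) ((1 + b) ^ k) b) ⟩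
    (1 + b) ^ suc k * b         ∎
    where
    open ≤-Reasoning
    lem : ∀ b p k → b * p * (b + (1 + k)) + p * k ≡ (1 + b) * (p * (b + k))
    lem = solve-∀

  -- This is (1 + 1/b)^(1+b) ≥ 2, from Bernoulli: with 1 + b = 2D it turns 2D rounds into one
  -- guaranteed service per request, up to the logarithm of the number of requests.
  2b^≤ : ∀ b → 0 < b → 2 * b ^ (1 + b) ≤ (1 + b) ^ (1 + b)
  2b^≤ b pos = *-cancelʳ-≤ (2 * b ^ (1 + b)) ((1 + b) ^ (1 + b)) b {{>-nonZero pos}} (begin
    2 * b ^ (1 + b) * b               ≡⟨ lem (b ^ (1 + b)) b ⟩
    b ^ (1 + b) * (b + b)             ≤⟨ *-monoʳ-≤ (b ^ (1 + b)) (+-monoʳ-≤ b (n≤1+n b)) ⟩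
    b ^ (1 + b) * (b + (1 + b))       ≤⟨ bernoulli b (1 + b) ⟩
    (1 + b) ^ (1 + b) * b             ∎)
    where
    open ≤-Reasoning
    lem : ∀ p b → 2 * p * b ≡ p * (b + b)
    lem = solve-∀

  ^-cancel-≤ : ∀ m k → 2 ^ m ≤ 2 ^ k → m ≤ k
  ^-cancel-≤ m k h with m ≤? k
  ... | yes p = p
  ... | no ¬p = contradiction h (<⇒≱ (^-monoʳ-< 2 (s≤s (s≤s z≤n)) (≰⇒> ¬p)))

  ^-distribʳ-* : ∀ k a b → (a * b) ^ k ≡ a ^ k * b ^ k
  ^-distribʳ-* zero    a b = refl
  ^-distribʳ-* (suc k) a b = trans (cong (a * b *_) (^-distribʳ-* k a b)) (lem a b (a ^ k) (b ^ k))
    where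
    lem : ∀ a b p q → a * b * (p * q) ≡ a * p * (b * q)
    lem = solve-∀

  -- Derandomised sampling by multiplicative weights: a request loses half of its weight whenever the chosen
  -- element serves it, and every element is chosen to serve at least an average share of the current weight.
  module Family {A Q W : Set} (xs : List A) (qs : List Q) (serves : Q → A → Bool) (parts : A → List W)
    (Fresh : List W → A → Set) (N ξ D b′ : ℕ) (2D≡ : 2 * D ≡ 1 + b′) (0<b′ : 0 < b′)
    (0<xs : 0 < length xs) (0<qs : 0 < length qs)
    (∣parts∣ : ∀ a → length (parts a) ≡ N)
    (many : ∀ X → length X ≤ ξ → ∀ q → Dense xs D (λ t → Fresh X t × T (serves q t))) where

    count : Q → List A → ℕ
    count q F = ∑ F (λ t → ⟦ serves q t ⟧)

    occupied : List A → List W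
    occupied = concatMap parts

    FreshFamily : List W → List A → Set
    FreshFamily X []      = ⊤
    FreshFamily X (t ∷ F) = Fresh (X ++ occupied F) t × FreshFamily X F

    weight : List A → Q → ℕ
    weight []      q = 1
    weight (t ∷ F) q = if serves q t then weight F q else 2 * weight F q

    total : List A → ℕ
    total F = ∑ qs (weight F)

    weight-count : ∀ F q → weight F q * 2 ^ count q F ≡ 2 ^ length F
    weight-count []      q = refl
    weight-count (t ∷ F) q with serves q t
    ... | true  = trans (lem (weight F q) (2 ^ count q F)) (cong (2 *_) (weight-count F q))
      where
      lem : ∀ w c → w * (2 * c) ≡ 2 * (w * c)
      lem = solve-∀
    ... | false = trans (*-assoc 2 (weight F q) _) (cong (2 *_) (weight-count F q))

    0<weight : ∀ F q → 0 < weight F q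
    0<weight []      q = s≤s z≤n
    0<weight (t ∷ F) q with serves q t
    ... | true  = 0<weight F q
    ... | false = ≤-trans (0<weight F q) (m≤m+n _ _)

    total-step : ∀ t F → total (t ∷ F) + ∑ qs (λ q → weight F q * ⟦ serves q t ⟧) ≡ 2 * total F
    total-step t F = trans (sym (∑-+ qs _ _)) (trans (∑-cong qs eq) (∑-* qs 2 _))
      where
      eq : ∀ q → weight (t ∷ F) q + weight F q * ⟦ serves q t ⟧ ≡ 2 * weight F q
      eq q with serves q t
      ... | true  = cong (weight F q +_) (*-comm (weight F q) 1)
      ... | false = trans (cong (2 * weight F q +_) (*-zeroʳ (weight F q))) (+-identityʳ _)

    -- Double counting of weighted services finds an element of at least average value. The request
    -- that it is certain to serve is recorded too: it is what later shows that a chosen absorber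
    -- carries its basic path.
    step : ∀ X F → length X ≤ ξ → ∃ λ t → Fresh X t × (∃ λ q → T (serves q t)) ×
           total F ≤ D * ∑ qs (λ q → weight F q * ⟦ serves q t ⟧)
    step X F hX = t , proj₁ good , (proj₁ wit , proj₂ good) ,
        ≤-trans big (*-monoʳ-≤ D (∑-mono qs (λ q → *-monoʳ-≤ (weight F q) (⟦⟧-⇒ (λ p → proj₂ (sound (many X hX q) t p))))))
      where
      open ≤-Reasoning
      f : Q → A → Bool
      f q = test (many X hX q)
      avg : ∃ λ t → t ∈ xs × total F ≤ D * ∑ qs (λ q → weight F q * ⟦ f q t ⟧)
      avg = ∑-average xs (total F) (λ t → D * ∑ qs (λ q → weight F q * ⟦ f q t ⟧)) 0<xs (begin
        length xs * total F                                              ≡⟨ trans (*-comm (length xs) (total F)) (sym (∑-*ʳ qs (length xs) (weight F))) ⟩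
        ∑ qs (λ q → weight F q * length xs)                              ≤⟨ ∑-mono qs (λ q → *-monoʳ-≤ (weight F q) (bound (many X hX q))) ⟩
        ∑ qs (λ q → weight F q * (D * ∑ xs (λ t → ⟦ f q t ⟧)))           ≡⟨ ∑-cong qs (λ q → trans (lem (weight F q) D (∑ xs (λ t → ⟦ f q t ⟧))) (cong (D *_) (sym (∑-* xs (weight F q) (λ t → ⟦ f q t ⟧))))) ⟩
        ∑ qs (λ q → D * ∑ xs (λ t → weight F q * ⟦ f q t ⟧))             ≡⟨ trans (∑-* qs D (λ q → ∑ xs (λ t → weight F q * ⟦ f q t ⟧))) (cong (D *_) (∑-swap qs xs (λ q t → weight F q * ⟦ f q t ⟧))) ⟩
        D * ∑ xs (λ t → ∑ qs (λ q → weight F q * ⟦ f q t ⟧))             ≡⟨ sym (∑-* xs D (λ t → ∑ qs (λ q → weight F q * ⟦ f q t ⟧))) ⟩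
        ∑ xs (λ t → D * ∑ qs (λ q → weight F q * ⟦ f q t ⟧))             ∎)
        where
        lem : ∀ w d s → w * (d * s) ≡ d * (w * s)
        lem = solve-∀
      t : A
      t = proj₁ avg
      big : total F ≤ D * ∑ qs (λ q → weight F q * ⟦ f q t ⟧)
      big = proj₂ (proj₂ avg)
      0<total : 0 < total F
      0<total = ≤-trans (≤-trans 0<qs (≤-reflexive (sym (*-identityʳ _)))) (∑-≥const qs (0<weight F))
      pos : ∀ {c} → 0 < D * c → 0 < c
      pos {zero}  h rewrite *-zeroʳ D = contradiction h (λ ())
      pos {suc c} h = s≤s z≤n
      wit : ∃ λ q → T (f q t)
      wit = proj₁ ex , lem (weight F (proj₁ ex)) (f (proj₁ ex) t) (proj₂ (proj₂ ex))
        where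
        ex : ∃ λ q → q ∈ qs × 0 < weight F q * ⟦ f q t ⟧
        ex = ∑-exceeds qs (λ _ → 0) (λ q → weight F q * ⟦ f q t ⟧)
                 (subst (_< ∑ qs (λ q → weight F q * ⟦ f q t ⟧)) (sym (trans (∑-const qs 0) (*-zeroʳ (length qs)))) (pos (≤-trans 0<total big)))
        lem : ∀ w b → 0 < w * ⟦ b ⟧ → T b
        lem w true  _ = tt
        lem w false h rewrite *-zeroʳ w = contradiction h (λ ())
      good : Fresh X t × T (serves (proj₁ wit) t)
      good = sound (many X hX (proj₁ wit)) t (proj₂ wit)

    length-occupied : ∀ F → length (occupied F) ≡ length F * N
    length-occupied = length-cells parts ∣parts∣

    Built : List W → ℕ → List A → Set
    Built X k F = length F ≡ k × FreshFamily X F × All (λ t → ∃ λ q → T (serves q t)) F ×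
                  D ^ k * total F ≤ b′ ^ k * length qs

    extend : ∀ X k F t → Built X k F → Fresh (X ++ occupied F) t → (∃ λ q → T (serves q t)) →
             total F ≤ D * ∑ qs (λ q → weight F q * ⟦ serves q t ⟧) → Built X (suc k) (t ∷ F)
    extend X k F t (lF , fr , al , w) ft ex big = cong suc lF , (ft , fr) , ex ∷ al , (begin
        D * D ^ k * total (t ∷ F)       ≡⟨ lem D (D ^ k) (total (t ∷ F)) ⟩
        D ^ k * (D * total (t ∷ F))     ≤⟨ *-monoʳ-≤ (D ^ k) drop-weight ⟩
        D ^ k * (b′ * total F)          ≡⟨ lem₂ (D ^ k) b′ (total F) ⟩
        b′ * (D ^ k * total F)          ≤⟨ *-monoʳ-≤ b′ w ⟩
        b′ * (b′ ^ k * length qs)       ≡⟨ sym (*-assoc b′ (b′ ^ k) (length qs)) ⟩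
        b′ * b′ ^ k * length qs         ∎)
      where
      open ≤-Reasoning
      S = ∑ qs (λ q → weight F q * ⟦ serves q t ⟧)
      lem : ∀ d p s → d * p * s ≡ p * (d * s)
      lem = solve-∀
      lem₂ : ∀ p c s → p * (c * s) ≡ c * (p * s)
      lem₂ = solve-∀
      lem₃ : ∀ d s → d * (2 * s) ≡ 2 * d * s
      lem₃ = solve-∀
      -- The new total is 2 `total F` - `S`, and D `S` is at least `total F`; hence the total is
      -- multiplied by at most (2D - 1)/D.
      drop-weight : D * total (t ∷ F) ≤ b′ * total F
      drop-weight = +-cancelʳ-≤ (total F) (D * total (t ∷ F)) (b′ * total F) (begin
        D * total (t ∷ F) + total F       ≤⟨ +-monoʳ-≤ (D * total (t ∷ F)) big ⟩
        D * total (t ∷ F) + D * S         ≡⟨ sym (*-distribˡ-+ D (total (t ∷ F)) S) ⟩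
        D * (total (t ∷ F) + S)           ≡⟨ cong (D *_) (total-step t F) ⟩
        D * (2 * total F)                 ≡⟨ trans (lem₃ D (total F)) (trans (cong (_* total F) 2D≡) (+-comm (total F) (b′ * total F))) ⟩
        b′ * total F + total F            ∎)

    build : ∀ X k → length X + k * N ≤ ξ → ∃ (Built X k)
    build X zero    h = [] , refl , tt , [] , *-monoʳ-≤ 1 (≤-reflexive (sym (length≡∑ qs)))
    build X (suc k) h = grow (build X k (≤-trans (+-monoʳ-≤ (length X) (m≤n+m (k * N) N)) h))
      where
      grow : ∃ (Built X k) → ∃ (Built X (suc k))
      grow (F , B) = proj₁ st ∷ F , extend X k F (proj₁ st) B (proj₁ (proj₂ st)) (proj₁ (proj₂ (proj₂ st))) (proj₂ (proj₂ (proj₂ st)))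
        where
        st = step (X ++ occupied F) F
            (≤-trans (≤-reflexive (trans (length-++ X) (cong (length X +_) (trans (length-occupied F) (cong (_* N) (proj₁ B))))))
              (≤-trans (+-monoʳ-≤ (length X) (m≤n+m (k * N) N)) h))

    -- A request served c times keeps weight 2^(k-c), which cannot exceed the total (b′/D)^k 2^h.
    -- Over k = 2Dm rounds (2D/b′)^k is at least 2^m, so c + h is at least m.
    enough : ∀ F m h {k} → k ≡ 2 * D * m → length F ≡ k → D ^ k * total F ≤ b′ ^ k * length qs → length qs ≤ 2 ^ h →
             ∀ {q} → q ∈ qs → m ≤ count q F + h
    enough F m h refl lF w hq {q} q∈ = ^-cancel-≤ m (c + h) (*-cancelʳ-≤ (2 ^ m) (2 ^ (c + h)) (b′ ^ k) {{m^n≢0 b′ k {{>-nonZero 0<b′}}}} (begin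
      2 ^ m * b′ ^ k                              ≡⟨ cong (2 ^ m *_) (sym (^-*-assoc b′ (2 * D) m)) ⟩
      2 ^ m * (b′ ^ (2 * D)) ^ m                  ≡⟨ sym (^-distribʳ-* m 2 (b′ ^ (2 * D))) ⟩
      (2 * b′ ^ (2 * D)) ^ m                      ≤⟨ ^-monoˡ-≤ m base ⟩
      ((2 * D) ^ (2 * D)) ^ m                     ≡⟨ ^-*-assoc (2 * D) (2 * D) m ⟩
      (2 * D) ^ k                                 ≡⟨ trans (^-distribʳ-* k 2 D) (*-comm (2 ^ k) (D ^ k)) ⟩
      D ^ k * 2 ^ k                               ≡⟨ cong (D ^ k *_) (trans (cong (2 ^_) (sym lF)) (sym (weight-count F q))) ⟩
      D ^ k * (weight F q * 2 ^ c)                ≤⟨ *-monoʳ-≤ (D ^ k) (*-monoˡ-≤ (2 ^ c) (term≤∑ (weight F) q∈)) ⟩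
      D ^ k * (total F * 2 ^ c)                   ≡⟨ sym (*-assoc (D ^ k) (total F) (2 ^ c)) ⟩
      D ^ k * total F * 2 ^ c                     ≤⟨ *-monoˡ-≤ (2 ^ c) w ⟩
      b′ ^ k * length qs * 2 ^ c                  ≤⟨ *-monoˡ-≤ (2 ^ c) (*-monoʳ-≤ (b′ ^ k) hq) ⟩
      b′ ^ k * 2 ^ h * 2 ^ c                      ≡⟨ lem (b′ ^ k) (2 ^ h) (2 ^ c) ⟩
      2 ^ c * 2 ^ h * b′ ^ k                      ≡⟨ cong (_* b′ ^ k) (sym (^-distribˡ-+-* 2 c h)) ⟩
      2 ^ (c + h) * b′ ^ k                        ∎))
      where
      open ≤-Reasoning
      k = 2 * D * m
      c = count q F
      base : 2 * b′ ^ (2 * D) ≤ (2 * D) ^ (2 * D)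
      base = subst (λ z → 2 * b′ ^ z ≤ z ^ z) (sym 2D≡) (2b^≤ b′ 0<b′)
      lem : ∀ x y z → x * y * z ≡ z * y * x
      lem = solve-∀

    family : ∀ X m h → length X + 2 * D * m * N ≤ ξ → length qs ≤ 2 ^ h →
             ∃ λ F → length F ≡ 2 * D * m × FreshFamily X F × All (λ t → ∃ λ q → T (serves q t)) F ×
             (∀ {q} → q ∈ qs → m ≤ count q F + h)
    family X m h hX hq = F , lF , fr , al , enough F m h refl lF w hq
      where
      B : ∃ (Built X (2 * D * m))
      B = build X (2 * D * m) hX
      F = proj₁ B
      lF = proj₁ (proj₂ B)
      fr = proj₁ (proj₂ (proj₂ B))
      al = proj₁ (proj₂ (proj₂ (proj₂ B)))
      w = proj₂ (proj₂ (proj₂ (proj₂ B)))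

  -- Permutations found by evaluation, and the index lists of the absorber.

  module _ {A : Set} (_≟_ : (x y : A) → Dec (x ≡ y)) where

    extract : (x : A) (ys : List A) → Maybe (∃ λ zs → ys ↭ x ∷ zs)
    extract x [] = nothing
    extract x (y ∷ ys) with x ≟ y
    ... | yes refl = just (ys , ↭-refl)
    ... | no  _ with extract x ys
    ...   | nothing       = nothing
    ...   | just (zs , p) = just (y ∷ zs , ↭-trans (prep y p) (swap y x ↭-refl))

    -- On closed index lists the search evaluates to `just`, so the rearrangements of gadgets and
    -- augmenting paths are computed once on indices and transported by `map⁺`.
    permutation : (xs ys : List A) → Maybe (xs ↭ ys)
    permutation []       []      = just ↭-refl
    permutation []       (_ ∷ _) = nothing
    permutation (x ∷ xs) ys with extract x ys
    ... | nothing = nothing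
    ... | just (zs , p) with permutation xs zs
    ...   | nothing = nothing
    ...   | just q  = just (↭-trans (prep x q) (↭-sym p))

  lookup-allFin : {A : Set} {N : ℕ} (t : Vec A N) → map (Vec.lookup t) (allFin N) ≡ Vec.toList t
  lookup-allFin t = trans (map-tabulate id (Vec.lookup t)) (go t)
    where
    go : ∀ {A : Set} {N} (t : Vec A N) → tabulate (Vec.lookup t) ≡ Vec.toList t
    go []      = refl
    go (x ∷ t) = cong (x ∷_) (go t)

  -- Absorber of x and y: the vertices 0–6 are v₄ h h' v₃ v₅ v₂ v₆, and 7–19, 20–32 are the vertices k s b b' v₁ u₁ r s' y w x z v
  -- of end-swapping gadgets for (v₂ , v₃) and (v₆ , v₅). A gadget for (v₂ , v₃) carries the two spanning paths
  -- v₂ b v₁ x y z w v u₁ v₃ b' k s r s' and v₃ b' u₁ v w z y x v₁ v₂ b k s r s'. They allow the path to pass from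
  -- … v₃ h v₄ h' v₅ … to … v₂ x v₄ h h' y v₆ …
  beforeIx afterInner afterOuter : List (Fin 33)
  beforeIx = # 7 ∷ # 9 ∷ # 5 ∷ # 11 ∷ # 17 ∷ # 15 ∷ # 18 ∷ # 16 ∷ # 19 ∷ # 12 ∷ # 10 ∷ # 3 ∷ # 1 ∷ # 0 ∷ # 2 ∷
             # 4 ∷ # 23 ∷ # 25 ∷ # 32 ∷ # 29 ∷ # 31 ∷ # 28 ∷ # 30 ∷ # 24 ∷ # 6 ∷ # 22 ∷ # 20 ∷ # 21 ∷ # 26 ∷ # 27 ∷ []
  afterInner = # 7 ∷ # 10 ∷ # 3 ∷ # 12 ∷ # 19 ∷ # 16 ∷ # 18 ∷ # 15 ∷ # 17 ∷ # 11 ∷ # 9 ∷ # 5 ∷ []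
  afterOuter = # 6 ∷ # 22 ∷ # 24 ∷ # 30 ∷ # 28 ∷ # 31 ∷ # 29 ∷ # 32 ∷ # 25 ∷ # 4 ∷ # 23 ∷ # 20 ∷ # 21 ∷ # 26 ∷ # 27 ∷ []

  startIx endIx : Fin 33 × Fin 33 × Fin 33
  startIx = # 14 , # 13 , # 8
  endIx   = # 21 , # 26 , # 27

  triple→ : {A B : Set} → (A → B) → A × A × A → B × B × B
  triple→ f (a , b , c) = f a , f b , f c

  afterWith : {A : Set} → A → A → (Fin 33 → A) → List A
  afterWith x y f = map f afterInner ++ x ∷ f (# 0) ∷ f (# 1) ∷ f (# 2) ∷ y ∷ map f afterOuter

  -- The absorbed pair occupies indices 0 and 1 and the absorber is shifted by two, so that a lookup
  -- in `x ∷ y ∷ t` turns this one permutation into all its instances.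
  afterIx↭ : afterWith (# 0) (# 1) (λ i → suc (suc i)) ↭ # 0 ∷ # 1 ∷ map (λ i → suc (suc i)) beforeIx
  afterIx↭ = from-just (permutation _≟ᶠ_ (afterWith (# 0) (# 1) (λ i → suc (suc i))) (# 0 ∷ # 1 ∷ map (λ i → suc (suc i)) beforeIx))

  beforeIx↭ : # 14 ∷ # 13 ∷ # 8 ∷ beforeIx ↭ allFin 33
  beforeIx↭ = from-just (permutation _≟ᶠ_ (# 14 ∷ # 13 ∷ # 8 ∷ beforeIx) (allFin 33))

  toVec : {A : Set} → ∀ k (xs : List A) → length xs ≡ k → ∃ λ (v : Vec A k) → Vec.toList v ≡ xs
  toVec _ xs refl = Vec.fromList xs , toList∘fromList xs

  -- Matchings

  module _ {A : Set} where

    flat : List (A × A) → List A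
    flat []             = []
    flat ((x , y) ∷ ms) = x ∷ y ∷ flat ms

    flat-++ : ∀ ms ns → flat (ms ++ ns) ≡ flat ms ++ flat ns
    flat-++ []             ns = refl
    flat-++ ((x , y) ∷ ms) ns = cong (λ z → x ∷ y ∷ z) (flat-++ ms ns)

    flat-↭ : ∀ {ms ns} → ms ↭ ns → flat ms ↭ flat ns
    flat-↭ _↭_.refl                        = ↭-refl
    flat-↭ (prep (x , y) p)                = prep x (prep y (flat-↭ p))
    flat-↭ (swap (x , y) (x' , y') p)      = ↭-trans (shifts (x ∷ y ∷ []) (x' ∷ y' ∷ [])) (++⁺ˡ (x' ∷ y' ∷ x ∷ y ∷ []) (flat-↭ p))
    flat-↭ (_↭_.trans p q)                 = ↭-trans (flat-↭ p) (flat-↭ q)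

    length-flat : ∀ ms → length (flat ms) ≡ 2 * length ms
    length-flat []       = refl
    length-flat (_ ∷ ms) = trans (cong (2 +_) (length-flat ms)) (sym (*-suc 2 (length ms)))

    ∑-flat : ∀ ms (f : A → ℕ) → ∑ (flat ms) f ≡ ∑ ms (λ m → f (proj₁ m) + f (proj₂ m))
    ∑-flat []             f = refl
    ∑-flat ((x , y) ∷ ms) f = trans (cong (λ z → f x + (f y + z)) (∑-flat ms f)) (sym (+-assoc (f x) (f y) _))

    reorder : ∀ {m} (v : Vec A m) {is js : List (Fin m)} → is ↭ js → ∀ R → map (Vec.lookup v) is ++ R ↭ map (Vec.lookup v) js ++ R
    reorder v p R = ++⁺ʳ R (map⁺ (Vec.lookup v) p)

    ∈⇒↭ : ∀ {x : A} {xs} → x ∈ xs → ∃ λ ys → xs ↭ x ∷ ys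
    ∈⇒↭ {xs = x ∷ xs} (here refl) = xs , ↭-refl
    ∈⇒↭ {xs = y ∷ xs} (there m) with ∈⇒↭ m
    ... | ys , p = y ∷ ys , ↭-trans (prep y p) (swap y _ ↭-refl)

    search : {R : A → Set} → (∀ x → Dec (R x)) → ∀ xs → All (λ x → ¬ R x) xs ⊎ ∃ λ x → ∃ λ ys → R x × xs ↭ x ∷ ys
    search R? [] = inj₁ []
    search R? (x ∷ xs) with R? x
    ... | yes r = inj₂ (x , xs , r , ↭-refl)
    ... | no ¬r with search R? xs
    ...   | inj₁ a = inj₁ (¬r ∷ a)
    ...   | inj₂ (y , ys , r , p) = inj₂ (y , x ∷ ys , r , ↭-trans (prep x p) (swap x y ↭-refl))

    searchPairs : {R : A → A → Set} → (∀ x y → Dec (R x y)) → ∀ xs →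
                  AllPairs (λ x y → ¬ R x y) xs ⊎ ∃ λ x → ∃ λ y → ∃ λ ys → R x y × xs ↭ x ∷ y ∷ ys
    searchPairs R? [] = inj₁ []
    searchPairs R? (x ∷ xs) with search (R? x) xs
    ... | inj₂ (y , ys , r , p) = inj₂ (x , y , ys , r , prep x p)
    ... | inj₁ a with searchPairs R? xs
    ...   | inj₁ b = inj₁ (a ∷ b)
    ...   | inj₂ (y , z , ys , r , p) = inj₂ (y , z , x ∷ ys , r ,
              ↭-trans (prep x p) (↭-trans (swap x y ↭-refl) (prep y (swap x z ↭-refl))))

    pairs-dichotomy : {R : A → A → Set} {xs : List A} → AllPairs R xs → ∀ {x y} → x ∈ xs → y ∈ xs → x ≡ y ⊎ R x y ⊎ R y x
    pairs-dichotomy (_ ∷ _)  (here refl) (here refl) = inj₁ refl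
    pairs-dichotomy (a ∷ _)  (here refl) (there m)   = inj₂ (inj₁ (All.lookup a m))
    pairs-dichotomy (a ∷ _)  (there m)   (here refl) = inj₂ (inj₂ (All.lookup a m))
    pairs-dichotomy (_ ∷ ps) (there m)   (there m')  = pairs-dichotomy ps m m'

    -- If some entry satisfies `a` and a different one satisfies `b`, the hypothesis fails. So
    -- either only one of the tests ever succeeds, or both succeed at a single entry; the summand 2
    -- covers the latter.
    exclusive-sum : (a b : A → Bool) (xs : List A) → AllPairs (λ p q → ¬ (T (a p) × T (b q) ⊎ T (a q) × T (b p))) xs →
                    ∑ xs (λ p → ⟦ a p ⟧ + ⟦ b p ⟧) ≤ length xs + 2
    exclusive-sum a b [] _ = z≤n
    exclusive-sum a b (p ∷ xs) (h ∷ hs) = go (a p) (b p) (λ t u m → All.lookup h m (inj₁ (t , u))) (λ t u m → All.lookup h m (inj₂ (u , t)))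
      where
      none : ∀ (c : A → Bool) → (∀ {q} → q ∈ xs → ¬ T (c q)) → ∀ {q} → q ∈ xs → ⟦ c q ⟧ ≤ 0
      none c k {q} m with c q | k m
      ... | false | _ = z≤n
      ... | true  | f = ⊥-elim (f tt)
      go : ∀ s t → (T s → ∀ {q} → T (b q) → q ∈ xs → ⊥) → (T t → ∀ {q} → T (a q) → q ∈ xs → ⊥) →
           ⟦ s ⟧ + ⟦ t ⟧ + ∑ xs (λ p → ⟦ a p ⟧ + ⟦ b p ⟧) ≤ suc (length xs) + 2
      go false false _ _ = ≤-trans (exclusive-sum a b xs hs) (n≤1+n _)
      go true  t     f g = ≤-trans (+-mono-≤ (s≤s (⟦⟧≤1 t)) (≤-trans (∑-mono-∈ xs (λ {q} m → +-mono-≤ (⟦⟧≤1 (a q)) (none b (λ m' u → f tt u m') m))) (≤-reflexive (∑-const xs 1))))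
                             (≤-trans (≤-reflexive (lem (length xs))) (s≤s (+-monoʳ-≤ (length xs) (s≤s z≤n))))
        where
        lem : ∀ l → 2 + l * 1 ≡ 1 + (l + 1)
        lem = solve-∀
      go false true  f g = ≤-trans (+-monoʳ-≤ 1 (≤-trans (∑-mono-∈ xs (λ {q} m → +-mono-≤ (none a (λ m' u → g tt u m') m) (⟦⟧≤1 (b q)))) (≤-reflexive (∑-const xs 1))))
                             (s≤s (≤-trans (≤-reflexive (*-identityʳ _)) (m≤m+n _ 2)))

  -- The condition 5(g + b) ≤ 2k absorbs the term quadratic in b: it says that a clique on the
  -- matched vertices has no more edges than the graph of all edges meeting half of them.
  matching-arith : ∀ e g b w k → k ≡ 2 * g + (2 * b + w) → 5 * (g + b) ≤ 2 * k →
    e ≤ 3 * (g * g) + 2 * (2 * (g * b) + (g + 2) * b) + 4 * (b * b) + 2 * (g * w) + 2 * (2 * b) →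
    e + (g + b) * (g + b) ≤ 2 * ((g + b) * k) + 8 * (g + b)
  matching-arith e g b w k refl h₁ h₂ = begin
    e + (g + b) * (g + b)
      ≤⟨ +-monoˡ-≤ ((g + b) * (g + b)) h₂ ⟩
    Z + (g + b) * (g + b)
      ≤⟨ m≤m+n (Z + (g + b) * (g + b)) (g * b + 8 * g) ⟩
    Z + (g + b) * (g + b) + (g * b + 8 * g)
      ≡⟨ lem₁ g b w ⟩
    b * (5 * (g + b)) + (2 * (g * k) + 8 * (g + b))
      ≤⟨ +-monoˡ-≤ (2 * (g * k) + 8 * (g + b)) (*-monoʳ-≤ b h₁) ⟩
    b * (2 * k) + (2 * (g * k) + 8 * (g + b))
      ≡⟨ lem₂ g b k ⟩
    2 * ((g + b) * k) + 8 * (g + b) ∎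
    where
    open ≤-Reasoning
    Z = 3 * (g * g) + 2 * (2 * (g * b) + (g + 2) * b) + 4 * (b * b) + 2 * (g * w) + 2 * (2 * b)
    lem₁ : ∀ g b w → 3 * (g * g) + 2 * (2 * (g * b) + (g + 2) * b) + 4 * (b * b) + 2 * (g * w) + 2 * (2 * b) + (g + b) * (g + b) + (g * b + 8 * g)
         ≡ b * (5 * (g + b)) + (2 * (g * (2 * g + (2 * b + w))) + 8 * (g + b))
    lem₁ = solve-∀
    lem₂ : ∀ g b k → b * (2 * k) + (2 * (g * k) + 8 * (g + b)) ≡ 2 * ((g + b) * k) + 8 * (g + b)
    lem₂ = solve-∀

  -- Half of the Erdős–Gallai theorem, by augmenting paths with at most three matching edges.
  module Matching {A : Set} (G : A → A → Bool) (G-sym : ∀ a b → G a b ≡ G b a) (G-irr : ∀ a → ¬ T (G a a)) (Ps : List A) where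

    gsym : ∀ {a b} → T (G a b) → T (G b a)
    gsym {a} {b} = subst T (G-sym a b)

    count : List A → List A → ℕ
    count S U = ∑ S (λ a → ∑ U (λ b → ⟦ G a b ⟧))

    degIn : List A → A → ℕ
    degIn W x = ∑ W (λ w → ⟦ G x w ⟧)

    Edges : List (A × A) → Set
    Edges = All (λ m → T (G (proj₁ m) (proj₂ m)))

    IsMatching : List (A × A) → Set
    IsMatching ms = Edges ms × ∃ λ W → flat ms ++ W ↭ Ps

    Augmented : ℕ → Set
    Augmented ν = ∃ λ ms → length ms ≡ suc ν × IsMatching ms

    -- Two uncovered neighbours instead of one: when an augmenting path already ends at one of them,
    -- another remains.
    Rich : List A → A × A → Set
    Rich W m = 2 ≤ degIn W (proj₁ m)

    Poor : List A → A × A → Set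
    Poor W m = degIn W (proj₁ m) ≤ 1 × degIn W (proj₂ m) ≤ 1

    record Sorted (ms : List (A × A)) (W : List A) : Set where
      field
        gs bs  : List (A × A)
        total  : length gs + length bs ≡ length ms
        perm   : flat gs ++ flat bs ↭ flat ms
        gEdges : Edges gs
        bEdges : Edges bs
        rich   : All (Rich W) gs
        poor   : All (Poor W) bs

    sort : ∀ ms W → Edges ms → Sorted ms W
    sort [] W [] = record { gs = [] ; bs = [] ; total = refl ; perm = ↭-refl ; gEdges = [] ; bEdges = [] ; rich = [] ; poor = [] }
    sort ((x , y) ∷ ms) W (e ∷ es) with sort ms W es | 2 ≤? degIn W x | 2 ≤? degIn W y
    ... | S | yes p | _ = record
      { gs = (x , y) ∷ S.gs ; bs = S.bs ; total = cong suc S.total ; perm = prep x (prep y S.perm)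
      ; gEdges = e ∷ S.gEdges ; bEdges = S.bEdges ; rich = p ∷ S.rich ; poor = S.poor }
      where module S = Sorted S
    ... | S | no _ | yes p = record
      { gs = (y , x) ∷ S.gs ; bs = S.bs ; total = cong suc S.total ; perm = ↭-trans (swap y x ↭-refl) (prep x (prep y S.perm))
      ; gEdges = gsym e ∷ S.gEdges ; bEdges = S.bEdges ; rich = p ∷ S.rich ; poor = S.poor }
      where module S = Sorted S
    ... | S | no p | no q = record
      { gs = S.gs ; bs = (x , y) ∷ S.bs ; total = trans (+-suc (length S.gs) (length S.bs)) (cong suc S.total)
      ; perm = ↭-trans (shifts (flat S.gs) (x ∷ y ∷ [])) (prep x (prep y S.perm))
      ; gEdges = S.gEdges ; bEdges = e ∷ S.bEdges ; rich = S.rich ; poor = (≤-pred (≰⇒> p) , ≤-pred (≰⇒> q)) ∷ S.poor }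
      where module S = Sorted S

    pick : ∀ W x → 0 < degIn W x → ∃ λ w → ∃ λ W' → T (G x w) × W ↭ w ∷ W'
    pick W x h with ∑-exceeds W (λ _ → 0) (λ w → ⟦ G x w ⟧) (subst (_< degIn W x) (sym (trans (∑-const W 0) (*-zeroʳ (length W)))) h)
    ... | w , m , p with ∈⇒↭ m
    ...   | W' , q = w , W' , 0<⟦⟧ p , q

    pick-other : ∀ {W w W'} x → W ↭ w ∷ W' → 2 ≤ degIn W x → ∃ λ w' → ∃ λ W″ → T (G x w') × W' ↭ w' ∷ W″
    pick-other {W} {w} {W'} x p h = pick W' x (≤-pred (≤-trans h (≤-trans (≤-reflexive (∑-↭ (λ v → ⟦ G x v ⟧) p)) (+-monoˡ-≤ (degIn W' x) (⟦⟧≤1 (G x w))))))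

    module _ {gs bs W} (cover : flat gs ++ flat bs ++ W ↭ Ps) (ge : Edges gs) (be : Edges bs) (rich : All (Rich W) gs) where

      ν = length gs + length bs

      augment₁ : ∀ {w w' W'} → T (G w w') → W ↭ w ∷ w' ∷ W' → Augmented ν
      augment₁ {w} {w'} {W'} g p = (w , w') ∷ gs ++ bs , cong suc (length-++ gs) , (g ∷ All-++⁺ ge be) , W' , (begin
        w ∷ w' ∷ flat (gs ++ bs) ++ W'            ≡⟨ cong (λ z → w ∷ w' ∷ z ++ W') (flat-++ gs bs) ⟩
        w ∷ w' ∷ (flat gs ++ flat bs) ++ W'       ↭⟨ shifts (w ∷ w' ∷ []) (flat gs ++ flat bs) ⟩
        (flat gs ++ flat bs) ++ w ∷ w' ∷ W'       ↭⟨ ++⁺ˡ (flat gs ++ flat bs) (↭-sym p) ⟩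
        (flat gs ++ flat bs) ++ W                 ≡⟨ ++-assoc (flat gs) (flat bs) W ⟩
        flat gs ++ flat bs ++ W                   ↭⟨ cover ⟩
        Ps ∎)
        where open PermutationReasoning

      -- Augmenting path w' x y w, where w' is a second neighbour of the rich end x.
      augment₂ : ∀ {x y gs'} w {W'} → gs ↭ (x , y) ∷ gs' → T (G y w) → W ↭ w ∷ W' → Augmented ν
      augment₂ {x} {y} {gs'} w {W'} p g q = go (pick-other x q (All.head (All-resp-↭ p rich)))
        where
        open PermutationReasoning
        go : (∃ λ w' → ∃ λ W″ → T (G x w') × W' ↭ w' ∷ W″) → Augmented ν
        go (w' , W″ , g' , r) = (w' , x) ∷ (y , w) ∷ gs' ++ bs , len , (gsym g' ∷ g ∷ All-++⁺ (All.tail (All-resp-↭ p ge)) be) , W″ , (begin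
          w' ∷ x ∷ y ∷ w ∷ flat (gs' ++ bs) ++ W″       ≡⟨ cong (λ z → w' ∷ x ∷ y ∷ w ∷ z ++ W″) (flat-++ gs' bs) ⟩
          w' ∷ x ∷ y ∷ w ∷ R ++ W″                      ↭⟨ reorder (x ∷ y ∷ w ∷ w' ∷ []) (from-just (permutation _≟ᶠ_ (# 3 ∷ # 0 ∷ # 1 ∷ # 2 ∷ []) (allFin 4))) (R ++ W″) ⟩
          x ∷ y ∷ w ∷ w' ∷ R ++ W″                      ↭⟨ prep x (prep y (shifts (w ∷ w' ∷ []) R)) ⟩
          x ∷ y ∷ R ++ w ∷ w' ∷ W″                      ↭⟨ prep x (prep y (++⁺ˡ R (↭-trans (prep w (↭-sym r)) (↭-sym q)))) ⟩
          x ∷ y ∷ R ++ W                                ≡⟨ cong (λ z → x ∷ y ∷ z) (++-assoc (flat gs') (flat bs) W) ⟩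
          flat ((x , y) ∷ gs') ++ flat bs ++ W          ↭⟨ ++⁺ʳ (flat bs ++ W) (flat-↭ (↭-sym p)) ⟩
          flat gs ++ flat bs ++ W                       ↭⟨ cover ⟩
          Ps ∎)
          where
          R = flat gs' ++ flat bs
          len : 2 + length (gs' ++ bs) ≡ suc ν
          len = cong suc (trans (cong suc (length-++ gs')) (cong (_+ length bs) (sym (↭-length p))))

      -- Augmenting path w x y y' x' w' through two rich edges.
      augment₃ : ∀ {x y x' y' gs'} → gs ↭ (x , y) ∷ (x' , y') ∷ gs' → T (G y y') → Augmented ν
      augment₃ {x} {y} {x'} {y'} {gs'} p g = go (pick W x (≤-trans (s≤s z≤n) (All.head rich')))
        where
        open PermutationReasoning
        rich' = All-resp-↭ p rich
        go : (∃ λ w → ∃ λ W' → T (G x w) × W ↭ w ∷ W') → Augmented ν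
        go (w , W' , g₁ , q) = go′ (pick-other x' q (All.head (All.tail rich')))
          where
          go′ : (∃ λ w' → ∃ λ W″ → T (G x' w') × W' ↭ w' ∷ W″) → Augmented ν
          go′ (w' , W″ , g₂ , r) = (w , x) ∷ (y , y') ∷ (x' , w') ∷ gs' ++ bs , len ,
              (gsym g₁ ∷ g ∷ g₂ ∷ All-++⁺ (All.tail (All.tail (All-resp-↭ p ge))) be) , W″ , (begin
            w ∷ x ∷ y ∷ y' ∷ x' ∷ w' ∷ flat (gs' ++ bs) ++ W″ ≡⟨ cong (λ z → w ∷ x ∷ y ∷ y' ∷ x' ∷ w' ∷ z ++ W″) (flat-++ gs' bs) ⟩
            w ∷ x ∷ y ∷ y' ∷ x' ∷ w' ∷ R ++ W″                ↭⟨ reorder (x ∷ y ∷ x' ∷ y' ∷ w ∷ w' ∷ []) (from-just (permutation _≟ᶠ_ (# 4 ∷ # 0 ∷ # 1 ∷ # 3 ∷ # 2 ∷ # 5 ∷ []) (allFin 6))) (R ++ W″) ⟩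
            x ∷ y ∷ x' ∷ y' ∷ w ∷ w' ∷ R ++ W″                ↭⟨ ++⁺ˡ (x ∷ y ∷ x' ∷ y' ∷ []) (shifts (w ∷ w' ∷ []) R) ⟩
            x ∷ y ∷ x' ∷ y' ∷ R ++ w ∷ w' ∷ W″                ↭⟨ ++⁺ˡ (x ∷ y ∷ x' ∷ y' ∷ R) (↭-trans (prep w (↭-sym r)) (↭-sym q)) ⟩
            x ∷ y ∷ x' ∷ y' ∷ R ++ W                          ≡⟨ cong (λ z → x ∷ y ∷ x' ∷ y' ∷ z) (++-assoc (flat gs') (flat bs) W) ⟩
            flat ((x , y) ∷ (x' , y') ∷ gs') ++ flat bs ++ W  ↭⟨ ++⁺ʳ (flat bs ++ W) (flat-↭ (↭-sym p)) ⟩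
            flat gs ++ flat bs ++ W                           ↭⟨ cover ⟩
            Ps ∎)
            where
            R = flat gs' ++ flat bs
            len : 3 + length (gs' ++ bs) ≡ suc ν
            len = cong suc (trans (cong (2 +_) (length-++ gs')) (cong (_+ length bs) (sym (↭-length p))))

      -- Augmenting path w x y z z' y' x' w' through two rich edges and the poor edge between them.
      augment₄ : ∀ {x y x' y' gs' z z' bs'} → gs ↭ (x , y) ∷ (x' , y') ∷ gs' → bs ↭ (z , z') ∷ bs' → T (G y z) → T (G y' z') → Augmented ν
      augment₄ {x} {y} {x'} {y'} {gs'} {z} {z'} {bs'} p p' g h = go (pick W x (≤-trans (s≤s z≤n) (All.head rich')))
        where
        open PermutationReasoning
        rich' = All-resp-↭ p rich
        go : (∃ λ w → ∃ λ W' → T (G x w) × W ↭ w ∷ W') → Augmented ν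
        go (w , W' , g₁ , q) = go′ (pick-other x' q (All.head (All.tail rich')))
          where
          go′ : (∃ λ w' → ∃ λ W″ → T (G x' w') × W' ↭ w' ∷ W″) → Augmented ν
          go′ (w' , W″ , g₂ , r) = (w , x) ∷ (y , z) ∷ (z' , y') ∷ (x' , w') ∷ gs' ++ bs' , len ,
              (gsym g₁ ∷ g ∷ gsym h ∷ g₂ ∷ All-++⁺ (All.tail (All.tail (All-resp-↭ p ge))) (All.tail (All-resp-↭ p' be))) , W″ , (begin
            w ∷ x ∷ y ∷ z ∷ z' ∷ y' ∷ x' ∷ w' ∷ flat (gs' ++ bs') ++ W″ ≡⟨ cong (λ u → w ∷ x ∷ y ∷ z ∷ z' ∷ y' ∷ x' ∷ w' ∷ u ++ W″) (flat-++ gs' bs') ⟩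
            w ∷ x ∷ y ∷ z ∷ z' ∷ y' ∷ x' ∷ w' ∷ R ++ W″  ↭⟨ reorder (x ∷ y ∷ x' ∷ y' ∷ z ∷ z' ∷ w ∷ w' ∷ []) (from-just (permutation _≟ᶠ_ (# 6 ∷ # 0 ∷ # 1 ∷ # 4 ∷ # 5 ∷ # 3 ∷ # 2 ∷ # 7 ∷ []) (allFin 8))) (R ++ W″) ⟩
            x ∷ y ∷ x' ∷ y' ∷ z ∷ z' ∷ w ∷ w' ∷ R ++ W″  ↭⟨ ++⁺ˡ (x ∷ y ∷ x' ∷ y' ∷ z ∷ z' ∷ []) (shifts (w ∷ w' ∷ []) R) ⟩
            x ∷ y ∷ x' ∷ y' ∷ z ∷ z' ∷ R ++ w ∷ w' ∷ W″  ↭⟨ ++⁺ˡ (x ∷ y ∷ x' ∷ y' ∷ z ∷ z' ∷ R) (↭-trans (prep w (↭-sym r)) (↭-sym q)) ⟩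
            x ∷ y ∷ x' ∷ y' ∷ z ∷ z' ∷ R ++ W            ≡⟨ cong (λ u → x ∷ y ∷ x' ∷ y' ∷ z ∷ z' ∷ u) (++-assoc (flat gs') (flat bs') W) ⟩
            x ∷ y ∷ x' ∷ y' ∷ z ∷ z' ∷ flat gs' ++ flat bs' ++ W ↭⟨ ++⁺ˡ (x ∷ y ∷ x' ∷ y' ∷ []) (shifts (z ∷ z' ∷ []) (flat gs')) ⟩
            flat ((x , y) ∷ (x' , y') ∷ gs') ++ flat ((z , z') ∷ bs') ++ W  ↭⟨ ++⁺ (flat-↭ (↭-sym p)) (++⁺ʳ W (flat-↭ (↭-sym p'))) ⟩
            flat gs ++ flat bs ++ W                      ↭⟨ cover ⟩
            Ps ∎)
            where
            R = flat gs' ++ flat bs'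
            len : 4 + length (gs' ++ bs') ≡ suc ν
            len = trans (cong (4 +_) (length-++ gs')) (trans (lem (length gs') (length bs'))
              (cong₂ (λ a b → suc (a + b)) (sym (↭-length p)) (sym (↭-length p'))))
              where
              lem : ∀ a b → 4 + (a + b) ≡ suc (2 + a + (1 + b))
              lem = solve-∀

      module _ (poor : All (Poor W) bs) (hW : AllPairs (λ w w' → ¬ T (G w w')) W)
        (hy : All (λ m → All (λ w → ¬ T (G (proj₂ m) w)) W) gs)
        (hyy : AllPairs (λ m m' → ¬ T (G (proj₂ m) (proj₂ m'))) gs)
        (hz : All (λ b → AllPairs (λ m m' → ¬ (T (G (proj₂ m) (proj₁ b)) × T (G (proj₂ m') (proj₂ b))
                                            ⊎ T (G (proj₂ m') (proj₁ b)) × T (G (proj₂ m) (proj₂ b)))) gs) bs) where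

        g b w : ℕ
        g = length gs
        b = length bs
        w = length W

        ¬T⇒0 : ∀ {c} → ¬ T c → ⟦ c ⟧ ≤ 0
        ¬T⇒0 {false} _ = z≤n
        ¬T⇒0 {true}  h = ⊥-elim (h tt)

        count-flat : ∀ ms U → count (flat ms) U ≡ ∑ ms (λ m → degIn U (proj₁ m) + degIn U (proj₂ m))
        count-flat ms U = ∑-flat ms (degIn U)

        deg≤ : ∀ U x → degIn U x ≤ length U
        deg≤ U x = ≤-trans (∑-≤const U (λ u → ⟦⟧≤1 (G x u))) (≤-reflexive (*-identityʳ (length U)))

        WW : count W W ≤ 0
        WW = ≤-trans (∑-mono-∈ W (λ m → ≤-trans (∑-mono-∈ W (λ m' → ¬T⇒0 (non m m'))) (≤-reflexive (trans (∑-const W 0) (*-zeroʳ w)))))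
               (≤-reflexive (trans (∑-const W 0) (*-zeroʳ w)))
          where
          non : ∀ {x y} → x ∈ W → y ∈ W → ¬ T (G x y)
          non m m' e with pairs-dichotomy hW m m'
          ... | inj₁ refl     = G-irr _ e
          ... | inj₂ (inj₁ h) = h e
          ... | inj₂ (inj₂ h) = h (gsym e)

        gW : count (flat gs) W ≤ g * w
        gW = ≤-trans (≤-reflexive (count-flat gs W)) (≤-trans (∑-mono-∈ gs (λ {m} i → +-mono-≤ (deg≤ W (proj₁ m))
               (≤-trans (∑-mono-∈ W (λ j → ¬T⇒0 (All.lookup (All.lookup hy i) j))) (≤-reflexive (trans (∑-const W 0) (*-zeroʳ w))))))
               (≤-reflexive (trans (∑-const gs (w + 0)) (cong (g *_) (+-identityʳ w)))))

        bW : count (flat bs) W ≤ 2 * b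
        bW = ≤-trans (≤-reflexive (count-flat bs W)) (≤-trans (∑-mono-∈ bs (λ i → +-mono-≤ (proj₁ (All.lookup poor i)) (proj₂ (All.lookup poor i))))
               (≤-reflexive (trans (∑-const bs 2) (*-comm b 2))))

        bb : count (flat bs) (flat bs) ≤ 4 * (b * b)
        bb = ≤-trans (∑-≤const (flat bs) (deg≤ (flat bs))) (≤-reflexive (trans (cong₂ _*_ (length-flat bs) (length-flat bs)) (lem b)))
          where
          lem : ∀ b → 2 * b * (2 * b) ≡ 4 * (b * b)
          lem = solve-∀

        gg : count (flat gs) (flat gs) ≤ 3 * (g * g)
        gg = ≤-trans (≤-reflexive (trans (count-flat gs (flat gs)) (∑-cong gs (λ m → trans (cong₂ _+_ (∑-flat gs _) (∑-flat gs _)) (sym (∑-+ gs _ _))))))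
               (≤-trans (∑-mono-∈ gs (λ {m} i → ∑-mono-∈ gs (λ {m'} j →
                  +-mono-≤ (+-mono-≤ (⟦⟧≤1 (G (proj₁ m) (proj₁ m'))) (⟦⟧≤1 (G (proj₁ m) (proj₂ m')))) (+-mono-≤ (⟦⟧≤1 (G (proj₂ m) (proj₁ m'))) (¬T⇒0 (non i j))))))
                 (≤-reflexive (trans (∑-cong gs (λ _ → ∑-const gs 3)) (trans (∑-const gs (g * 3)) (lem g)))))
          where
          lem : ∀ g → g * (g * 3) ≡ 3 * (g * g)
          lem = solve-∀
          non : ∀ {m m'} → m ∈ gs → m' ∈ gs → ¬ T (G (proj₂ m) (proj₂ m'))
          non i j e with pairs-dichotomy hyy i j
          ... | inj₁ refl     = G-irr _ e
          ... | inj₂ (inj₁ h) = h e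
          ... | inj₂ (inj₂ h) = h (gsym e)

        gb : count (flat gs) (flat bs) ≤ 2 * (g * b) + (g + 2) * b
        gb = begin
          count (flat gs) (flat bs)
            ≡⟨ trans (count-flat gs (flat bs)) (∑-+ gs (λ m → degIn (flat bs) (proj₁ m)) (λ m → degIn (flat bs) (proj₂ m))) ⟩
          ∑ gs (λ m → degIn (flat bs) (proj₁ m)) + ∑ gs (λ m → degIn (flat bs) (proj₂ m))
            ≤⟨ +-mono-≤ (≤-trans (∑-≤const gs (λ m → deg≤ (flat bs) (proj₁ m))) (≤-reflexive (trans (cong (g *_) (length-flat bs)) (lem g b)))) ys ⟩
          2 * (g * b) + (g + 2) * b ∎
          where
          open ≤-Reasoning
          lem : ∀ g b → g * (2 * b) ≡ 2 * (g * b)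
          lem = solve-∀
          -- The saving over the trivial bound 2gb: without `augment₄`, the second ends of the rich
          -- edges send at most g + 2 edges to each poor edge.
          ys : ∑ gs (λ m → degIn (flat bs) (proj₂ m)) ≤ (g + 2) * b
          ys = begin
            ∑ gs (λ m → degIn (flat bs) (proj₂ m))
              ≡⟨ trans (∑-cong gs (λ m → ∑-flat bs (λ v → ⟦ G (proj₂ m) v ⟧))) (∑-swap gs bs (λ m c → ⟦ G (proj₂ m) (proj₁ c) ⟧ + ⟦ G (proj₂ m) (proj₂ c) ⟧)) ⟩
            ∑ bs (λ c → ∑ gs (λ m → ⟦ G (proj₂ m) (proj₁ c) ⟧ + ⟦ G (proj₂ m) (proj₂ c) ⟧))
              ≤⟨ ∑-mono-∈ bs (λ {c} i → exclusive-sum (λ m → G (proj₂ m) (proj₁ c)) (λ m → G (proj₂ m) (proj₂ c)) gs (All.lookup hz i)) ⟩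
            ∑ bs (λ _ → g + 2) ≡⟨ trans (∑-const bs (g + 2)) (*-comm b (g + 2)) ⟩
            (g + 2) * b ∎

        count-++ˡ : ∀ S S' U → count (S ++ S') U ≡ count S U + count S' U
        count-++ˡ S S' U = ∑-++ S S' (degIn U)

        count-++ʳ : ∀ S U U' → count S (U ++ U') ≡ count S U + count S U'
        count-++ʳ S U U' = trans (∑-cong S (λ a → ∑-++ U U' _)) (∑-+ S _ _)

        count-sym : ∀ S U → count S U ≡ count U S
        count-sym S U = trans (∑-swap S U _) (∑-cong U (λ u → ∑-cong S (λ s → cong ⟦_⟧ (G-sym s u))))

        bound-edges : count Ps Ps ≤ 3 * (g * g) + 2 * (2 * (g * b) + (g + 2) * b) + 4 * (b * b) + 2 * (g * w) + 2 * (2 * b)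
        bound-edges = begin
          count Ps Ps                                     ≡⟨ trans (∑-↭ (degIn Ps) (↭-sym cover)) (∑-cong all (λ a → ∑-↭ _ (↭-sym cover))) ⟩
          count all all                                   ≡⟨ trans (count-++ˡ Fg (Fb ++ W) all) (cong (count Fg all +_) (count-++ˡ Fb W all)) ⟩
          count Fg all + (count Fb all + count W all)     ≡⟨ cong₂ _+_ (expand Fg) (cong₂ _+_ (expand Fb) (expand W)) ⟩
          (count Fg Fg + (count Fg Fb + count Fg W)) + ((count Fb Fg + (count Fb Fb + count Fb W)) + (count W Fg + (count W Fb + count W W)))
            ≡⟨ cong₂ (λ u v → (count Fg Fg + (count Fg Fb + count Fg W)) + ((u + (count Fb Fb + count Fb W)) + (v + (count W Fb + count W W)))) (count-sym Fb Fg) (count-sym W Fg) ⟩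
          (count Fg Fg + (count Fg Fb + count Fg W)) + ((count Fg Fb + (count Fb Fb + count Fb W)) + (count Fg W + (count W Fb + count W W)))
            ≡⟨ cong (λ u → (count Fg Fg + (count Fg Fb + count Fg W)) + ((count Fg Fb + (count Fb Fb + count Fb W)) + (count Fg W + (u + count W W)))) (count-sym W Fb) ⟩
          (count Fg Fg + (count Fg Fb + count Fg W)) + ((count Fg Fb + (count Fb Fb + count Fb W)) + (count Fg W + (count Fb W + count W W)))
            ≤⟨ +-mono-≤ (+-mono-≤ gg (+-mono-≤ gb gW)) (+-mono-≤ (+-mono-≤ gb (+-mono-≤ bb bW)) (+-mono-≤ gW (+-mono-≤ bW WW))) ⟩
          (3 * (g * g) + (X + g * w)) + ((X + (4 * (b * b) + 2 * b)) + (g * w + (2 * b + 0)))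
            ≡⟨ lem (3 * (g * g)) X (g * w) (4 * (b * b)) (2 * b) ⟩
          3 * (g * g) + 2 * X + 4 * (b * b) + 2 * (g * w) + 2 * (2 * b) ∎
          where
          open ≤-Reasoning
          Fg = flat gs
          Fb = flat bs
          all = Fg ++ Fb ++ W
          X = 2 * (g * b) + (g + 2) * b
          expand : ∀ S → count S all ≡ count S Fg + (count S Fb + count S W)
          expand S = trans (count-++ʳ S Fg (Fb ++ W)) (cong (count S Fg +_) (count-++ʳ S Fb W))
          lem : ∀ a x y c d → (a + (x + y)) + ((x + (c + d)) + (y + (d + 0))) ≡ a + 2 * x + c + 2 * y + 2 * d
          lem = solve-∀

        stuck : 5 * ν ≤ 2 * length Ps → count Ps Ps + ν * ν ≤ 2 * (ν * length Ps) + 8 * ν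
        stuck h = matching-arith (count Ps Ps) g b w (length Ps) len h bound-edges
          where
          len : length Ps ≡ 2 * g + (2 * b + w)
          len = trans (sym (↭-length cover)) (trans (length-++ (flat gs)) (cong₂ _+_ (length-flat gs)
            (trans (length-++ (flat bs)) (cong (_+ w) (length-flat bs)))))

      improve : All (Poor W) bs → Augmented ν ⊎ (5 * ν ≤ 2 * length Ps → count Ps Ps + ν * ν ≤ 2 * (ν * length Ps) + 8 * ν)
      improve poor with searchPairs (λ w w' → T? (G w w')) W
      ... | inj₂ (w , w' , W' , e , p) = inj₁ (augment₁ e p)
      ... | inj₁ hW with search (λ m → Any.any? (λ w → T? (G (proj₂ m) w)) W) gs
      ...   | inj₂ (m , gs' , a , p) = inj₁ (go (find a))
        where
        go : (∃ λ w → w ∈ W × T (G (proj₂ m) w)) → Augmented ν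
        go (w , i , e) = augment₂ w p e (proj₂ (∈⇒↭ i))
      ...   | inj₁ hy with searchPairs (λ m m' → T? (G (proj₂ m) (proj₂ m'))) gs
      ...     | inj₂ (m , m' , gs' , e , p) = inj₁ (augment₃ p e)
      ...     | inj₁ hyy with searchBad bs
        where
        Cross : A × A → A × A → A × A → Set
        Cross c m m' = T (G (proj₂ m) (proj₁ c)) × T (G (proj₂ m') (proj₂ c)) ⊎ T (G (proj₂ m') (proj₁ c)) × T (G (proj₂ m) (proj₂ c))
        Cross? : ∀ c m m' → Dec (Cross c m m')
        Cross? c m m' = (T? _ ×-dec T? _) ⊎-dec (T? _ ×-dec T? _)
        searchBad : ∀ cs → All (λ c → AllPairs (λ m m' → ¬ Cross c m m') gs) cs ⊎
                    ∃ λ c → ∃ λ cs' → cs ↭ c ∷ cs' × ∃ λ m → ∃ λ m' → ∃ λ gs' → Cross c m m' × gs ↭ m ∷ m' ∷ gs'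
        searchBad [] = inj₁ []
        searchBad (c ∷ cs) with searchPairs (Cross? c) gs
        ... | inj₂ f = inj₂ (c , cs , ↭-refl , f)
        ... | inj₁ h with searchBad cs
        ...   | inj₁ hs = inj₁ (h ∷ hs)
        ...   | inj₂ (d , cs' , p , f) = inj₂ (d , c ∷ cs' , ↭-trans (prep c p) (swap c d ↭-refl) , f)
      ...       | inj₂ (c , bs' , p , m , m' , gs' , inj₁ (e , f) , q) = inj₁ (augment₄ q p e f)
      ...       | inj₂ (c , bs' , p , m , m' , gs' , inj₂ (e , f) , q) = inj₁ (augment₄ (↭-trans q (swap m m' ↭-refl)) p e f)
      ...       | inj₁ hz = inj₂ (stuck poor hW (All.map (λ ¬a → ¬Any⇒All¬ W ¬a) hy) hyy hz)

    grow : ∀ ms → IsMatching ms → Augmented (length ms) ⊎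
           (5 * length ms ≤ 2 * length Ps → count Ps Ps + length ms * length ms ≤ 2 * (length ms * length Ps) + 8 * length ms)
    grow ms (es , W , p) = subst (λ ν → Augmented ν ⊎ (5 * ν ≤ 2 * length Ps → count Ps Ps + ν * ν ≤ 2 * (ν * length Ps) + 8 * ν)) S.total
        (improve (↭-trans (↭-reflexive (sym (++-assoc (flat S.gs) (flat S.bs) W))) (↭-trans (++⁺ʳ W S.perm) p)) S.gEdges S.bEdges S.rich S.poor)
      where module S = Sorted (sort ms W es)

    -- A matching that admits none of the augmentations forces few edges, and this bound grows with
    -- the size of the matching, so getting stuck at any size up to t contradicts the density.
    large-matching : ∀ t → 5 * t ≤ 2 * length Ps → t ≤ length Ps → 2 * (t * length Ps) + 8 * t < count Ps Ps + t * t →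
                     ∃ λ ms → length ms ≡ suc t × IsMatching ms
    large-matching t h₁ h₂ h₃ = go (suc t) ≤-refl
      where
      open ≤-Reasoning
      k = length Ps
      monotone : ∀ ν δ → ν + δ ≡ t → count Ps Ps + ν * ν ≤ 2 * (ν * k) + 8 * ν → count Ps Ps + t * t ≤ 2 * (t * k) + 8 * t
      monotone ν δ refl h = begin
        count Ps Ps + (ν + δ) * (ν + δ)                    ≡⟨ lem₁ (count Ps Ps) ν δ ⟩
        count Ps Ps + ν * ν + δ * (ν + (ν + δ))            ≤⟨ +-mono-≤ h (*-monoʳ-≤ δ (+-mono-≤ (≤-trans (m≤m+n ν δ) h₂) h₂)) ⟩
        2 * (ν * k) + 8 * ν + δ * (k + k)                  ≤⟨ m≤m+n _ (8 * δ) ⟩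
        2 * (ν * k) + 8 * ν + δ * (k + k) + 8 * δ          ≡⟨ lem₂ ν δ k ⟩
        2 * ((ν + δ) * k) + 8 * (ν + δ)                    ∎
        where
        lem₁ : ∀ c ν δ → c + (ν + δ) * (ν + δ) ≡ c + ν * ν + δ * (ν + (ν + δ))
        lem₁ = solve-∀
        lem₂ : ∀ ν δ k → 2 * (ν * k) + 8 * ν + δ * (k + k) + 8 * δ ≡ 2 * ((ν + δ) * k) + 8 * (ν + δ)
        lem₂ = solve-∀
      go : ∀ j → j ≤ suc t → ∃ λ ms → length ms ≡ j × IsMatching ms
      go zero    _ = [] , refl , [] , Ps , ↭-refl
      go (suc j) (s≤s j≤t) = next (go j (m≤n⇒m≤1+n j≤t))
        where
        next : (∃ λ ms → length ms ≡ j × IsMatching ms) → ∃ λ ms → length ms ≡ suc j × IsMatching ms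
        next (ms , refl , M) with grow ms M
        ... | inj₁ a = a
        ... | inj₂ f = contradiction (monotone (length ms) (t ∸ length ms) (m+[n∸m]≡n j≤t) (f (≤-trans (*-monoʳ-≤ 5 j≤t) h₁))) (<⇒≱ h₃)

  -- Blow-ups and zigzag paths

  -- Makes the witness the same for a positive proportion of samples, at the cost of the number of
  -- possible witnesses. Each sample is charged to the index of its own witness.
  dense-pigeonhole : {A B : Set} {xs : List A} (ms : List B) {P : B → A → Set} {D : ℕ} → 0 < length xs →
                     Dense xs D (λ x → ∃ λ μ → μ ∈ ms × P μ x) → ∃ λ μ → μ ∈ ms × Dense xs (D * length ms) (P μ)
  dense-pigeonhole {A} {B} {xs} ms {P} {D} 0<xs d@(dense f s b) = lookup ms i , ∈-lookup i , dense (f′ i) (s′ i) big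
    where
    open ≤-Reasoning
    L = length ms
    f′ : Fin L → A → Bool
    f′ i x = guard (f x) (λ p _ → ⌊ Any.index (proj₁ (proj₂ (s x p))) ≟ᶠ i ⌋) tt
    s′ : ∀ i x → T (f′ i x) → P (lookup ms i) x
    s′ i x h with guard-sound (f x) (λ p _ → ⌊ Any.index (proj₁ (proj₂ (s x p))) ≟ᶠ i ⌋) tt h
    ... | p , q = subst (λ μ → P μ x) (trans (lookup-index (proj₁ (proj₂ (s x p)))) (cong (lookup ms) (toWitness q))) (proj₂ (proj₂ (s x p)))
    cover : ∀ x → ⟦ f x ⟧ ≤ ∑ (allFin L) (λ i → ⟦ f′ i x ⟧)
    cover x with f x | s x
    ... | false | _ = z≤n
    ... | true  | k = ≤-trans (≤-reflexive (sym (⟦T⟧ {⌊ j ≟ᶠ j ⌋} (fromWitness refl)))) (term≤∑ (λ i → ⟦ ⌊ j ≟ᶠ i ⌋ ⟧) (∈-allFin j))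
      where j = Any.index (proj₁ (proj₂ (k tt)))
    0<L : 0 < L
    0<L with dense-∃ 0<xs d
    ... | _ , _ , _ , m , _ = nonempty m
      where
      nonempty : ∀ {y : B} {ys : List B} → y ∈ ys → 0 < length ys
      nonempty (here _)  = s≤s z≤n
      nonempty (there _) = s≤s z≤n
    avg : ∃ λ i → i ∈ allFin L × length xs ≤ D * L * ∑ xs (λ x → ⟦ f′ i x ⟧)
    avg = ∑-average (allFin L) (length xs) (λ i → D * L * ∑ xs (λ x → ⟦ f′ i x ⟧)) (subst (0 <_) (sym (length-allFin L)) 0<L) (begin
      length (allFin L) * length xs                                 ≡⟨ cong (_* length xs) (length-allFin L) ⟩
      L * length xs                                                 ≤⟨ *-monoʳ-≤ L (≤-trans b (*-monoʳ-≤ D (∑-mono xs cover))) ⟩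
      L * (D * ∑ xs (λ x → ∑ (allFin L) (λ i → ⟦ f′ i x ⟧)))        ≡⟨ lem L D (∑ xs (λ x → ∑ (allFin L) (λ i → ⟦ f′ i x ⟧))) ⟩
      D * L * ∑ xs (λ x → ∑ (allFin L) (λ i → ⟦ f′ i x ⟧))          ≡⟨ cong (D * L *_) (∑-swap xs (allFin L) (λ x i → ⟦ f′ i x ⟧)) ⟩
      D * L * ∑ (allFin L) (λ i → ∑ xs (λ x → ⟦ f′ i x ⟧))          ≡⟨ sym (∑-* (allFin L) (D * L) _) ⟩
      ∑ (allFin L) (λ i → D * L * ∑ xs (λ x → ⟦ f′ i x ⟧))          ∎)
      where
      lem : ∀ l d s → l * (d * s) ≡ d * l * s
      lem = solve-∀
    i = proj₁ avg
    big = proj₂ (proj₂ avg)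

  -- The losses of one round of `dense-blowup`: splitting off a coordinate and exchanging gives 2(2D
  -- · 2D), then an S-th power and a second exchange.
  fubiniD blowD : ℕ → ℕ → ℕ
  fubiniD S D = 2 * (D * D ^ S)
  blowD S D = fubiniD S (2 * (2 * D * (2 * D)))

  blowupD : ℕ → ℕ → ℕ → ℕ
  blowupD zero    S D = D
  blowupD (suc k) S D = blowD S D * blowupD k S (blowD S D)

  selection : {A : Set} {k S : ℕ} → Vec A (k * S) → (Fin k → Fin S) → Vec A k
  selection T φ = Vec.tabulate (λ i → Vec.lookup T (combine i (φ i)))

  -- The counting form of Erdős's theorem on complete k-partite subgraphs. Many tails r have many
  -- heads a; S heads drawn independently for the same r are all good with positive proportion.
  -- After an exchange these S heads share a dense set of tails, and the induction blows up the
  -- tails.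
  dense-blowup : {A : Set} {xs : List A} → 0 < length xs → ∀ k S {D} {P : Vec A k → Set} → Dense (vecs xs k) D P →
                 Dense (vecs xs (k * S)) (blowupD k S D) (λ T → ∀ φ → P (selection T φ))
  dense-blowup pos zero    S d = dense-mono (λ { [] p φ → p }) d
  dense-blowup {A} {xs} pos (suc k) S {D} {P} d = dense-++ {xs = xs} S (dense-mono (λ c d′ → dense-mono (λ T h φ →
      subst (λ u → P u) (cong₂ _∷_ (sym (lookup-++ˡ c T (φ zero))) (tabulate-cong (λ i → sym (lookup-++ʳ c T (combine i (φ (suc i)))))))
        (h (λ i → φ (suc i)) (φ zero)))
      (dense-blowup pos k S d′))
    (dense-fubini (vecs xs k) (vecs xs S) {P = λ r c → ∀ κ → P (Vec.lookup c κ ∷ r)} (0<vecs pos k)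
      (dense-mono (λ r → dense-power {xs = xs} S) (dense-fubini xs (vecs xs k) {P = λ a r → P (a ∷ r)} pos (dense-uncons (0<vecs pos k) d)))))

  -- The loose path X₀ U₀ Y₀ U₁ X₁ U₂ Y₁ … with 1 + c edges.
  module _ {A : Set} where

    zigzag : (X Y U : ℕ → A) → ℕ → List A
    zigzag X Y U zero    = X 0 ∷ U 0 ∷ Y 0 ∷ []
    zigzag X Y U (suc c) = X 0 ∷ U 0 ∷ zigzag Y (X ∘ suc) (U ∘ suc) c

    zigTail : (X Y U : ℕ → A) → ℕ → List A
    zigTail X Y U zero    = []
    zigTail X Y U (suc c) = U 1 ∷ X 1 ∷ zigTail Y (X ∘ suc) (U ∘ suc) c

    zigStart : (X Y U : ℕ → A) → A × A × A
    zigStart X Y U = X 0 , U 0 , Y 0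

    zigEnd : (X Y U : ℕ → A) → ℕ → A × A × A
    zigEnd X Y U zero    = X 0 , U 0 , Y 0
    zigEnd X Y U (suc c) = zigEnd Y (X ∘ suc) (U ∘ suc) c

    zigzag-split : ∀ X Y U c → zigzag X Y U c ≡ X 0 ∷ U 0 ∷ Y 0 ∷ zigTail X Y U c
    zigzag-split X Y U zero    = refl
    zigzag-split X Y U (suc c) = cong (λ z → X 0 ∷ U 0 ∷ z) (zigzag-split Y (X ∘ suc) (U ∘ suc) c)

    length-zigTail : ∀ X Y U c → length (zigTail X Y U c) ≡ 2 * c
    length-zigTail X Y U zero    = refl
    length-zigTail X Y U (suc c) = trans (cong (2 +_) (length-zigTail Y (X ∘ suc) (U ∘ suc) c)) (sym (*-suc 2 c))

    ∈-zigzag : ∀ X Y U c {a} → a ∈ zigzag X Y U c →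
               (∃ λ k → 2 * k ≤ suc c × a ≡ X k) ⊎ (∃ λ k → 2 * k ≤ c × a ≡ Y k) ⊎ (∃ λ k → k ≤ c × a ≡ U k)
    ∈-zigzag X Y U zero    (here refl)                 = inj₁ (0 , z≤n , refl)
    ∈-zigzag X Y U zero    (there (here refl))         = inj₂ (inj₂ (0 , z≤n , refl))
    ∈-zigzag X Y U zero    (there (there (here refl))) = inj₂ (inj₁ (0 , z≤n , refl))
    ∈-zigzag X Y U (suc c) (here refl)                 = inj₁ (0 , z≤n , refl)
    ∈-zigzag X Y U (suc c) (there (here refl))         = inj₂ (inj₂ (0 , z≤n , refl))
    ∈-zigzag X Y U (suc c) (there (there m)) with ∈-zigzag Y (X ∘ suc) (U ∘ suc) c m
    ... | inj₁ (k , h , e)        = inj₂ (inj₁ (k , h , e))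
    ... | inj₂ (inj₁ (k , h , e)) = inj₁ (suc k , subst (_≤ suc (suc c)) (sym (*-suc 2 k)) (s≤s (s≤s h)) , e)
    ... | inj₂ (inj₂ (k , h , e)) = inj₂ (inj₂ (suc k , s≤s h , e))

    zigzag-unique : ∀ X Y U c → (∀ {k l} → 2 * k ≤ suc c → 2 * l ≤ suc c → X k ≡ X l → k ≡ l) →
      (∀ {k l} → 2 * k ≤ c → 2 * l ≤ c → Y k ≡ Y l → k ≡ l) → (∀ {k l} → k ≤ c → l ≤ c → U k ≡ U l → k ≡ l) →
      (∀ k l → X k ≢ Y l) → (∀ k l → X k ≢ U l) → (∀ k l → Y k ≢ U l) → Unique (zigzag X Y U c)
    zigzag-unique X Y U zero    xi yi ui xy xu yu = (xu 0 0 ∷ xy 0 0 ∷ []) ∷ ((λ e → yu 0 0 (sym e)) ∷ []) ∷ [] ∷ []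
    zigzag-unique X Y U (suc c) xi yi ui xy xu yu =
      (xu 0 0 ∷ All.tabulate (λ m e → nx m (sym e))) ∷ All.tabulate (λ m e → nu m (sym e)) ∷
        zigzag-unique Y (X ∘ suc) (U ∘ suc) c yi
          (λ {k} {l} h h' e → suc-injective (xi (up k h) (up l h') e)) (λ h h' e → suc-injective (ui (s≤s h) (s≤s h') e))
          (λ k l e → xy (suc l) k (sym e)) (λ k l → yu k (suc l)) (λ k l → xu (suc k) (suc l))
      where
      up : ∀ k → 2 * k ≤ c → 2 * suc k ≤ suc (suc c)
      up k h = subst (_≤ suc (suc c)) (sym (*-suc 2 k)) (s≤s (s≤s h))
      nx : ∀ {a} → a ∈ zigzag Y (X ∘ suc) (U ∘ suc) c → a ≢ X 0
      nx m e with ∈-zigzag Y (X ∘ suc) (U ∘ suc) c m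
      ... | inj₁ (k , h , refl)        = xy 0 k (sym e)
      ... | inj₂ (inj₁ (k , h , refl)) = 1+n≢0 (xi (up k h) z≤n e)
      ... | inj₂ (inj₂ (k , h , refl)) = xu 0 (suc k) (sym e)
      nu : ∀ {a} → a ∈ zigzag Y (X ∘ suc) (U ∘ suc) c → a ≢ U 0
      nu m e with ∈-zigzag Y (X ∘ suc) (U ∘ suc) c m
      ... | inj₁ (k , h , refl)        = yu k 0 e
      ... | inj₂ (inj₁ (k , h , refl)) = xu (suc k) 0 e
      ... | inj₂ (inj₂ (k , h , refl)) = 1+n≢0 (ui (s≤s h) z≤n e)

  map-zigTail : {A B : Set} (f : A → B) → ∀ X Y U c → map f (zigTail X Y U c) ≡ zigTail (f ∘ X) (f ∘ Y) (f ∘ U) c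
  map-zigTail f X Y U zero    = refl
  map-zigTail f X Y U (suc c) = cong (λ z → f (U 1) ∷ f (X 1) ∷ z) (map-zigTail f Y (X ∘ suc) (U ∘ suc) c)

  map-zigEnd : {A B : Set} (f : A → B) → ∀ X Y U c → triple→ f (zigEnd X Y U c) ≡ zigEnd (f ∘ X) (f ∘ Y) (f ∘ U) c
  map-zigEnd f X Y U zero    = refl
  map-zigEnd f X Y U (suc c) = map-zigEnd f Y (X ∘ suc) (U ∘ suc) c

  module _ {r N q : ℕ} where

    Avoid² : Tm r N q → Tm r N q → Set
    Avoid² (var i _) (var j _) = i ≢ j
    Avoid² _         _         = ⊥

    Avoid²-sep : ∀ d x a b c → Avoid² d x → Avoid² d a → Avoid² d b → Avoid² d c → Avoid² x a → Avoid² x b → Avoid² x c → Sep d x (a , b , c)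
    Avoid²-sep (var _ _) (var _ _) (var _ _) (var _ _) (var _ _) h h₁ h₂ h₃ h₄ h₅ h₆ = h , (h₁ , h₂ , h₃) , (h₄ , h₅ , h₆)

    -- Each new edge adds two cells that do not occur in the previous edge, so the later edge is
    -- always the random one.
    zigzag-ok : ∀ (X Y U : ℕ → Tm r N q) c → (∀ {k} → 2 * k ≤ c → Avoid² (X (suc k)) (X k)) → (∀ {k} → suc (2 * k) ≤ c → Avoid² (Y (suc k)) (Y k)) →
      (∀ {k} → suc k ≤ c → Avoid² (U (suc k)) (U k)) → (∀ k l → Avoid² (X k) (Y l)) → (∀ k l → Avoid² (Y k) (X l)) →
      (∀ k l → Avoid² (U k) (X l)) → (∀ k l → Avoid² (U k) (Y l)) → (∀ k l → Avoid² (X k) (U l)) → (∀ k l → Avoid² (Y k) (U l)) →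
      Ok (zigStart X Y U) (zigTail X Y U c)
    zigzag-ok X Y U zero    _ _ _ _ _ _ _ _ _ = tt
    zigzag-ok X Y U (suc c) xx yy uu xy yx ux uy xu yu =
      inj₁ (Avoid²-sep (U 1) (X 1) (X 0) (U 0) (Y 0) (ux 1 1) (ux 1 0) (uu (s≤s z≤n)) (uy 1 0) (xx z≤n) (xu 1 0) (xy 1 0)) ,
      zigzag-ok Y (X ∘ suc) (U ∘ suc) c (λ h → yy (s≤s h)) (λ {k} h → xx (subst (_≤ suc c) (sym (*-suc 2 k)) (s≤s h))) (λ h → uu (s≤s h))
        (λ k l → yx k (suc l)) (λ k l → xy (suc k) l) (λ k l → uy (suc k) l) (λ k l → ux (suc k) (suc l)) (λ k l → yu k (suc l)) (λ k l → xu (suc k) (suc l))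

  module _ {n : ℕ} (H : Coloured n) where

    open Links H

    zigzag-Linked : ∀ (X Y U : ℕ → V) c → (∀ k l u → T (E (Y l) (U u) (X k))) → (∀ k l u → T (E (X k) (U u) (Y l))) →
                    Linked (zigStart X Y U) (zigTail X Y U c) (zigEnd X Y U c)
    zigzag-Linked X Y U zero    yx xy = refl
    zigzag-Linked X Y U (suc c) yx xy = yx 1 0 1 , zigzag-Linked Y (X ∘ suc) (U ∘ suc) c (λ k l u → xy (suc l) k (suc u) ) (λ k l u → yx (suc l) k (suc u))

  all-lookup : {A : Set} {P : A → Set} {k : ℕ} (v : Vec A k) → All P (Vec.toList v) → ∀ c → P (Vec.lookup v c)
  all-lookup (x ∷ v) (p ∷ ps) zero    = p
  all-lookup (x ∷ v) (p ∷ ps) (suc c) = all-lookup v ps c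

  side : {A : Set} {k : ℕ} → Vec (A × A) k → Bool → Fin k → A
  side μ false c = proj₁ (Vec.lookup μ c)
  side μ true  c = proj₂ (Vec.lookup μ c)

  side∈flat : {A : Set} {k : ℕ} (μ : Vec (A × A) k) → ∀ b c → side μ b c ∈ flat (Vec.toList μ)
  side∈flat ((x , y) ∷ μ) false zero    = here refl
  side∈flat ((x , y) ∷ μ) true  zero    = there (here refl)
  side∈flat ((x , y) ∷ μ) false (suc c) = there (there (side∈flat μ false c))
  side∈flat ((x , y) ∷ μ) true  (suc c) = there (there (side∈flat μ true c))

  side-suc : {A : Set} {k : ℕ} (m : A × A) (μ : Vec (A × A) k) → ∀ b c → side (m ∷ μ) b (suc c) ≡ side μ b c
  side-suc m μ false c = refl
  side-suc m μ true  c = refl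

  side-injective : {A : Set} {k : ℕ} (μ : Vec (A × A) k) → Unique (flat (Vec.toList μ)) →
                   ∀ b c b' c' → side μ b c ≡ side μ b' c' → b ≡ b' × c ≡ c'
  side-injective ((x , y) ∷ μ) ((x≢y ∷ x∉) ∷ y∉ ∷ u) = go
    where
    go : ∀ b c b' c' → side ((x , y) ∷ μ) b c ≡ side ((x , y) ∷ μ) b' c' → b ≡ b' × c ≡ c'
    go false zero    false zero     e = refl , refl
    go true  zero    true  zero     e = refl , refl
    go false zero    true  zero     e = contradiction e x≢y
    go true  zero    false zero     e = contradiction (sym e) x≢y
    go false zero    b'    (suc c') e = contradiction (trans e (side-suc (x , y) μ b' c')) (All.lookup x∉ (side∈flat μ b' c'))
    go true  zero    b'    (suc c') e = contradiction (trans e (side-suc (x , y) μ b' c')) (All.lookup y∉ (side∈flat μ b' c'))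
    go b     (suc c) false zero     e = contradiction (trans (sym e) (side-suc (x , y) μ b c)) (All.lookup x∉ (side∈flat μ b c))
    go b     (suc c) true  zero     e = contradiction (trans (sym e) (side-suc (x , y) μ b c)) (All.lookup y∉ (side∈flat μ b c))
    go b     (suc c) b'    (suc c') e with side-injective μ u b c b' c' (trans (sym (side-suc (x , y) μ b c)) (trans e (side-suc (x , y) μ b' c')))
    ... | p , r = p , cong suc r

  Unique-++⁻ˡ : {A : Set} (xs : List A) {ys : List A} → Unique (xs ++ ys) → Unique xs
  Unique-++⁻ˡ []       u       = []
  Unique-++⁻ˡ (x ∷ xs) (h ∷ u) = All.tabulate (λ m → All.lookup h (∈-++⁺ˡ m)) ∷ Unique-++⁻ˡ xs u

  Unique-resp-↭ : {A : Set} {xs ys : List A} → xs ↭ ys → Unique xs → Unique ys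
  Unique-resp-↭ _↭_.refl        u             = u
  Unique-resp-↭ (prep x p)      (h ∷ u)       = All-resp-↭ p h ∷ Unique-resp-↭ p u
  Unique-resp-↭ (swap x y p)    ((x≢y ∷ h) ∷ h' ∷ u) = ((x≢y ∘ sym) ∷ All-resp-↭ p h') ∷ All-resp-↭ p h ∷ Unique-resp-↭ p u
  Unique-resp-↭ (_↭_.trans p q) u             = Unique-resp-↭ q (Unique-resp-↭ p u)

  ∑-tabulate-const : {A : Set} {k c : ℕ} (f : Fin k → A) (h : A → ℕ) → (∀ i → h (f i) ≡ c) → ∑ (tabulate f) h ≡ k * c
  ∑-tabulate-const {k = zero}  f h e = refl
  ∑-tabulate-const {k = suc k} f h e = cong₂ _+_ (e zero) (∑-tabulate-const (f ∘ suc) h (e ∘ suc))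

  -- Tiles, exchanges of tiles, and Hamilton cycles.

  module Tiles {n : ℕ} (H : Coloured n) where

    open Links H

    record IsTile (q : ℕ) (L : List V) : Set where
      field
        start end : Port
        tail      : List V
        split     : L ≡ corners start ++ tail
        edge      : IsEdge start
        link      : Link start tail end
        size      : length L ≡ q

    -- Of the M blocks at j (suc _), those listed in `broken` are replaced, using also vertices at j zero, by one tile more.
    record NewTiles (q M κ : ℕ) (at : Fin M → Fin (suc q) → V) : Set where
      field
        newTiles : List (List V)
        number   : length newTiles ≡ suc κ
        areTiles : All (IsTile q) newTiles
        unique   : Unique (concat newTiles)
        broken   : List (Fin M)
        ∣broken∣ : length broken ≡ κ
        located  : ∀ {v} → v ∈ concat newTiles → (∃ λ j → ∃ λ a → j ∈ broken × v ≡ at j (suc a)) ⊎ (∃ λ j → v ≡ at j zero)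

    -- The list starts after the last vertex of `base` and runs once around until `base` is again
    -- the last edge; thus the comparison of colours across the seam is part of `closed`.
    record HamiltonCycle : Set where
      field
        base   : Port
        cycle  : List V
        closed : Link base cycle base
        spans  : cycle ↭ allFin n

  -- Weaving tiles along a matching

  module Sample {n : ℕ} (H : Coloured n) (g m s q M : ℕ) (0<g : 0 < g) (0<s : 0 < s) (0<mq : 0 < m * q) (0<M : 0 < M)
    (at : Fin M → Fin (suc q) → Fin n) (at-inj : ∀ p {j j'} → at j p ≡ at j' p → j ≡ j')
    (hm : 7 * g + 12 ≤ 4 * m)
    (eg : ∀ e → (7 * g + 4) * (m * q * (m * q)) ≤ 16 * g * e → 2 * (m * s * (m * q)) + 8 * (m * s) < e + m * s * (m * s))
    (5t≤2k : 5 * (m * s) ≤ 2 * (m * q)) (t≤k : m * s ≤ m * q)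
    (link-density : ∀ u → (7 * g + 12) * (q * q) * (M * M) ≤ 16 * g * ∑ (allFin M) (λ j → ∑ (allFin M) (λ j' →
      ∑ (allFin q) (λ a → ∑ (allFin q) (λ a' → ⟦ Coloured.E H u (at j (suc a)) (at j' (suc a')) ⟧)))))
    (D₀ : ℕ) (D₀≡ : D₀ ≡ 4 * g * (m * q * (m * q)) ^ suc (m * s)) where

    open Links H
    open Tiles H
    open Sampling H M (suc q) 0<M at at-inj public

    Pos : Set
    Pos = Fin m × Fin q

    Ps : List Pos
    Ps = cartesianProduct (allFin m) (allFin q)

    ∣Ps∣ : length Ps ≡ m * q
    ∣Ps∣ = trans (length-cart _,_ (allFin m) (allFin q)) (cong₂ _*_ (length-allFin m) (length-allFin q))

    -- The first sampled cell contributes its uncovered vertex, stored at position `zero`; the other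
    -- m cells contribute their blocks, stored at the positions `suc a`.
    joined : Vec (Fin M) (suc m) → Pos → Pos → Bool
    joined t (i , a) (i' , a') = E (at (Vec.lookup t zero) zero) (at (Vec.lookup t (suc i)) (suc a)) (at (Vec.lookup t (suc i')) (suc a'))

    -- Pairs inside one tile are discarded because their vertices come from the same cell. The ends
    -- of a matching edge then lie in independent cells, as the colour count requires.
    adj : Vec (Fin M) (suc m) → Pos → Pos → Bool
    adj t p p' = not ⌊ proj₁ p ≟ᶠ proj₁ p' ⌋ ∧ joined t p p'

    ≟-sym : ∀ {k} (i j : Fin k) → ⌊ i ≟ᶠ j ⌋ ≡ ⌊ j ≟ᶠ i ⌋
    ≟-sym i j with i ≟ᶠ j | j ≟ᶠ i
    ... | yes _    | yes _    = refl
    ... | no _     | no _     = refl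
    ... | yes refl | no ¬p    = contradiction refl ¬p
    ... | no ¬p    | yes refl = contradiction refl ¬p

    adj-sym : ∀ t p p' → adj t p p' ≡ adj t p' p
    adj-sym t p p' = cong₂ (λ b e → not b ∧ e) (≟-sym (proj₁ p) (proj₁ p')) (E-swap _ _ _)

    adj-irr : ∀ t p → ¬ T (adj t p p)
    adj-irr t (i , a) h with i ≟ᶠ i
    ... | no ¬p = ¬p refl

    adj-separate : ∀ t p p' → T (adj t p p') → proj₁ p ≢ proj₁ p'
    adj-separate t (i , a) (.i , a') h refl with i ≟ᶠ i
    ... | no ¬p = ¬p refl

    IsMatchingAt : Vec (Fin M) (suc m) → List (Pos × Pos) → Set
    IsMatchingAt t = Matching.IsMatching (adj t) (adj-sym t) (adj-irr t) Ps

    degrees : Vec (Fin M) (suc m) → ℕ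
    degrees t = Matching.count (adj t) (adj-sym t) (adj-irr t) Ps Ps Ps

    pairSum : Vec (Fin M) (suc m) → Fin m → Fin m → ℕ
    pairSum t i i' = ∑ (allFin q) (λ a → ∑ (allFin q) (λ a' → ⟦ joined t (i , a) (i' , a') ⟧))

    ⟦∧⟧ : ∀ a b → ⟦ a ∧ b ⟧ ≡ ⟦ a ⟧ * ⟦ b ⟧
    ⟦∧⟧ true  b = sym (+-identityʳ ⟦ b ⟧)
    ⟦∧⟧ false b = refl

    differ : Fin m → Fin m → ℕ
    differ i i' = ⟦ not ⌊ i ≟ᶠ i' ⌋ ⟧

    degrees≡ : ∀ t → degrees t ≡ ∑ (allFin m) (λ i → ∑ (allFin m) (λ i' → differ i i' * pairSum t i i'))
    degrees≡ t = trans (∑-cart _,_ (allFin m) (allFin q) _) (∑-cong (allFin m) (λ i →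
      trans (∑-cong (allFin q) (λ a → ∑-cart _,_ (allFin m) (allFin q) (λ p' → ⟦ adj t (i , a) p' ⟧)))
      (trans (∑-swap (allFin q) (allFin m) (λ a i' → ∑ (allFin q) (λ a' → ⟦ adj t (i , a) (i' , a') ⟧)))
      (∑-cong (allFin m) (λ i' → trans
        (∑-cong (allFin q) (λ a → trans (∑-cong (allFin q) (λ a' → ⟦∧⟧ (not ⌊ i ≟ᶠ i' ⌋) (joined t (i , a) (i' , a'))))
          (∑-* (allFin q) (differ i i') (λ a' → ⟦ joined t (i , a) (i' , a') ⟧))))
        (∑-* (allFin q) (differ i i') (λ a → ∑ (allFin q) (λ a' → ⟦ joined t (i , a) (i' , a') ⟧))))))))

    τ : ℕ
    τ = length (tuples (suc m))

    -- Redrawing the cells i and i' turns the sum over tuples into the density of the link of the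
    -- vertex from cell zero, which does not change.
    pair-density : ∀ i i' → i ≢ i' → (7 * g + 12) * (q * q) * τ ≤ 16 * g * ∑ (tuples (suc m)) (λ t → pairSum t i i')
    pair-density i i' i≢i' = *-cancelʳ-≤ _ _ (M * M) {{m*n≢0 M M {{>-nonZero 0<M}} {{>-nonZero 0<M}}}} (begin
      (7 * g + 12) * (q * q) * τ * (M * M)           ≡⟨ lem₁ ((7 * g + 12) * (q * q)) τ (M * M) ⟩
      τ * ((7 * g + 12) * (q * q) * (M * M))         ≤⟨ ∑-≥const (tuples (suc m)) (λ t → link-density (at (Vec.lookup t zero) zero)) ⟩
      ∑ (tuples (suc m)) (λ t → 16 * g * ∑ (allFin M) (λ j → ∑ (allFin M) (λ j' → F t j j')))
        ≡⟨ ∑-* (tuples (suc m)) (16 * g) _ ⟩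
      16 * g * ∑ (tuples (suc m)) (λ t → ∑ (allFin M) (λ j → ∑ (allFin M) (λ j' → F t j j')))
        ≡⟨ cong (16 * g *_) (∑-cong (tuples (suc m)) (λ t → ∑-cong (allFin M) (λ j → ∑-cong (allFin M) (λ j' → sym (eqn t j j'))))) ⟩
      16 * g * ∑ (tuples (suc m)) (λ t → ∑ (allFin M) (λ j → ∑ (allFin M) (λ j' → pairSum (t [ suc i ]≔ j [ suc i' ]≔ j') i i')))
        ≡⟨ cong (16 * g *_) (sym (trans (cong (M *_) (upd (suc i') (λ t → pairSum t i i'))) (upd (suc i) (λ t → ∑ (allFin M) (λ j' → pairSum (t [ suc i' ]≔ j') i i'))))) ⟩
      16 * g * (M * (M * ∑ (tuples (suc m)) (λ t → pairSum t i i')))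
        ≡⟨ lem₂ (16 * g) M _ ⟩
      16 * g * ∑ (tuples (suc m)) (λ t → pairSum t i i') * (M * M) ∎)
      where
      open ≤-Reasoning
      F : Vec (Fin M) (suc m) → Fin M → Fin M → ℕ
      F t j j' = ∑ (allFin q) (λ a → ∑ (allFin q) (λ a' → ⟦ E (at (Vec.lookup t zero) zero) (at j (suc a)) (at j' (suc a')) ⟧))
      lem₁ : ∀ x y z → x * y * z ≡ y * (x * z)
      lem₁ = solve-∀
      lem₂ : ∀ x y z → x * (y * (y * z)) ≡ x * z * (y * y)
      lem₂ = solve-∀
      upd : ∀ k (f : Vec (Fin M) (suc m) → ℕ) → M * ∑ (tuples (suc m)) f ≡ ∑ (tuples (suc m)) (λ t → ∑ (allFin M) (λ b → f (t [ k ]≔ b)))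
      upd k f = trans (cong (_* ∑ (tuples (suc m)) f) (sym ∣M∣)) (∑-update {xs = allFin M} k f)
      eqn : ∀ t j j' → pairSum (t [ suc i ]≔ j [ suc i' ]≔ j') i i' ≡ F t j j'
      eqn (x ∷ t) j j' = ∑-cong (allFin q) (λ a → ∑-cong (allFin q) (λ a' → cong₂ (λ u v → ⟦ E (at x zero) (at u (suc a)) (at v (suc a')) ⟧)
        (trans (lookup∘update′ i≢i' (t [ i ]≔ j) j') (lookup∘update i t j)) (lookup∘update i' (t [ i ]≔ j) j')))

    differ-sum : ∀ i → (7 * g + 8) * m ≤ (7 * g + 12) * ∑ (allFin m) (differ i)
    differ-sum i = +-cancelʳ-≤ (7 * g + 12) _ _ (begin
      (7 * g + 8) * m + (7 * g + 12)   ≤⟨ +-monoʳ-≤ ((7 * g + 8) * m) hm ⟩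
      (7 * g + 8) * m + 4 * m          ≡⟨ lem₁ (7 * g) m ⟩
      (7 * g + 12) * m                 ≤⟨ *-monoʳ-≤ (7 * g + 12) m≤ ⟩
      (7 * g + 12) * (y + 1)           ≡⟨ lem₂ (7 * g + 12) y ⟩
      (7 * g + 12) * y + (7 * g + 12)  ∎)
      where
      open ≤-Reasoning
      y = ∑ (allFin m) (differ i)
      lem₁ : ∀ x m → (x + 8) * m + 4 * m ≡ (x + 12) * m
      lem₁ = solve-∀
      lem₂ : ∀ x y → x * (y + 1) ≡ x * y + x
      lem₂ = solve-∀
      m≤ : m ≤ y + 1
      m≤ = begin
        m                                                                ≡⟨ sym (length-allFin m) ⟩
        length (allFin m)                                                ≡⟨ length≡∑ (allFin m) ⟩
        ∑ (allFin m) (λ _ → 1)                                           ≤⟨ ∑-mono (allFin m) (λ i' → one ⌊ i ≟ᶠ i' ⌋) ⟩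
        ∑ (allFin m) (λ i' → differ i i' + ⟦ ⌊ i ≟ᶠ i' ⌋ ⟧)              ≡⟨ ∑-+ (allFin m) _ _ ⟩
        y + ∑ (allFin m) (λ i' → ⟦ ⌊ i ≟ᶠ i' ⌋ ⟧)                        ≡⟨ cong (y +_) (∑-cong (allFin m) (λ i' → cong ⟦_⟧ (≟-sym i i'))) ⟩
        y + ∑ (allFin m) (λ i' → ⟦ ⌊ i' ≟ᶠ i ⌋ ⟧)                        ≤⟨ +-monoʳ-≤ y (∑-unique≤1 id id i (allFin m) (allFin⁺ m)) ⟩
        y + 1 ∎
        where
        one : ∀ b → 1 ≤ ⟦ not b ⟧ + ⟦ b ⟧
        one true  = s≤s z≤n
        one false = s≤s z≤n

    -- The excess over 7/16 is spent in units of 1/(16g): 16 in the hypergraph, 12 inside the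
    -- blocks, 8 after discarding pairs within one tile, 4 after averaging; Erdős-Gallai consumes
    -- the last 4.
    total-density : (7 * g + 8) * (m * q * (m * q)) * τ ≤ 16 * g * ∑ (tuples (suc m)) degrees
    total-density = begin
      (7 * g + 8) * (m * q * (m * q)) * τ                        ≡⟨ lem₁ (7 * g + 8) m q τ ⟩
      m * ((7 * g + 8) * m * (q * q * τ))                        ≡⟨ cong (_* ((7 * g + 8) * m * (q * q * τ))) (sym (length-allFin m)) ⟩
      length (allFin m) * ((7 * g + 8) * m * (q * q * τ))        ≤⟨ ∑-≥const (allFin m) (λ i → *-monoˡ-≤ (q * q * τ) (differ-sum i)) ⟩
      ∑ (allFin m) (λ i → (7 * g + 12) * ∑ (allFin m) (differ i) * (q * q * τ))
        ≡⟨ ∑-cong (allFin m) (λ i → trans (lem₂ (7 * g + 12) (∑ (allFin m) (differ i)) (q * q) τ) (sym (∑-*ʳ (allFin m) ((7 * g + 12) * (q * q) * τ) (differ i)))) ⟩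
      ∑ (allFin m) (λ i → ∑ (allFin m) (λ i' → differ i i' * ((7 * g + 12) * (q * q) * τ)))
        ≤⟨ ∑-mono (allFin m) (λ i → ∑-mono (allFin m) (λ i' → each i i')) ⟩
      ∑ (allFin m) (λ i → ∑ (allFin m) (λ i' → 16 * g * ∑ (tuples (suc m)) (λ t → differ i i' * pairSum t i i')))
        ≡⟨ trans (∑-cong (allFin m) (λ i → ∑-* (allFin m) (16 * g) _)) (∑-* (allFin m) (16 * g) _) ⟩
      16 * g * ∑ (allFin m) (λ i → ∑ (allFin m) (λ i' → ∑ (tuples (suc m)) (λ t → differ i i' * pairSum t i i')))
        ≡⟨ cong (16 * g *_) (trans (∑-cong (allFin m) (λ i → ∑-swap (allFin m) (tuples (suc m)) (λ i' t → differ i i' * pairSum t i i')))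
             (∑-swap (allFin m) (tuples (suc m)) (λ i t → ∑ (allFin m) (λ i' → differ i i' * pairSum t i i')))) ⟩
      16 * g * ∑ (tuples (suc m)) (λ t → ∑ (allFin m) (λ i → ∑ (allFin m) (λ i' → differ i i' * pairSum t i i')))
        ≡⟨ cong (16 * g *_) (∑-cong (tuples (suc m)) (λ t → sym (degrees≡ t))) ⟩
      16 * g * ∑ (tuples (suc m)) degrees ∎
      where
      open ≤-Reasoning
      lem₁ : ∀ x m q t → x * (m * q * (m * q)) * t ≡ m * (x * m * (q * q * t))
      lem₁ = solve-∀
      lem₂ : ∀ x y z t → x * y * (z * t) ≡ y * (x * z * t)
      lem₂ = solve-∀
      lem₃ : ∀ d c s → d * (c * s) ≡ c * (d * s)
      lem₃ = solve-∀
      each : ∀ i i' → differ i i' * ((7 * g + 12) * (q * q) * τ) ≤ 16 * g * ∑ (tuples (suc m)) (λ t → differ i i' * pairSum t i i')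
      each i i' = subst (differ i i' * ((7 * g + 12) * (q * q) * τ) ≤_)
        (trans (lem₃ (differ i i') (16 * g) (∑ (tuples (suc m)) (λ t → pairSum t i i'))) (cong (16 * g *_) (sym (∑-* (tuples (suc m)) (differ i i') (λ t → pairSum t i i'))))) (go (i ≟ᶠ i') refl)
        where
        go : (d : Dec (i ≡ i')) → d ≡ (i ≟ᶠ i') → differ i i' * ((7 * g + 12) * (q * q) * τ) ≤ differ i i' * (16 * g * ∑ (tuples (suc m)) (λ t → pairSum t i i'))
        go (yes p) e rewrite sym e = z≤n
        go (no ¬p) _ = *-monoʳ-≤ (differ i i') (pair-density i i' ¬p)

    Good : Vec (Fin M) (suc m) → Set
    Good t = (7 * g + 4) * (m * q * (m * q)) ≤ 16 * g * degrees t

    -- Reverse Markov inequality for values bounded by k: a mean of (a + c)k/b leaves a proportion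
    -- c/b of values that are at least ak/b.
    markov : ∀ {A : Set} (xs : List A) (f : A → ℕ) (a c k b : ℕ) → (∀ x → f x ≤ k) → 0 < k → (a + c) * k * length xs ≤ b * ∑ xs f →
             c * length xs ≤ b * ∑ xs (λ x → ⟦ ⌊ a * k ≤? b * f x ⌋ ⟧)
    markov xs f a c k b f≤ 0<k h = *-cancelˡ-≤ k {{>-nonZero 0<k}} (+-cancelˡ-≤ (a * k * length xs) _ _ (begin
      a * k * length xs + k * (c * length xs)    ≡⟨ lem₁ a k c (length xs) ⟩
      (a + c) * k * length xs                    ≤⟨ h ⟩
      b * ∑ xs f                                 ≡⟨ sym (∑-* xs b f) ⟩
      ∑ xs (λ x → b * f x)                       ≤⟨ ∑-mono xs one ⟩
      ∑ xs (λ x → a * k + b * k * ⟦ ⌊ a * k ≤? b * f x ⌋ ⟧) ≡⟨ trans (∑-+ xs _ _) (cong₂ _+_ (trans (∑-const xs (a * k)) (*-comm (length xs) (a * k))) (∑-* xs (b * k) _)) ⟩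
      a * k * length xs + b * k * ∑ xs (λ x → ⟦ ⌊ a * k ≤? b * f x ⌋ ⟧) ≡⟨ cong (a * k * length xs +_) (lem₂ b k _) ⟩
      a * k * length xs + k * (b * ∑ xs (λ x → ⟦ ⌊ a * k ≤? b * f x ⌋ ⟧)) ∎))
      where
      open ≤-Reasoning
      lem₁ : ∀ a k c l → a * k * l + k * (c * l) ≡ (a + c) * k * l
      lem₁ = solve-∀
      lem₂ : ∀ b k s → b * k * s ≡ k * (b * s)
      lem₂ = solve-∀
      one : ∀ x → b * f x ≤ a * k + b * k * ⟦ ⌊ a * k ≤? b * f x ⌋ ⟧
      one x with a * k ≤? b * f x
      ... | yes _ = ≤-trans (*-monoʳ-≤ b (f≤ x)) (≤-trans (≤-reflexive (sym (*-identityʳ (b * k)))) (m≤n+m (b * k * 1) (a * k)))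
      ... | no ¬p = ≤-trans (<⇒≤ (≰⇒> ¬p)) (m≤m+n (a * k) _)

    degrees≤ : ∀ t → degrees t ≤ m * q * (m * q)
    degrees≤ t = ≤-trans (∑-≤const Ps (λ p → ≤-trans (∑-≤const Ps (λ p' → ⟦⟧≤1 (adj t p p'))) (≤-reflexive (*-identityʳ (length Ps)))))
      (≤-reflexive (cong₂ _*_ ∣Ps∣ ∣Ps∣))

    dense-good : Dense (tuples (suc m)) (4 * g) Good
    dense-good = dense (λ t → ⌊ (7 * g + 4) * (m * q * (m * q)) ≤? 16 * g * degrees t ⌋) (λ t → toWitness)
      (*-cancelˡ-≤ 4 (≤-trans (markov (tuples (suc m)) degrees (7 * g + 4) 4 (m * q * (m * q)) (16 * g) degrees≤ pos
        (subst (λ z → z * (m * q * (m * q)) * τ ≤ 16 * g * ∑ (tuples (suc m)) degrees) (lem₁ (7 * g)) total-density)) (≤-reflexive (lem₂ g _))))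
      where
      pos : 0 < m * q * (m * q)
      pos = *-mono-< 0<mq 0<mq
      lem₁ : ∀ x → x + 8 ≡ x + 4 + 4
      lem₁ = solve-∀
      lem₂ : ∀ g s → 16 * g * s ≡ 4 * (4 * g * s)
      lem₂ = solve-∀

    κ : ℕ
    κ = suc (m * s)

    matchings : List (Vec (Pos × Pos) κ)
    matchings = vecs (cartesianProduct Ps Ps) κ

    ∈-Ps : ∀ p → p ∈ Ps
    ∈-Ps (i , a) = ∈-cartesianProductWith⁺ _,_ (∈-allFin i) (∈-allFin a)

    record Matches (μ : Vec (Pos × Pos) κ) (t : Vec (Fin M) (suc m)) : Set where
      constructor matches
      field isMatching : IsMatchingAt t (Vec.toList μ)
    open Matches public

    good⇒matching : ∀ t → Good t → ∃ λ μ → μ ∈ matchings × Matches μ t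
    good⇒matching t h = go (Matching.large-matching (adj t) (adj-sym t) (adj-irr t) Ps (m * s)
        (subst (λ k → 5 * (m * s) ≤ 2 * k) (sym ∣Ps∣) 5t≤2k) (subst (m * s ≤_) (sym ∣Ps∣) t≤k)
        (subst (λ k → 2 * (m * s * k) + 8 * (m * s) < degrees t + m * s * (m * s)) (sym ∣Ps∣) (eg (degrees t) h)))
      where
      go : (∃ λ ms → length ms ≡ suc (m * s) × IsMatchingAt t ms) → ∃ λ μ → μ ∈ matchings × Matches μ t
      go (ms , l , I) = proj₁ v , ∈-vecs (λ { (p , p') → ∈-cartesianProductWith⁺ _,_ (∈-Ps p) (∈-Ps p') }) (proj₁ v) , matches (subst (IsMatchingAt t) (sym (proj₂ v)) I)
        where v = toVec κ ms l

    ∣matchings∣ : 4 * g * length matchings ≡ D₀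
    ∣matchings∣ = trans (cong (4 * g *_) (trans (length-vecs {xs = cartesianProduct Ps Ps} κ)
      (cong (_^ κ) (trans (length-cart _,_ Ps Ps) (cong₂ _*_ ∣Ps∣ ∣Ps∣))))) (sym D₀≡)

    record Popular : Set where
      constructor popular
      field
        common : Vec (Pos × Pos) κ
        often  : Dense (tuples (suc m)) D₀ (Matches common)

    dense-matching : Popular
    dense-matching = popular (proj₁ found) (dense-weaken (≤-reflexive ∣matchings∣) (proj₂ (proj₂ found)))
      where
      found : ∃ λ μ → μ ∈ matchings × Dense (tuples (suc m)) (4 * g * length matchings) (Matches μ)
      found = dense-pigeonhole matchings (0<tuples (suc m)) (dense-mono good⇒matching dense-good)

    module Weave
      (q≡ : suc q ≡ 4 * s) (block-inj : ∀ j a a' → at j (suc a) ≡ at j (suc a') → a ≡ a')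
      (K D : ℕ) (0<K : 0 < K) (D≡ : D ≡ blowupD (suc m) (suc (m * s) * (2 * s)) D₀)
      (sparse : ∀ w κ p p' → K * ∑ (allFin M) (λ a → ∑ (allFin M) (λ b → Links.colourCount H w κ (at a p) (at b p'))) ≤ M * M)
      (hK : 4 * D * (suc (m * s) * (4 * s)) ≤ K)
      (hM : 4 * D * (suc m * (suc (m * s) * (2 * s)) * (suc q * (0 + suc m * (suc (m * s) * (2 * s)) * suc q))) ≤ M) where

      at∈contents : ∀ {N} (t : Vec (Fin M) N) i p → at (Vec.lookup t i) p ∈ contents t
      at∈contents (j ∷ t) zero    p = ∈-++⁺ˡ (∈-map⁺ (at j) (∈-allFin p))
      at∈contents (j ∷ t) (suc i) p = ∈-++⁺ʳ (content j) (at∈contents t i p)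

      fresh-inj : ∀ {N} (t : Vec (Fin M) N) → Fresh [] t → ∀ i i' p p' → at (Vec.lookup t i) p ≡ at (Vec.lookup t i') p' → i ≡ i'
      fresh-inj (j ∷ t) (f , fr) zero    zero     p p' e = refl
      fresh-inj (j ∷ t) (f , fr) zero    (suc i') p p' e = ⊥-elim (f (lose (∈-allFin p) (subst (_∈ contents t) (sym e) (at∈contents t i' p'))))
      fresh-inj (j ∷ t) (f , fr) (suc i) zero     p p' e = ⊥-elim (f (lose (∈-allFin p') (subst (_∈ contents t) e (at∈contents t i p))))
      fresh-inj (j ∷ t) (f , fr) (suc i) (suc i') p p' e = cong suc (fresh-inj t fr i i' p p' e)

      2s : ℕ
      2s = 2 * s

      0<2s : 0 < 2s
      0<2s = ≤-trans 0<s (m≤m+n s _)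

      cp : ℕ → Fin 2s
      cp k = fromℕ< (m%n<n k 2s {{>-nonZero 0<2s}})

      cp-inj : ∀ {k l} → k < 2s → l < 2s → cp k ≡ cp l → k ≡ l
      cp-inj {k} {l} h h' e = trans (sym (m<n⇒m%n≡m {{>-nonZero 0<2s}} h)) (trans (trans (sym (toℕ-fromℕ< _)) (trans (cong toℕ e) (toℕ-fromℕ< _))) (m<n⇒m%n≡m {{>-nonZero 0<2s}} h'))

      N : ℕ
      N = suc m * (κ * 2s)

      abstract
        -- Copy (c, k) of coordinate b in the blown-up tuple; coordinate zero is the one that gives
        -- uncovered vertices.
        ix : Fin (suc m) → Fin κ → ℕ → Fin N
        ix b c k = combine b (combine c (cp k))

        ix≡ : ∀ b c k → ix b c k ≡ combine b (combine c (cp k))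
        ix≡ b c k = refl

        ix-inj : ∀ b c k b' c' k' → ix b c k ≡ ix b' c' k' → b ≡ b' × c ≡ c' × cp k ≡ cp k'
        ix-inj b c k b' c' k' e with combine-injective b (combine c (cp k)) b' (combine c' (cp k')) e
        ... | p , r = p , combine-injective c (cp k) c' (cp k') r

      c₀ : ℕ
      -- 2s - 1 edges, hence 4s - 1 = q vertices: s on either side and 2s - 1 uncovered.
      c₀ = 2s ∸ 2

      c₀≡ : 2 + c₀ ≡ 2s
      c₀≡ = m+[n∸m]≡n (*-monoʳ-≤ 2 0<s)

      module _ (μ : Vec (Pos × Pos) κ) (separate : ∀ c → proj₁ (side μ false c) ≢ proj₁ (side μ true c))
        (distinct : Unique (flat (Vec.toList μ))) where

        -- All matching edges read their ends from the same copies, those with `zero` in the middle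
        -- slot: edges at different positions of one tile share its s copies, which keeps the number
        -- of broken blocks at ms.
        J : Bool → Fin κ → ℕ → Tm 0 N (suc q)
        J b c k = var (ix (suc (proj₁ (side μ b c))) zero k) (suc (proj₂ (side μ b c)))

        -- A cell carries only one uncovered vertex, so each matching edge c needs its own copies
        -- here; this is why the blow-up factor is κ · 2s.
        U : Fin κ → ℕ → Tm 0 N (suc q)
        U c l = var (ix zero c l) zero

        ok : ∀ c → Ok (zigStart (J false c) (J true c) (U c)) (zigTail (J false c) (J true c) (U c) c₀)
        ok c = zigzag-ok (J false c) (J true c) (U c) c₀
            (λ {k} h e → shift≢ k (≤-trans (m≤m+n k (k + 0)) h) (proj₂ (proj₂ (ix-inj _ _ (suc k) _ _ k e))))
            (λ {k} h e → shift≢ k (≤-trans (≤-trans (m≤m+n k (k + 0)) (n≤1+n (2 * k))) h) (proj₂ (proj₂ (ix-inj _ _ (suc k) _ _ k e))))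
            (λ {k} h e → shift≢ k (≤-trans (n≤1+n k) h) (proj₂ (proj₂ (ix-inj _ _ (suc k) _ _ k e))))
            (λ k l e → separate c (suc-inj (proj₁ (ix-inj _ _ k _ _ l e))))
            (λ k l e → separate c (sym (suc-inj (proj₁ (ix-inj _ _ k _ _ l e)))))
            (λ k l e → 0≢suc (proj₁ (ix-inj _ _ k _ _ l e)))
            (λ k l e → 0≢suc (proj₁ (ix-inj _ _ k _ _ l e)))
            (λ k l e → 0≢suc (sym (proj₁ (ix-inj _ _ k _ _ l e))))
            (λ k l e → 0≢suc (sym (proj₁ (ix-inj _ _ k _ _ l e))))
          where
          suc-inj : ∀ {k} {i j : Fin k} → Fin.suc i ≡ Fin.suc j → i ≡ j
          suc-inj refl = refl
          0≢suc : ∀ {k} {i : Fin k} → Fin.zero ≢ Fin.suc i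
          0≢suc ()
          shift≢ : ∀ k → k ≤ c₀ → cp (suc k) ≢ cp k
          shift≢ k h e = 1+n≢n (cp-inj (subst (suc (suc k) ≤_) c₀≡ (s≤s (s≤s h))) (subst (suc k ≤_) c₀≡ (s≤s (m≤n⇒m≤1+n h))) e)

        open Patterns {0} {N} K sparse []

        pattern′ : Fin κ → Pattern
        pattern′ c = zigStart (J false c) (J true c) (U c) , zigTail (J false c) (J true c) (U c) c₀ , zigEnd (J false c) (J true c) (U c) c₀

        edges : ∀ t → (∀ φ → Matches μ (selection t φ)) → ∀ c → LinkedT t (pattern′ c)
        edges t h c = xy 0 0 0 , subst₂ (Linked (evalP t (zigStart (J false c) (J true c) (U c))))
            (sym (map-zigTail (eval t) (J false c) (J true c) (U c) c₀)) (sym (map-zigEnd (eval t) (J false c) (J true c) (U c) c₀))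
            (zigzag-Linked H (eval t ∘ J false c) (eval t ∘ J true c) (eval t ∘ U c) c₀ yx xy)
          where
          i i' : Fin m
          i  = proj₁ (side μ false c)
          i' = proj₁ (side μ true c)
          a a' : Fin q
          a  = proj₂ (side μ false c)
          a' = proj₂ (side μ true c)
          base : ∀ k l u → T (E (eval t (U c u)) (eval t (J false c k)) (eval t (J true c l)))
          base k l u = subst T (trans (cong (λ z → E (at (Vec.lookup t z) zero) (at (Vec.lookup (selection t φ) (suc i)) (suc a)) (at (Vec.lookup (selection t φ) (suc i')) (suc a'))) (sym (ix≡ zero c u))) (cong₂ (λ x y → E (eval t (U c u)) (at x (suc a)) (at y (suc a'))) atI atI′))
              (proj₂ (Equivalence.to (T-∧ {not ⌊ i ≟ᶠ i' ⌋}) (all-lookup μ (proj₁ (isMatching (h φ))) c)))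
            where
            pickφ : ∀ {j} → Dec (j ≡ i) → Fin (κ * 2s)
            pickφ (yes _) = combine {κ} {2s} zero (cp k)
            pickφ (no _)  = combine {κ} {2s} zero (cp l)
            -- The selection that reads copy k of the tile of one end, copy l of the tile of the
            -- other and copy (c, u) of the uncovered vertex. The two tiles differ by `separate`, so
            -- the choices are compatible.
            φ : Fin (suc m) → Fin (κ * 2s)
            φ zero    = combine c (cp u)
            φ (suc j) = pickφ (j ≟ᶠ i)
            atI : Vec.lookup (selection t φ) (suc i) ≡ Vec.lookup t (ix (suc i) zero k)
            atI = trans (lookup∘tabulate (λ j → Vec.lookup t (combine (suc j) (φ (suc j)))) i) (cong (Vec.lookup t) (trans (cong (combine (suc i)) (is (i ≟ᶠ i))) (sym (ix≡ (suc i) zero k))))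
              where
              is : (d : Dec (i ≡ i)) → pickφ d ≡ combine {κ} {2s} zero (cp k)
              is (yes _) = refl
              is (no ¬p) = contradiction refl ¬p
            atI′ : Vec.lookup (selection t φ) (suc i') ≡ Vec.lookup t (ix (suc i') zero l)
            atI′ = trans (lookup∘tabulate (λ j → Vec.lookup t (combine (suc j) (φ (suc j)))) i') (cong (Vec.lookup t) (trans (cong (combine (suc i')) (is (i' ≟ᶠ i))) (sym (ix≡ (suc i') zero l))))
              where
              is : (d : Dec (i' ≡ i)) → pickφ d ≡ combine {κ} {2s} zero (cp l)
              is (yes p) = contradiction (sym p) (separate c)
              is (no _)  = refl
          xy : ∀ k l u → T (E (eval t (J false c k)) (eval t (U c u)) (eval t (J true c l)))
          xy k l u = subst T (trans (E-rot _ _ _) (E-swap _ _ _)) (base k l u)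
          yx : ∀ k l u → T (E (eval t (J true c l)) (eval t (U c u)) (eval t (J false c k)))
          yx k l u = subst T (trans (E-rot _ _ _) (trans (E-rot _ _ _) (E-swap _ _ _))) (xy k l u)

        module _ (t : Vec (Fin M) N) (fresh : Fresh [] t) where

          Jv : Bool → Fin κ → ℕ → V
          Jv b c k = eval t (J b c k)

          Uv : Fin κ → ℕ → V
          Uv c k = eval t (U c k)

          Jv-inj : ∀ b c k b' c' k' → Jv b c k ≡ Jv b' c' k' → (b ≡ b' × c ≡ c') × cp k ≡ cp k'
          Jv-inj b c k b' c' k' e = side-injective μ distinct b c b' c' (same (side μ b c) (side μ b' c') e′ e) , proj₂ (proj₂ e″)
            where
            e′ : ix (suc (proj₁ (side μ b c))) zero k ≡ ix (suc (proj₁ (side μ b' c'))) zero k'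
            e′ = fresh-inj t fresh _ _ _ _ e
            e″ = ix-inj (suc (proj₁ (side μ b c))) zero k (suc (proj₁ (side μ b' c'))) zero k' e′
            same : ∀ p p' → ix (suc (proj₁ p)) zero k ≡ ix (suc (proj₁ p')) zero k' →
                   at (Vec.lookup t (ix (suc (proj₁ p)) zero k)) (suc (proj₂ p)) ≡ at (Vec.lookup t (ix (suc (proj₁ p')) zero k')) (suc (proj₂ p')) → p ≡ p'
            same (i , a) (i' , a') e₁ e₂ with proj₁ (ix-inj (suc i) zero k (suc i') zero k' e₁)
            ... | refl = cong (i ,_) (block-inj _ a a' (trans e₂ (cong (λ z → at (Vec.lookup t z) (suc a')) (sym e₁))))

          Uv-inj : ∀ c k c' k' → Uv c k ≡ Uv c' k' → c ≡ c' × cp k ≡ cp k'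
          Uv-inj c k c' k' e = proj₂ (ix-inj zero c k zero c' k' (fresh-inj t fresh _ _ _ _ e))

          J≢U : ∀ b c k c' k' → Jv b c k ≢ Uv c' k'
          J≢U b c k c' k' e = absurd (proj₁ (ix-inj (suc (proj₁ (side μ b c))) zero k zero c' k' (fresh-inj t fresh _ _ _ _ e)))
            where
            absurd : ∀ {k} {i : Fin k} → Fin.suc i ≢ Fin.zero
            absurd ()

          tile : Fin κ → List V
          tile c = zigzag (Jv false c) (Jv true c) (Uv c) c₀

          2k<⇒ : ∀ k → 2 * k ≤ suc c₀ → k < s
          2k<⇒ k h = *-cancelˡ-< 2 k s (subst (2 * k <_) c₀≡ (s≤s h))

          k<s⇒ : ∀ {k} → k < s → k < 2s
          k<s⇒ h = ≤-trans h (m≤m+n s _)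

          ∈-tile : ∀ c {v} → v ∈ tile c → (∃ λ b → ∃ λ k → k < s × v ≡ Jv b c k) ⊎ (∃ λ k → k < 2s × v ≡ Uv c k)
          ∈-tile c m with ∈-zigzag (Jv false c) (Jv true c) (Uv c) c₀ m
          ... | inj₁ (k , h , e)        = inj₁ (false , k , 2k<⇒ k h , e)
          ... | inj₂ (inj₁ (k , h , e)) = inj₁ (true , k , 2k<⇒ k (m≤n⇒m≤1+n h) , e)
          ... | inj₂ (inj₂ (k , h , e)) = inj₂ (k , subst (k <_) c₀≡ (s≤s (m≤n⇒m≤1+n h)) , e)

          tile-unique : ∀ c → Unique (tile c)
          tile-unique c = zigzag-unique (Jv false c) (Jv true c) (Uv c) c₀
            (λ {k} {l} h h' e → cp-inj (k<s⇒ (2k<⇒ k h)) (k<s⇒ (2k<⇒ l h')) (proj₂ (Jv-inj false c k false c l e)))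
            (λ {k} {l} h h' e → cp-inj (k<s⇒ (2k<⇒ k (m≤n⇒m≤1+n h))) (k<s⇒ (2k<⇒ l (m≤n⇒m≤1+n h'))) (proj₂ (Jv-inj true c k true c l e)))
            (λ {k} {l} h h' e → cp-inj (subst (k <_) c₀≡ (s≤s (m≤n⇒m≤1+n h))) (subst (l <_) c₀≡ (s≤s (m≤n⇒m≤1+n h'))) (proj₂ (Uv-inj c k c l e)))
            (λ k l e → f≢t (proj₁ (proj₁ (Jv-inj false c k true c l e))))
            (λ k l → J≢U false c k c l) (λ k l → J≢U true c k c l)
            where
            f≢t : false ≢ true
            f≢t ()

          tile-disjoint : ∀ {c c'} → c ≢ c' → Disjoint (tile c) (tile c')
          tile-disjoint {c} {c'} c≢c' (m , m') with ∈-tile c m | ∈-tile c' m'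
          ... | inj₁ (b , k , _ , refl) | inj₁ (b' , k' , _ , e) = c≢c' (proj₂ (proj₁ (Jv-inj b c k b' c' k' e)))
          ... | inj₁ (b , k , _ , refl) | inj₂ (k' , _ , e)      = J≢U b c k c' k' e
          ... | inj₂ (k , _ , refl)     | inj₁ (b' , k' , _ , e) = J≢U b' c' k' c k (sym e)
          ... | inj₂ (k , _ , refl)     | inj₂ (k' , _ , e)      = c≢c' (proj₁ (Uv-inj c k c' k' e))

          tiles : List (List V)
          tiles = tabulate tile

          tiles-unique : Unique (concat tiles)
          tiles-unique = Uniqueₚ.concat⁺ (Allₚ.tabulate⁺ {f = tile} tile-unique) (AllPairsₚ.tabulate⁺ tile-disjoint)

          used : List (Fin M)
          used = cartesianProductWith (λ i k → Vec.lookup t (ix (suc i) zero (toℕ k))) (allFin m) (allFin s)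

          ∣used∣ : length used ≡ m * s
          ∣used∣ = trans (length-cart _ (allFin m) (allFin s)) (cong₂ _*_ (length-allFin m) (length-allFin s))

          ∈-tiles : ∀ {v} → v ∈ concat tiles → (∃ λ j → ∃ λ a → j ∈ used × v ≡ at j (suc a)) ⊎ (∃ λ j → v ≡ at j zero)
          ∈-tiles m with ∈-concat⁻′ tiles m
          ... | L , v∈ , L∈ with ∈-tabulate⁻ {f = tile} L∈
          ...   | c , refl with ∈-tile c v∈
          ...     | inj₁ (b , k , k<s , e) = inj₁ (_ , _ , subst (λ z → Vec.lookup t (ix (suc (proj₁ (side μ b c))) zero z) ∈ used) (toℕ-fromℕ< k<s)
                      (∈-cartesianProductWith⁺ (λ i k → Vec.lookup t (ix (suc i) zero (toℕ k))) (∈-allFin (proj₁ (side μ b c))) (∈-allFin (fromℕ< k<s))) , e)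
          ...     | inj₂ (k , _ , e) = inj₂ (_ , e)

          tile-isTile : (∀ c → LinkT t (pattern′ c)) → ∀ c → IsTile q (tile c)
          tile-isTile h c = record
            { start = zigStart (Jv false c) (Jv true c) (Uv c) ; end = zigEnd (Jv false c) (Jv true c) (Uv c) c₀
            ; tail = zigTail (Jv false c) (Jv true c) (Uv c) c₀ ; split = zigzag-split (Jv false c) (Jv true c) (Uv c) c₀
            ; edge = proj₁ (h c)
            ; link = subst₂ (Link (zigStart (Jv false c) (Jv true c) (Uv c))) (map-zigTail (eval t) (J false c) (J true c) (U c) c₀)
                       (map-zigEnd (eval t) (J false c) (J true c) (U c) c₀) (proj₂ (h c))
            ; size = trans (cong length (zigzag-split (Jv false c) (Jv true c) (Uv c) c₀)) (trans (cong (3 +_) (length-zigTail (Jv false c) (Jv true c) (Uv c) c₀)) (suc-injective (begin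
                4 + 2 * c₀         ≡⟨ lem c₀ ⟩
                2 * (2 + c₀)       ≡⟨ cong (2 *_) c₀≡ ⟩
                2 * 2s             ≡⟨ lem′ s ⟩
                4 * s              ≡⟨ sym q≡ ⟩
                suc q              ∎))) }
            where
            open ≡-Reasoning
            lem : ∀ c → 4 + 2 * c ≡ 2 * (2 + c)
            lem = solve-∀
            lem′ : ∀ s → 2 * (2 * s) ≡ 4 * s
            lem′ = solve-∀

        size-patterns : size (tabulate pattern′) ≤ κ * (4 * s)
        size-patterns = ≤-trans (≤-reflexive (∑-tabulate-const pattern′ (λ P → length (proj₁ (proj₂ P))) (λ c → length-zigTail (J false c) (J true c) (U c) c₀)))
          (*-monoʳ-≤ κ (≤-trans (*-monoʳ-≤ 2 (m∸n≤m 2s 2)) (≤-reflexive (lem s))))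
          where
          lem : ∀ s → 2 * (2 * s) ≡ 4 * s
          lem = solve-∀

        dense-tiles : Dense (tuples N) D (λ t → ∀ φ → Matches μ (selection t φ)) →
                      ∃ λ t → Fresh [] t × (∀ c → LinkT t (pattern′ c))
        dense-tiles d = proj₁ found , proj₁ (proj₂ (proj₂ found)) , Allₚ.tabulate⁻ {f = pattern′} (proj₂ (proj₂ (proj₂ found)))
          where
          found : ∃ λ t → t ∈ tuples N × Fresh [] t × All (LinkT t) (tabulate pattern′)
          found = dense-∃ (0<tuples N) (dense-patterns (tabulate pattern′) [] (Allₚ.tabulate⁺ {f = pattern′} ok) 0<K (≤-trans (*-monoʳ-≤ (4 * D) size-patterns) hK) hM
            (dense-mono (λ t h → Allₚ.tabulate⁺ {f = pattern′} (edges t h)) d))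

      weaveAlong : Popular → NewTiles q M (m * s) at
      weaveAlong (popular μ d) = record
        { newTiles = tiles μ separate distinct t fr ; number = length-tabulate (tile μ separate distinct t fr)
        ; areTiles = Allₚ.tabulate⁺ {f = tile μ separate distinct t fr} (tile-isTile μ separate distinct t fr links) ; unique = tiles-unique μ separate distinct t fr
        ; broken = used μ separate distinct t fr ; ∣broken∣ = ∣used∣ μ separate distinct t fr ; located = ∈-tiles μ separate distinct t fr }
        where
        instance′ : ∃ λ t → t ∈ tuples (suc m) × Matches μ t
        instance′ = dense-∃ (0<tuples (suc m)) d
        -- That the edges of `μ` are disjoint and join different tiles concerns `μ` alone, so one
        -- sample in which `μ` is a matching proves it.
        t₀ = proj₁ instance′
        static : IsMatchingAt t₀ (Vec.toList μ)
        static = isMatching (proj₂ (proj₂ instance′))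
        separate : ∀ c → proj₁ (side μ false c) ≢ proj₁ (side μ true c)
        separate c = adj-separate t₀ (side μ false c) (side μ true c) (all-lookup μ (proj₁ static) c)
        distinct : Unique (flat (Vec.toList μ))
        distinct = Unique-++⁻ˡ (flat (Vec.toList μ)) (Unique-resp-↭ (↭-sym (proj₂ (proj₂ static)))
          (Uniqueₚ.cartesianProduct⁺ (allFin⁺ m) (allFin⁺ q)))
        blown : Dense (tuples N) D (λ t → ∀ φ → Matches μ (selection t φ))
        blown = dense-weaken (≤-reflexive (sym D≡)) (dense-blowup (subst (0 <_) (sym ∣M∣) 0<M) (suc m) (κ * 2s) {P = Matches μ} d)
        res = dense-tiles μ separate distinct blown
        t = proj₁ res
        fr = proj₁ (proj₂ res)
        links = proj₂ (proj₂ res)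

      abstract
        weave : NewTiles q M (m * s) at
        weave = weaveAlong dense-matching

  -- Lists without repetition and their division into blocks.

  ∉-head : {A : Set} {x : A} {xs : List A} → All (x ≢_) xs → x ∉ xs
  ∉-head h m = All.lookup h m refl

  complement : ∀ {n} (L : List (Fin n)) → Unique L → ∃ λ R → L ++ R ↭ allFin n
  complement []      _       = allFin _ , ↭-refl
  complement (x ∷ L) (h ∷ u) with complement L u
  ... | R , p with ∈-++⁻ L (∈-resp-↭ (↭-sym p) (∈-allFin x))
  ...   | inj₁ m = ⊥-elim (∉-head h m)
  ...   | inj₂ m with ∈⇒↭ m
  ...     | R' , r = R' , ↭-trans (↭-sym (shift x L R')) (↭-trans (++⁺ˡ L (↭-sym r)) p)

  ∑-injection : ∀ {m n} (f : Fin m → Fin n) → (∀ {i j} → f i ≡ f j → i ≡ j) → (h : Fin n → ℕ) → ∑ (allFin m) (h ∘ f) ≤ ∑ (allFin n) h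
  ∑-injection {m} {n} f inj h with complement (map f (allFin m)) (Uniqueₚ.map⁺ inj (allFin⁺ m))
  ... | R , p = begin
    ∑ (allFin m) (h ∘ f)                    ≡⟨ sym (∑-map f (allFin m) h) ⟩
    ∑ (map f (allFin m)) h                  ≤⟨ m≤m+n _ (∑ R h) ⟩
    ∑ (map f (allFin m)) h + ∑ R h          ≡⟨ sym (∑-++ (map f (allFin m)) R h) ⟩
    ∑ (map f (allFin m) ++ R) h             ≡⟨ ∑-↭ h p ⟩
    ∑ (allFin n) h ∎
    where open ≤-Reasoning

  module _ {A : Set} where

    Unique-++⁻ʳ : (xs : List A) {ys : List A} → Unique (xs ++ ys) → Unique ys
    Unique-++⁻ʳ []       u       = u
    Unique-++⁻ʳ (x ∷ xs) (_ ∷ u) = Unique-++⁻ʳ xs u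

    Unique-++-disjoint : (xs : List A) {ys : List A} → Unique (xs ++ ys) → ∀ {v} → v ∈ xs → v ∈ ys → ⊥
    Unique-++-disjoint (x ∷ xs) (h ∷ u) (here refl) m' = ∉-head h (∈-++⁺ʳ xs m')
    Unique-++-disjoint (x ∷ xs) (h ∷ u) (there m)   m' = Unique-++-disjoint xs u m m'

    Unique-++⁺ : {xs ys : List A} → Unique xs → Unique ys → (∀ {v} → v ∈ xs → v ∈ ys → ⊥) → Unique (xs ++ ys)
    Unique-++⁺ ux uy d = Uniqueₚ.++⁺ ux uy (λ { (m , m') → d m m' })

    lookup-injective : {xs : List A} → Unique xs → ∀ i j → lookup xs i ≡ lookup xs j → i ≡ j
    lookup-injective {x ∷ xs} (h ∷ u) zero    zero    e = refl
    lookup-injective {x ∷ xs} (h ∷ u) zero    (suc j) e = ⊥-elim (∉-head h (subst (_∈ xs) (sym e) (∈-lookup j)))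
    lookup-injective {x ∷ xs} (h ∷ u) (suc i) zero    e = ⊥-elim (∉-head h (subst (_∈ xs) e (∈-lookup i)))
    lookup-injective {x ∷ xs} (h ∷ u) (suc i) (suc j) e = cong suc (lookup-injective u i j e)

    ∑-lookup : (xs : List A) (f : A → ℕ) → ∑ (allFin (length xs)) (f ∘ lookup xs) ≡ ∑ xs f
    ∑-lookup xs f = trans (sym (∑-map (lookup xs) (allFin (length xs)) f)) (cong (λ L → ∑ L f) (trans (map-tabulate id (lookup xs)) (tabulate-lookup xs)))

    ∑-lookupᵛ : ∀ {k} (t : Vec A k) (f : A → ℕ) → ∑ (allFin k) (f ∘ Vec.lookup t) ≡ ∑ (Vec.toList t) f
    ∑-lookupᵛ {k} t f = trans (sym (∑-map (Vec.lookup t) (allFin k) f)) (cong (λ L → ∑ L f) (lookup-allFin t))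

    ∈-toList : ∀ {k} (t : Vec A k) i → Vec.lookup t i ∈ Vec.toList t
    ∈-toList (x ∷ t) zero    = here refl
    ∈-toList (x ∷ t) (suc i) = there (∈-toList t i)

    lookupᵛ-injective : ∀ {k} (t : Vec A k) → Unique (Vec.toList t) → ∀ i j → Vec.lookup t i ≡ Vec.lookup t j → i ≡ j
    lookupᵛ-injective (x ∷ t) (h ∷ u) zero    zero    e = refl
    lookupᵛ-injective (x ∷ t) (h ∷ u) zero    (suc j) e = ⊥-elim (∉-head h (subst (_∈ Vec.toList t) (sym e) (∈-toList t j)))
    lookupᵛ-injective (x ∷ t) (h ∷ u) (suc i) zero    e = ⊥-elim (∉-head h (subst (_∈ Vec.toList t) e (∈-toList t i)))
    lookupᵛ-injective (x ∷ t) (h ∷ u) (suc i) (suc j) e = cong suc (lookupᵛ-injective t u i j e)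

    module _ {q : ℕ} where

      cells : List (Vec A q) → List A
      cells = concatMap Vec.toList

      cells-++ : ∀ Bs Cs → cells (Bs ++ Cs) ≡ cells Bs ++ cells Cs
      cells-++ []       Cs = refl
      cells-++ (B ∷ Bs) Cs = trans (cong (Vec.toList B ++_) (cells-++ Bs Cs)) (sym (++-assoc (Vec.toList B) (cells Bs) (cells Cs)))

      ∣cells∣ : ∀ Bs → length (cells Bs) ≡ length Bs * q
      ∣cells∣ = length-cells Vec.toList length-toList

      cells-↭ : ∀ {Bs Cs} → Bs ↭ Cs → cells Bs ↭ cells Cs
      cells-↭ _↭_.refl        = ↭-refl
      cells-↭ (prep B p)      = ++⁺ˡ (Vec.toList B) (cells-↭ p)
      cells-↭ (swap B C p)    = ↭-trans (shifts (Vec.toList B) (Vec.toList C)) (++⁺ˡ (Vec.toList C) (++⁺ˡ (Vec.toList B) (cells-↭ p)))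
      cells-↭ (_↭_.trans p r) = ↭-trans (cells-↭ p) (cells-↭ r)

      ∈-cells⁺ : ∀ {Bs B v} → B ∈ Bs → v ∈ Vec.toList B → v ∈ cells Bs
      ∈-cells⁺ {B ∷ Bs} (here refl) m = ∈-++⁺ˡ m
      ∈-cells⁺ {B ∷ Bs} (there i)   m = ∈-++⁺ʳ (Vec.toList B) (∈-cells⁺ i m)

      ∈-cells⁻ : ∀ Bs {v} → v ∈ cells Bs → ∃ λ B → B ∈ Bs × v ∈ Vec.toList B
      ∈-cells⁻ (B ∷ Bs) m with ∈-++⁻ (Vec.toList B) m
      ... | inj₁ i = B , here refl , i
      ... | inj₂ i with ∈-cells⁻ Bs i
      ...   | C , j , k = C , there j , k

      cells-shared : ∀ {Bs} → Unique (cells Bs) → ∀ {B C v} → B ∈ Bs → C ∈ Bs → v ∈ Vec.toList B → v ∈ Vec.toList C → B ≡ C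
      cells-shared {D ∷ Bs} u (here refl) (here refl) m m' = refl
      cells-shared {D ∷ Bs} u (here refl) (there j)   m m' = ⊥-elim (Unique-++-disjoint (Vec.toList D) u m (∈-cells⁺ j m'))
      cells-shared {D ∷ Bs} u (there i)   (here refl) m m' = ⊥-elim (Unique-++-disjoint (Vec.toList D) u m' (∈-cells⁺ i m))
      cells-shared {D ∷ Bs} u (there i)   (there j)   m m' = cells-shared (Unique-++⁻ʳ (Vec.toList D) u) i j m m'

      cells-unique-each : ∀ {Bs} → Unique (cells Bs) → ∀ {B} → B ∈ Bs → Unique (Vec.toList B)
      cells-unique-each {D ∷ Bs} u (here refl) = Unique-++⁻ˡ (Vec.toList D) u
      cells-unique-each {D ∷ Bs} u (there i)   = cells-unique-each (Unique-++⁻ʳ (Vec.toList D) u) i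

    blocks-unique : ∀ {q} (Bs : List (Vec A (suc q))) → Unique (cells Bs) → Unique Bs
    blocks-unique []       _ = []
    blocks-unique ((x ∷ t) ∷ Bs) u = All.tabulate (λ { m refl → Unique-++-disjoint (x ∷ Vec.toList t) u (here refl) (∈-cells⁺ m (here refl)) })
      ∷ blocks-unique Bs (Unique-++⁻ʳ (x ∷ Vec.toList t) u)

    chunk : ∀ q c (L : List A) → c * q ≤ length L → ∃ λ (Cs : List (Vec A q)) → length Cs ≡ c × ∃ λ rest → L ≡ cells Cs ++ rest
    chunk q zero    L h = [] , refl , L , refl
    chunk q (suc c) L h = go (toVec q (take q L) (trans (length-take q L) (m≤n⇒m⊓n≡m (≤-trans (m≤m+n q (c * q)) h))))
        (chunk q c (drop q L) (≤-trans (≤-trans (≤-reflexive (sym (m+n∸m≡n q (c * q)))) (∸-monoˡ-≤ q h)) (≤-reflexive (sym (length-drop q L)))))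
      where
      go : (∃ λ (v : Vec A q) → Vec.toList v ≡ take q L) → (∃ λ (Cs : List (Vec A q)) → length Cs ≡ c × ∃ λ rest → drop q L ≡ cells Cs ++ rest) →
           ∃ λ (Cs : List (Vec A q)) → length Cs ≡ suc c × ∃ λ rest → L ≡ cells Cs ++ rest
      go (v , e) (Cs , refl , rest , e') = v ∷ Cs , refl , rest , (begin
        L                                    ≡⟨ sym (take++drop≡id q L) ⟩
        take q L ++ drop q L                 ≡⟨ cong₂ _++_ (sym e) e' ⟩
        Vec.toList v ++ cells Cs ++ rest     ≡⟨ sym (++-assoc (Vec.toList v) (cells Cs) rest) ⟩
        cells (v ∷ Cs) ++ rest               ∎)
        where open ≡-Reasoning

    -- Each removed entry is charged to a member of `L` equal to it; as `xs` has no repetitions,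
    -- every member is charged at most once.
    purge : ((x y : A) → Dec (x ≡ y)) → ∀ (L xs : List A) → Unique xs →
            ∃ λ ks → ∃ λ rs → xs ↭ ks ++ rs × length rs ≤ length L × (∀ {k} → k ∈ ks → k ∉ L)
    purge _≟_ []      xs u = xs , [] , ↭-reflexive (sym (++-identityʳ xs)) , z≤n , λ _ ()
    purge _≟_ (b ∷ L) xs u with purge _≟_ L xs u
    ... | ks , rs , p , l , d with Any.any? (b ≟_) ks
    ...   | no b∉ = ks , rs , p , m≤n⇒m≤1+n l , λ { m (here refl) → b∉ m ; m (there m') → d m m' }
    ...   | yes b∈ with ∈⇒↭ b∈
    ...     | ks' , r = ks' , b ∷ rs , ↭-trans p (↭-trans (++⁺ʳ rs r) (↭-sym (shift b ks' rs))) , s≤s l ,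
                λ { m (here refl) → ∉-head (AllPairs.head (Unique-resp-↭ r (Unique-++⁻ˡ ks (Unique-resp-↭ p u)))) m
                  ; m (there m') → d (∈-resp-↭ (↭-sym r) (there m)) m' }

  -- Almost perfect tilings

  module Rebuild {n : ℕ} (H : Coloured n) (p : ℕ) (X : List (Fin n)) where

    open Links H
    open Tiles H

    q : ℕ
    q = suc p

    record Tiled (Ts : List (Vec V q)) : Set where
      field
        areTiles : All (λ t → IsTile q (Vec.toList t)) Ts
        unique   : Unique (X ++ cells Ts)

    record Packing : Set where
      field
        Ts    : List (Vec V q)
        tiled : Tiled Ts
        R     : List V
        perm  : X ++ (cells Ts ++ R) ↭ allFin n
        small : q * length R < n

    -- The uncovered vertices are cut into blocks of tile size as well. The blocks then cover nearly
    -- everything, so the density of a link passes to them however few tiles exist, and breaking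
    -- such a block loses no tile.
    module Blocking (Ts Cs : List (Vec V q)) (R rest : List V) (tiled : Tiled Ts) (perm : X ++ (cells Ts ++ R) ↭ allFin n)
      (R≡ : R ≡ cells Cs ++ rest) where

      Blocks : List (Vec V q)
      Blocks = Ts ++ Cs

      M : ℕ
      M = length Blocks

      O : List V
      O = X ++ rest

      perm′ : cells Blocks ++ O ↭ allFin n
      perm′ = ↭-trans (↭-reflexive (cong (_++ O) (cells-++ Ts Cs))) (↭-trans (shifts (cells Ts ++ cells Cs) X) (↭-trans (++⁺ˡ X
        (↭-reflexive (trans (++-assoc (cells Ts) (cells Cs) rest) (cong (cells Ts ++_) (sym R≡))))) perm))

      all-unique : Unique (cells Blocks ++ O)
      all-unique = Unique-resp-↭ (↭-sym perm′) (allFin⁺ n)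

      cells-unique : Unique (cells Blocks)
      cells-unique = Unique-++⁻ˡ (cells Blocks) all-unique

      perm-unique : Unique (X ++ (cells Ts ++ R))
      perm-unique = Unique-resp-↭ (↭-sym perm) (allFin⁺ n)

      R-unique : Unique R
      R-unique = Unique-++⁻ʳ (cells Ts) (Unique-++⁻ʳ X perm-unique)

      n≡ : n ≡ M * q + length O
      n≡ = trans (sym (length-allFin n)) (trans (sym (↭-length perm′)) (trans (length-++ (cells Blocks)) (cong (_+ length O) (∣cells∣ Blocks))))

      module Positions (M≤ : M ≤ length R) where

        at : Fin M → Fin (suc q) → V
        at j zero    = lookup R (inject≤ j M≤)
        at j (suc a) = Vec.lookup (lookup Blocks j) a

        at∈block : ∀ j a → at j (suc a) ∈ Vec.toList (lookup Blocks j)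
        at∈block j a = ∈-toList (lookup Blocks j) a

        at-inj : ∀ a {j j'} → at j a ≡ at j' a → j ≡ j'
        at-inj zero    {j} {j'} e = inject≤-injective M≤ M≤ j j' (lookup-injective R-unique _ _ e)
        at-inj (suc a) {j} {j'} e = lookup-injective (blocks-unique Blocks cells-unique) j j'
          (cells-shared {Bs = Blocks} cells-unique (∈-lookup j) (∈-lookup j') (at∈block j a) (subst (_∈ Vec.toList (lookup Blocks j')) (sym e) (at∈block j' a)))

        block-inj : ∀ j a a' → at j (suc a) ≡ at j (suc a') → a ≡ a'
        block-inj j a a' e = lookupᵛ-injective (lookup Blocks j) (cells-unique-each cells-unique (∈-lookup {xs = Blocks} j)) a a' e

        ∑-blocks : ∀ (f : V → ℕ) → ∑ (allFin M) (λ j → ∑ (allFin q) (λ a → f (at j (suc a)))) ≡ ∑ (cells Blocks) f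
        ∑-blocks f = trans (∑-cong (allFin M) (λ j → ∑-lookupᵛ (lookup Blocks j) f))
          (trans (∑-lookup Blocks (λ b → ∑ (Vec.toList b) f)) (sym (trans (∑-concat (map Vec.toList Blocks) f) (∑-map Vec.toList Blocks (λ L → ∑ L f)))))

        -- Old tiles disappear only if they are among the κ broken blocks, while κ + 1 tiles arrive.
        -- New vertices lie in broken blocks or in `R`, hence outside `X` and outside the tiles that
        -- are kept.
        improve : ∀ {κ} → NewTiles q M κ at → ∃ λ Ts' → Tiled Ts' × length Ts < length Ts'
        improve {κ} W = go (purge (≡-decᵛ _≟ᶠ_) (map (lookup Blocks) W.broken) Ts (blocks-unique Ts (Unique-++⁻ʳ X (Tiled.unique tiled)))) (vectors W.newTiles W.areTiles)
          where
          module W = NewTiles W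
          vectors : ∀ Ls → All (IsTile q) Ls → ∃ λ (Vs : List (Vec V q)) → map Vec.toList Vs ≡ Ls
          vectors []       []       = [] , refl
          vectors (L ∷ Ls) (t ∷ ts) with toVec q L (IsTile.size t) | vectors Ls ts
          ... | v , e | Vs , e' = v ∷ Vs , cong₂ _∷_ e e'
          located : ∀ {v} → v ∈ concat W.newTiles → (∃ λ B → B ∈ map (lookup Blocks) W.broken × B ∈ Blocks × v ∈ Vec.toList B) ⊎ v ∈ R
          located m with W.located m
          ... | inj₁ (j , a , j∈ , refl) = inj₁ (lookup Blocks j , ∈-map⁺ (lookup Blocks) j∈ , ∈-lookup j , at∈block j a)
          ... | inj₂ (j , refl)          = inj₂ (∈-lookup (inject≤ j M≤))
          go : (∃ λ ks → ∃ λ rs → Ts ↭ ks ++ rs × length rs ≤ length (map (lookup Blocks) W.broken) × (∀ {k} → k ∈ ks → k ∉ map (lookup Blocks) W.broken)) →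
               (∃ λ (Vs : List (Vec V q)) → map Vec.toList Vs ≡ W.newTiles) → ∃ λ Ts' → Tiled Ts' × length Ts < length Ts'
          go (ks , rs , pk , lr , dk) (Vs , eV) = ks ++ Vs , record { areTiles = All-++⁺ ksTiles VsTiles ; unique = uniq } , longer
            where
            ksTiles : All (λ t → IsTile q (Vec.toList t)) ks
            ksTiles = Allₚ.++⁻ˡ ks (All-resp-↭ pk (Tiled.areTiles tiled))
            VsTiles : All (λ t → IsTile q (Vec.toList t)) Vs
            VsTiles = Allₚ.map⁻ (subst (All (IsTile q)) (sym eV) W.areTiles)
            cellsV : cells Vs ≡ concat W.newTiles
            cellsV = cong concat eV
            longer : length Ts < length (ks ++ Vs)
            longer = begin
              suc (length Ts)                     ≡⟨ cong suc (trans (↭-length pk) (length-++ ks)) ⟩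
              suc (length ks + length rs)         ≤⟨ s≤s (+-monoʳ-≤ (length ks) (≤-trans lr (≤-reflexive (trans (length-map (lookup Blocks) W.broken) W.∣broken∣)))) ⟩
              suc (length ks + κ)             ≡⟨ sym (+-suc (length ks) (κ)) ⟩
              length ks + suc (κ)             ≡⟨ cong (length ks +_) (sym (trans (sym (length-map Vec.toList Vs)) (trans (cong length eV) W.number))) ⟩
              length ks + length Vs               ≡⟨ sym (length-++ ks) ⟩
              length (ks ++ Vs)                   ∎
              where open ≤-Reasoning
            ks⊆ : ∀ {k} → k ∈ ks → k ∈ Ts
            ks⊆ i = ∈-resp-↭ (↭-sym pk) (∈-++⁺ˡ i)
            cells-ks⊆ : ∀ {v} → v ∈ cells ks → v ∈ cells Ts
            cells-ks⊆ i with ∈-cells⁻ ks i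
            ... | b , b∈ , v∈ = ∈-cells⁺ (ks⊆ b∈) v∈
            ks-unique : Unique (cells ks)
            ks-unique = Unique-++⁻ˡ (cells ks) (subst Unique (cells-++ ks rs) (Unique-resp-↭ (cells-↭ pk) (Unique-++⁻ʳ X (Tiled.unique tiled))))
            ks∩new : ∀ {v} → v ∈ cells ks → v ∈ cells Vs → ⊥
            ks∩new {v} i j with ∈-cells⁻ ks i | located (subst (v ∈_) cellsV j)
            ... | b , b∈ , v∈ | inj₁ (b' , b'∈ , b'∈B , v∈') = dk b∈ (subst (_∈ _) (sym (cells-shared cells-unique (∈-++⁺ˡ (ks⊆ b∈)) b'∈B v∈ v∈')) b'∈)
            ... | b , b∈ , v∈ | inj₂ v∈R = Unique-++-disjoint (cells Ts) (Unique-++⁻ʳ X perm-unique) (cells-ks⊆ i) v∈R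
            X∩new : ∀ {v} → v ∈ X → v ∈ cells Vs → ⊥
            X∩new {v} i j with located (subst (v ∈_) cellsV j)
            ... | inj₁ (b' , _ , b'∈B , v∈') = Unique-++-disjoint (cells Blocks) all-unique (∈-cells⁺ b'∈B v∈') (∈-++⁺ˡ i)
            ... | inj₂ v∈R = Unique-++-disjoint X perm-unique i (∈-++⁺ʳ (cells Ts) v∈R)
            X∩all : ∀ {v} → v ∈ X → v ∈ cells ks ++ cells Vs → ⊥
            X∩all i j with ∈-++⁻ (cells ks) j
            ... | inj₁ k = Unique-++-disjoint X (Tiled.unique tiled) i (cells-ks⊆ k)
            ... | inj₂ k = X∩new i k
            uniq : Unique (X ++ cells (ks ++ Vs))
            uniq = subst (λ z → Unique (X ++ z)) (sym (cells-++ ks Vs)) (Unique-++⁺ (Unique-++⁻ˡ X (Tiled.unique tiled))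
              (Unique-++⁺ ks-unique (subst Unique (sym cellsV) W.unique) ks∩new) X∩all)

  module Tiling {n : ℕ} (H : Coloured n) (g m s p : ℕ) (0<g : 0 < g) (0<s : 0 < s) (0<m : 0 < m)
    (hm : 7 * g + 12 ≤ 4 * m)
    (eg : ∀ e → (7 * g + 4) * (m * suc p * (m * suc p)) ≤ 16 * g * e → 2 * (m * s * (m * suc p)) + 8 * (m * s) < e + m * s * (m * s))
    (5t≤2k : 5 * (m * s) ≤ 2 * (m * suc p)) (t≤k : m * s ≤ m * suc p) (q≡ : suc (suc p) ≡ 4 * s)
    (K D D₀ C B : ℕ) (0<K : 0 < K) (D₀≡ : D₀ ≡ 4 * g * (m * suc p * (m * suc p)) ^ suc (m * s))
    (D≡ : D ≡ blowupD (suc m) (suc (m * s) * (2 * s)) D₀)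
    (hK : 4 * D * (suc (m * s) * (4 * s)) ≤ K)
    (B≡ : B ≡ 4 * D * (suc m * (suc (m * s) * (2 * s)) * (suc (suc p) * (0 + suc m * (suc (m * s) * (2 * s)) * suc (suc p)))))
    (hC : K * (2 * suc p * (2 * suc p)) ≤ C)
    (deg : ∀ v → (7 * g + 16) * (n * n) ≤ 16 * g * ∑ (allFin n) (λ a → ∑ (allFin n) (λ b → ⟦ Coloured.E H v a b ⟧)))
    (sparse : ∀ w κ → C * ∑ (allFin n) (λ a → ∑ (allFin n) (λ b → Links.colourCount H w κ a b)) ≤ n * n)
    (X : List (Fin n)) (hX : 8 * g * (length X + suc p) ≤ n) (hB : 2 * suc p * B ≤ n) (0<n : 0 < n) where

    open Links H
    open Tiles H
    open Rebuild H p X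

    module Step (Ts : List (Vec V q)) (tiled : Tiled Ts) (R : List V) (perm : X ++ (cells Ts ++ R) ↭ allFin n) (large : n ≤ q * length R) where

      c : ℕ
      c = length R / q

      chunked : ∃ λ (Cs : List (Vec V q)) → length Cs ≡ c × ∃ λ rest → R ≡ cells Cs ++ rest
      chunked = chunk q c R (m/n*n≤m (length R) q)

      Cs : List (Vec V q)
      Cs = proj₁ chunked

      rest : List V
      rest = proj₁ (proj₂ (proj₂ chunked))

      R≡ : R ≡ cells Cs ++ rest
      R≡ = proj₂ (proj₂ (proj₂ chunked))

      open Blocking Ts Cs R rest tiled perm R≡

      rest<q : length rest < q
      rest<q = subst (_< q) (+-cancelʳ-≡ (c * q) _ _ (begin
        length R % q + c * q                 ≡⟨ sym (m≡m%n+[m/n]*n (length R) q) ⟩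
        length R                             ≡⟨ cong length R≡ ⟩
        length (cells Cs ++ rest)            ≡⟨ length-++ (cells Cs) ⟩
        length (cells Cs) + length rest      ≡⟨ cong (_+ length rest) (trans (∣cells∣ Cs) (cong (_* q) (proj₁ (proj₂ chunked)))) ⟩
        c * q + length rest                  ≡⟨ +-comm (c * q) (length rest) ⟩
        length rest + c * q                  ∎)) (m%n<n (length R) q)
        where open ≡-Reasoning

      hO : 8 * g * length O ≤ n
      hO = ≤-trans (*-monoʳ-≤ (8 * g) (≤-trans (≤-reflexive (length-++ X)) (+-monoʳ-≤ (length X) (<⇒≤ rest<q)))) hX

      -- There is one uncovered vertex for each block: the blocks contain at most n vertices, and q
      -- |R| is at least n by `large`.
      M≤ : M ≤ length R
      M≤ = *-cancelʳ-≤ M (length R) q (≤-trans (≤-trans (m≤m+n (M * q) (length O)) (≤-reflexive (sym n≡))) (≤-trans large (≤-reflexive (*-comm q (length R)))))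

      open Positions M≤

      n≤ : n ≤ 2 * q * M
      n≤ = +-cancelʳ-≤ n n (2 * q * M) (begin
        n + n                                  ≡⟨ cong₂ _+_ n≡ n≡ ⟩
        (M * q + length O) + (M * q + length O) ≡⟨ lem M q (length O) ⟩
        2 * q * M + 2 * length O               ≤⟨ +-monoʳ-≤ (2 * q * M) (≤-trans (*-monoˡ-≤ (length O) (≤-trans (m≤m+n 2 6) (*-monoʳ-≤ 8 0<g))) hO) ⟩
        2 * q * M + n ∎)
        where
        open ≤-Reasoning
        lem : ∀ m q o → (m * q + o) + (m * q + o) ≡ 2 * q * m + 2 * o
        lem = solve-∀

      B≤M : B ≤ M
      B≤M = *-cancelˡ-≤ (2 * q) (≤-trans hB n≤)

      0<M : 0 < M
      0<M = pos (≤-trans 0<n n≤)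
        where
        pos : ∀ {k} → 0 < 2 * q * k → 0 < k
        pos {zero}  h = contradiction (subst (0 <_) (*-zeroʳ (2 * q)) h) (λ ())
        pos {suc k} h = s≤s z≤n

      -- At most 2|O|n ordered pairs meet the vertices outside the blocks, and `hO` makes this a
      -- 4/(16g) fraction of n²: from 16 down to 12.
      link-density : ∀ u → (7 * g + 12) * (q * q) * (M * M) ≤ 16 * g * ∑ (allFin M) (λ j → ∑ (allFin M) (λ j' →
        ∑ (allFin q) (λ a → ∑ (allFin q) (λ a' → ⟦ E u (at j (suc a)) (at j' (suc a')) ⟧))))
      link-density u = subst ((7 * g + 12) * (q * q) * (M * M) ≤_) (cong (16 * g *_) (sym reorganise))
          (+-cancelʳ-≤ (4 * (n * n)) _ _ (begin
          (7 * g + 12) * (q * q) * (M * M) + 4 * (n * n) ≡⟨ cong (_+ 4 * (n * n)) (lem₁ (7 * g + 12) q M) ⟩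
          (7 * g + 12) * (M * q * (M * q)) + 4 * (n * n) ≤⟨ +-monoˡ-≤ (4 * (n * n)) (*-monoʳ-≤ (7 * g + 12) (*-mono-≤ Mq≤n Mq≤n)) ⟩
          (7 * g + 12) * (n * n) + 4 * (n * n)           ≡⟨ lem₂ (7 * g) (n * n) ⟩
          (7 * g + 16) * (n * n)                         ≤⟨ deg u ⟩
          16 * g * S                                     ≤⟨ *-monoʳ-≤ (16 * g) S≤ ⟩
          16 * g * (FF + (length O * n + length O * n))  ≡⟨ lem₃ g FF (length O) n ⟩
          16 * g * FF + 4 * (8 * g * length O * n)       ≤⟨ +-monoʳ-≤ (16 * g * FF) (*-monoʳ-≤ 4 (*-monoˡ-≤ n hO)) ⟩
          16 * g * FF + 4 * (n * n) ∎))
        where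
        open ≤-Reasoning
        F = cells Blocks
        S = ∑ (allFin n) (λ a → ∑ (allFin n) (λ b → ⟦ E u a b ⟧))
        FF = ∑ F (λ x → ∑ F (λ y → ⟦ E u x y ⟧))
        lem₁ : ∀ x q m → x * (q * q) * (m * m) ≡ x * (m * q * (m * q))
        lem₁ = solve-∀
        lem₂ : ∀ x y → (x + 12) * y + 4 * y ≡ (x + 16) * y
        lem₂ = solve-∀
        lem₃ : ∀ g f o n → 16 * g * (f + (o * n + o * n)) ≡ 16 * g * f + 4 * (8 * g * o * n)
        lem₃ = solve-∀
        Mq≤n : M * q ≤ n
        Mq≤n = ≤-trans (m≤m+n (M * q) (length O)) (≤-reflexive (sym n≡))
        row≤ : ∀ L x → ∑ L (λ y → ⟦ E u x y ⟧) ≤ length L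
        row≤ L x = ≤-trans (∑-≤const L (λ y → ⟦⟧≤1 (E u x y))) (≤-reflexive (*-identityʳ (length L)))
        S≤ : S ≤ FF + (length O * n + length O * n)
        S≤ = begin
          S                                              ≡⟨ sym (∑-↭ (λ x → ∑ (allFin n) (λ b → ⟦ E u x b ⟧)) perm′) ⟩
          ∑ (F ++ O) (λ x → ∑ (allFin n) (λ b → ⟦ E u x b ⟧)) ≡⟨ ∑-++ F O _ ⟩
          ∑ F (λ x → ∑ (allFin n) (λ b → ⟦ E u x b ⟧)) + ∑ O (λ x → ∑ (allFin n) (λ b → ⟦ E u x b ⟧))
            ≤⟨ +-mono-≤ (≤-reflexive (trans (∑-cong F (λ x → trans (sym (∑-↭ (λ b → ⟦ E u x b ⟧) perm′)) (∑-++ F O _))) (∑-+ F _ _)))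
                 (≤-trans (∑-≤const O (λ x → row≤ (allFin n) x)) (≤-reflexive (cong (length O *_) (length-allFin n)))) ⟩
          FF + ∑ F (λ x → ∑ O (λ y → ⟦ E u x y ⟧)) + length O * n
            ≤⟨ +-monoˡ-≤ (length O * n) (+-monoʳ-≤ FF (≤-trans (∑-≤const F (λ x → row≤ O x)) (≤-trans (*-monoˡ-≤ (length O) (≤-trans (≤-reflexive (∣cells∣ Blocks)) Mq≤n)) (≤-reflexive (*-comm n (length O)))))) ⟩
          FF + length O * n + length O * n ≡⟨ +-assoc FF (length O * n) (length O * n) ⟩
          FF + (length O * n + length O * n) ∎
        reorganise : ∑ (allFin M) (λ j → ∑ (allFin M) (λ j' → ∑ (allFin q) (λ a → ∑ (allFin q) (λ a' → ⟦ E u (at j (suc a)) (at j' (suc a')) ⟧)))) ≡ FF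
        reorganise = trans (∑-cong (allFin M) (λ j → trans (∑-swap (allFin M) (allFin q) (λ j' a → ∑ (allFin q) (λ a' → ⟦ E u (at j (suc a)) (at j' (suc a')) ⟧)))
          (∑-cong (allFin q) (λ a → ∑-blocks (λ y → ⟦ E u (at j (suc a)) y ⟧))))) (∑-blocks (λ x → ∑ F (λ y → ⟦ E u x y ⟧)))

      colours : ∀ w κ a a' → K * ∑ (allFin M) (λ j → ∑ (allFin M) (λ j' → colourCount w κ (at j a) (at j' a'))) ≤ M * M
      colours w κ a a' = *-cancelˡ-≤ (2 * q * (2 * q)) (begin
        2 * q * (2 * q) * (K * Σ′)   ≡⟨ lem₁ (2 * q * (2 * q)) K Σ′ ⟩
        K * (2 * q * (2 * q)) * Σ′   ≤⟨ *-mono-≤ hC (≤-trans (∑-mono (allFin M) (λ j → ∑-injection (λ j' → at j' a') (at-inj a') (colourCount w κ (at j a))))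
                                          (∑-injection (λ j → at j a) (at-inj a) (λ x → ∑ (allFin n) (colourCount w κ x)))) ⟩
        C * ∑ (allFin n) (λ x → ∑ (allFin n) (colourCount w κ x)) ≤⟨ sparse w κ ⟩
        n * n                        ≤⟨ *-mono-≤ n≤ n≤ ⟩
        2 * q * M * (2 * q * M)      ≡⟨ lem₂ (2 * q) M ⟩
        2 * q * (2 * q) * (M * M)    ∎)
        where
        open ≤-Reasoning
        Σ′ = ∑ (allFin M) (λ j → ∑ (allFin M) (λ j' → colourCount w κ (at j a) (at j' a')))
        lem₁ : ∀ x k s → x * (k * s) ≡ k * x * s
        lem₁ = solve-∀
        lem₂ : ∀ x m → x * m * (x * m) ≡ x * x * (m * m)
        lem₂ = solve-∀

      next : ∃ λ Ts' → Tiled Ts' × length Ts < length Ts'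
      next = improve (Sample.Weave.weave H g m s q M 0<g 0<s (*-mono-< 0<m (s≤s z≤n)) 0<M at at-inj hm eg 5t≤2k t≤k link-density D₀ D₀≡ q≡ block-inj K D 0<K D≡ colours hK
        (≤-trans (≤-reflexive (sym B≡)) B≤M))

    -- Each unfinished round gains a tile. After n rounds the tiles contain at least n vertices, so
    -- `R` is empty and the bound on `R` holds as well.
    packing : Unique X → Packing
    packing uX = finish (go n)
      where
      Goal : ℕ → Set
      Goal k = Packing ⊎ ∃ λ Ts → Tiled Ts × k ≤ length Ts
      stepFrom : ∀ {k} Ts → Tiled Ts → k ≤ length Ts → (∃ λ R → (X ++ cells Ts) ++ R ↭ allFin n) → Goal (suc k)
      stepFrom {k} Ts tiled h (R , pm) = decide (n ≤? q * length R)
        where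
        pm′ : X ++ (cells Ts ++ R) ↭ allFin n
        pm′ = ↭-trans (↭-reflexive (sym (++-assoc X (cells Ts) R))) pm
        larger : (∃ λ Ts' → Tiled Ts' × length Ts < length Ts') → Goal (suc k)
        larger (Ts' , t' , l) = inj₂ (Ts' , t' , ≤-trans (s≤s h) l)
        decide : Dec (n ≤ q * length R) → Goal (suc k)
        decide (yes big) = larger (Step.next Ts tiled R pm′ big)
        decide (no ¬big) = inj₁ (record { Ts = Ts ; tiled = tiled ; R = R ; perm = pm′ ; small = ≰⇒> ¬big })
      go : ∀ k → Goal k
      go zero    = inj₂ ([] , record { areTiles = [] ; unique = subst Unique (sym (++-identityʳ X)) uX } , z≤n)
      go (suc k) = cont (go k)
        where
        cont : Goal k → Goal (suc k)
        cont (inj₁ P)            = inj₁ P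
        cont (inj₂ (Ts , t , h)) = stepFrom Ts t h (complement (X ++ cells Ts) (Tiled.unique t))
      finish : Goal n → Packing
      finish (inj₁ P) = P
      finish (inj₂ (Ts , t , h)) = last (complement (X ++ cells Ts) (Tiled.unique t))
        where
        last : (∃ λ R → (X ++ cells Ts) ++ R ↭ allFin n) → Packing
        last (R , pm) = record { Ts = Ts ; tiled = t ; R = R ; perm = ↭-trans (↭-reflexive (sym (++-assoc X (cells Ts) R))) pm
                               ; small = subst (λ z → q * z < n) (sym (R0)) (subst (_< n) (sym (*-zeroʳ q)) 0<n) }
          where
          open ≤-Reasoning
          full : n + length R ≤ n
          full = begin
            n + length R                                  ≤⟨ +-monoˡ-≤ (length R) (≤-trans h (≤-trans (m≤m*n (length Ts) q) (≤-reflexive (sym (∣cells∣ Ts))))) ⟩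
            length (cells Ts) + length R                  ≤⟨ m≤n+m _ (length X) ⟩
            length X + (length (cells Ts) + length R)     ≡⟨ sym (+-assoc (length X) _ _) ⟩
            length X + length (cells Ts) + length R       ≡⟨ cong (_+ length R) (sym (length-++ X)) ⟩
            length (X ++ cells Ts) + length R             ≡⟨ sym (length-++ (X ++ cells Ts)) ⟩
            length ((X ++ cells Ts) ++ R)                 ≡⟨ trans (↭-length pm) (length-allFin n) ⟩
            n ∎
          R0 : length R ≡ 0
          R0 = n≤0⇒n≡0 (+-cancelˡ-≤ n (length R) 0 (≤-trans full (≤-reflexive (sym (+-identityʳ n)))))

  -- Connecting and absorbing

  ≤-from-squares : ∀ a b → a * a ≤ b * b → a ≤ b
  ≤-from-squares a b h with a ≤? b
  ... | yes p = p
  ... | no ¬p = contradiction h (<⇒≱ (*-mono-< (≰⇒> ¬p) (≰⇒> ¬p)))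

  -- Kept abstract: `64 * x` would otherwise unfold to a sum with 64 summands.
  abstract
    k64 : ℕ
    k64 = 64

    k64≡ : k64 ≡ 64
    k64≡ = refl

    kF : ℕ
    kF = 2 * (k64 * k64)

    kF≡ : 2 * (k64 * k64) ≡ kF
    kF≡ = refl

  ≤k64 : ∀ {d} {_ : True (d ≤? 64)} → d ≤ k64
  ≤k64 {d} {p} = subst (d ≤_) (sym k64≡) (toWitness p)

  -- In units of n²/64: the link has 28, each of the two kinds of pairs with a light end costs at
  -- most 1, and the remaining 26 exceed 25 = 5².
  shadow-arith : ∀ k → k ≡ 64 → ∀ n a s l → 7 * (n * n) ≤ 16 * s → s ≤ a * a + (l + l) → k * l ≤ n * n → 5 * n ≤ 8 * a
  shadow-arith _ refl n a s l h₁ h₂ h₃ = ≤-from-squares (5 * n) (8 * a) (begin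
    5 * n * (5 * n)            ≡⟨ lem₃ n ⟩
    25 * (n * n)               ≤⟨ *-monoˡ-≤ (n * n) (n≤1+n 25) ⟩
    26 * (n * n)               ≤⟨ +-cancelʳ-≤ (n * n + n * n) (26 * (n * n)) (8 * a * (8 * a)) squares ⟩
    8 * a * (8 * a)            ∎)
    where
    open ≤-Reasoning
    lem₁ : ∀ m → 26 * m + (m + m) ≡ 4 * (7 * m)
    lem₁ = solve-∀
    lem₂ : ∀ a l → 4 * (16 * (a * a + (l + l))) ≡ 8 * a * (8 * a) + (64 * l + 64 * l)
    lem₂ = solve-∀
    lem₃ : ∀ n → 5 * n * (5 * n) ≡ 25 * (n * n)
    lem₃ = solve-∀
    squares : 26 * (n * n) + (n * n + n * n) ≤ 8 * a * (8 * a) + (n * n + n * n)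
    squares = begin
      26 * (n * n) + (n * n + n * n)          ≡⟨ lem₁ (n * n) ⟩
      4 * (7 * (n * n))                       ≤⟨ *-monoʳ-≤ 4 h₁ ⟩
      4 * (16 * s)                            ≤⟨ *-monoʳ-≤ 4 (*-monoʳ-≤ 16 h₂) ⟩
      4 * (16 * (a * a + (l + l)))            ≡⟨ lem₂ a l ⟩
      8 * a * (8 * a) + (64 * l + 64 * l)     ≤⟨ +-monoʳ-≤ (8 * a * (8 * a)) (+-mono-≤ h₃ h₃) ⟩
      8 * a * (8 * a) + (n * n + n * n)       ∎

  -- One factor per sampling step, in the order of the tuple: `k64` for a draw from a shadow or a
  -- link, and `kF` for a draw after an exchange of order.
  connectorD gadgetD absorberD : ℕ
  connectorD = k64 * (k64 * (k64 * (k64 * (k64 * 1))))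
  gadgetD = kF * (kF * (kF * (k64 * (k64 * (k64 * connectorD)))))
  absorberD = k64 * (kF * (kF * (kF * (k64 * (k64 * (k64 * (gadgetD * gadgetD)))))))

  0<k64 : 0 < k64
  0<k64 = ≤k64

  0<kF : 0 < kF
  0<kF = subst (0 <_) kF≡ (*-mono-< {0} {2} {0} (s≤s z≤n) (*-mono-< 0<k64 0<k64))

  0<* : ∀ {a b} → 0 < a → 0 < b → 0 < a * b
  0<* = *-mono-<

  0<connectorD : 0 < connectorD
  0<connectorD = 0<* 0<k64 (0<* 0<k64 (0<* 0<k64 (0<* 0<k64 (0<* 0<k64 (s≤s z≤n)))))

  0<gadgetD : 0 < gadgetD
  0<gadgetD = 0<* 0<kF (0<* 0<kF (0<* 0<kF (0<* 0<k64 (0<* 0<k64 (0<* 0<k64 0<connectorD)))))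

  0<absorberD : 0 < absorberD
  0<absorberD = 0<* 0<k64 (0<* 0<kF (0<* 0<kF (0<* 0<kF (0<* 0<k64 (0<* 0<k64 (0<* 0<k64 (0<* 0<gadgetD 0<gadgetD)))))))

  even-difference : ∀ a b c → a + b ≡ 2 * c → (∃ λ k → a ≡ 2 * k) → ∃ λ k → b ≡ 2 * k
  even-difference .(2 * k) b c e (k , refl) = c ∸ k , (begin
    b                          ≡⟨ sym (m+n∸m≡n (2 * k) b) ⟩
    2 * k + b ∸ 2 * k          ≡⟨ cong (_∸ 2 * k) e ⟩
    2 * c ∸ 2 * k              ≡⟨ sym (*-distribˡ-∸ 2 c k) ⟩
    2 * (c ∸ k)                ∎)
    where open ≡-Reasoning


  module Shadows {n : ℕ} (H : Coloured n) (0<n : 0 < n)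
    (deg : ∀ v → 7 * (n * n) ≤ 16 * ∑ (allFin n) (λ a → ∑ (allFin n) (λ b → ⟦ Coloured.E H v a b ⟧))) where

    open Links H
    open Tiles H

    vs : List V
    vs = allFin n

    ∣vs∣ : length vs ≡ n
    ∣vs∣ = length-allFin n

    0<vs : 0 < length vs
    0<vs = subst (0 <_) (sym ∣vs∣) 0<n

    rot : ∀ {a b c} → T (E a b c) → T (E b c a)
    rot = subst T (E-rot _ _ _)

    flip₂₃ : ∀ {a b c} → T (E a b c) → T (E a c b)
    flip₂₃ = subst T (E-swap _ _ _)

    rot² : ∀ {a b c} → T (E a b c) → T (E c a b)
    rot² e = rot (rot e)

    rev : ∀ {a b c} → T (E a b c) → T (E c b a)
    rev e = flip₂₃ (rot² e)

    flip₁₂ : ∀ {a b c} → T (E a b c) → T (E b a c)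
    flip₁₂ e = flip₂₃ (rot e)

    codeg : V → V → ℕ
    codeg v y = ∑ vs (λ z → ⟦ E v z y ⟧)

    heavy : V → V → Bool
    heavy v y = ⌊ n ≤? k64 * codeg v y ⌋

    Shadow : V → V → Set
    Shadow v y = Dense vs k64 (λ z → T (E v z y))

    heavy⇒Shadow : ∀ v y → T (heavy v y) → Shadow v y
    heavy⇒Shadow v y h = dense (λ z → E v z y) (λ _ → id) (subst (_≤ k64 * codeg v y) (sym ∣vs∣) (toWitness h))

    light : ∀ v y → k64 * codeg v y * ⟦ not (heavy v y) ⟧ ≤ n
    light v y with n ≤? k64 * codeg v y
    ... | yes _ = ≤-trans (≤-reflexive (*-zeroʳ (k64 * codeg v y))) z≤n
    ... | no ¬p = ≤-trans (≤-reflexive (*-identityʳ (k64 * codeg v y))) (<⇒≤ (≰⇒> ¬p))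

    -- Edges of the link of v that leave the shadow are few, so the shadow squared must contain almost 7/16 > 25/64 of all pairs.
    shadow-size : ∀ v → 5 * n ≤ 8 * ∑ vs (λ y → ⟦ heavy v y ⟧)
    shadow-size v = shadow-arith k64 k64≡ n A S L (deg v) (subst (λ z → S ≤ A * A + (L + z)) L'≡L S≤) L≤
      where
      open ≤-Reasoning
      A S L L' : ℕ
      A = ∑ vs (λ y → ⟦ heavy v y ⟧)
      S = ∑ vs (λ a → ∑ vs (λ b → ⟦ E v a b ⟧))
      L = ∑ vs (λ b → codeg v b * ⟦ not (heavy v b) ⟧)
      L' = ∑ vs (λ a → ∑ vs (λ b → ⟦ E v a b ⟧) * ⟦ not (heavy v a) ⟧)
      L'≡L : L' ≡ L
      L'≡L = ∑-cong vs (λ a → cong (_* ⟦ not (heavy v a) ⟧) (∑-cong vs (λ b → cong ⟦_⟧ (E-swap v a b))))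
      L≤ : k64 * L ≤ n * n
      L≤ = begin
        k64 * L                                                     ≡⟨ sym (∑-* vs k64 (λ b → codeg v b * ⟦ not (heavy v b) ⟧)) ⟩
        ∑ vs (λ b → k64 * (codeg v b * ⟦ not (heavy v b) ⟧))        ≤⟨ ∑-≤const vs (λ b → ≤-trans (≤-reflexive (sym (*-assoc k64 (codeg v b) ⟦ not (heavy v b) ⟧))) (light v b)) ⟩
        length vs * n                                              ≡⟨ cong (_* n) ∣vs∣ ⟩
        n * n ∎
      pointwise : ∀ e a b → ⟦ e ⟧ ≤ ⟦ a ⟧ * ⟦ b ⟧ + (⟦ e ⟧ * ⟦ not b ⟧ + ⟦ e ⟧ * ⟦ not a ⟧)
      pointwise false a     b     = z≤n
      pointwise true  true  true  = s≤s z≤n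
      pointwise true  true  false = s≤s z≤n
      pointwise true  false true  = s≤s z≤n
      pointwise true  false false = s≤s z≤n
      S≤ : S ≤ A * A + (L + L')
      S≤ = begin
        S ≤⟨ ∑-mono vs (λ a → ∑-mono vs (λ b → pointwise (E v a b) (heavy v a) (heavy v b))) ⟩
        ∑ vs (λ a → ∑ vs (λ b → ⟦ heavy v a ⟧ * ⟦ heavy v b ⟧ + (⟦ E v a b ⟧ * ⟦ not (heavy v b) ⟧ + ⟦ E v a b ⟧ * ⟦ not (heavy v a) ⟧)))
          ≡⟨ ∑-cong vs (λ a → trans (∑-+ vs _ _) (cong₂ _+_ (∑-* vs ⟦ heavy v a ⟧ (λ b → ⟦ heavy v b ⟧))
               (trans (∑-+ vs _ _) (cong (∑ vs (λ b → ⟦ E v a b ⟧ * ⟦ not (heavy v b) ⟧) +_) (∑-*ʳ vs ⟦ not (heavy v a) ⟧ (λ b → ⟦ E v a b ⟧)))))) ⟩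
        ∑ vs (λ a → ⟦ heavy v a ⟧ * A + (∑ vs (λ b → ⟦ E v a b ⟧ * ⟦ not (heavy v b) ⟧) + ∑ vs (λ b → ⟦ E v a b ⟧) * ⟦ not (heavy v a) ⟧))
          ≡⟨ trans (∑-+ vs _ _) (cong₂ _+_ (∑-*ʳ vs A (λ a → ⟦ heavy v a ⟧)) (trans (∑-+ vs _ _) (cong (_+ L')
               (trans (∑-swap vs vs _) (∑-cong vs (λ b → ∑-*ʳ vs ⟦ not (heavy v b) ⟧ (λ a → ⟦ E v a b ⟧))))))) ⟩
        A * A + (L + L') ∎

    dense-shadow : ∀ v → Dense vs k64 (Shadow v)
    dense-shadow v = dense-weaken {D = 2} ≤k64 $ dense (heavy v) (heavy⇒Shadow v) (subst (_≤ 2 * A) (sym ∣vs∣) (*-cancelˡ-≤ 4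
      (≤-trans (*-monoˡ-≤ n (n≤1+n 4)) (≤-trans (shadow-size v) (≤-reflexive (lem A))))))
      where
      A = ∑ vs (λ y → ⟦ heavy v y ⟧)
      lem : ∀ a → 8 * a ≡ 4 * (2 * a)
      lem = solve-∀

    -- 5/8 + 5/8 - 1 = 1/4.
    dense-shadows : ∀ v w → Dense vs k64 (λ y → Shadow v y × Shadow w y)
    dense-shadows v w = dense-weaken {D = 4} ≤k64 $ dense (λ y → heavy v y ∧ heavy w y)
      (λ y h → let p = Equivalence.to (T-∧ {heavy v y}) h in heavy⇒Shadow v y (proj₁ p) , heavy⇒Shadow w y (proj₂ p))
      (subst (_≤ 4 * I) (sym ∣vs∣) (*-cancelˡ-≤ 2 (+-cancelˡ-≤ (8 * n) (2 * n) (2 * (4 * I)) (begin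
        8 * n + 2 * n           ≡⟨ lem₁ n ⟩
        5 * n + 5 * n           ≤⟨ +-mono-≤ (shadow-size v) (shadow-size w) ⟩
        8 * A + 8 * B           ≡⟨ sym (*-distribˡ-+ 8 A B) ⟩
        8 * (A + B)             ≤⟨ *-monoʳ-≤ 8 sum ⟩
        8 * (n + I)             ≡⟨ lem₂ n I ⟩
        8 * n + 2 * (4 * I)     ∎))))
      where
      open ≤-Reasoning
      A = ∑ vs (λ y → ⟦ heavy v y ⟧)
      B = ∑ vs (λ y → ⟦ heavy w y ⟧)
      I = ∑ vs (λ y → ⟦ heavy v y ∧ heavy w y ⟧)
      lem₁ : ∀ n → 8 * n + 2 * n ≡ 5 * n + 5 * n
      lem₁ = solve-∀
      lem₂ : ∀ n i → 8 * (n + i) ≡ 8 * n + 2 * (4 * i)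
      lem₂ = solve-∀
      incl : ∀ a b → ⟦ a ⟧ + ⟦ b ⟧ ≤ 1 + ⟦ a ∧ b ⟧
      incl true  b = ≤-refl
      incl false b = ⟦⟧≤1 b
      sum : A + B ≤ n + I
      sum = begin
        A + B                                              ≡⟨ sym (∑-+ vs _ _) ⟩
        ∑ vs (λ y → ⟦ heavy v y ⟧ + ⟦ heavy w y ⟧)         ≤⟨ ∑-mono vs (λ y → incl (heavy v y) (heavy w y)) ⟩
        ∑ vs (λ y → 1 + ⟦ heavy v y ∧ heavy w y ⟧)         ≡⟨ trans (∑-+ vs _ _) (cong (_+ I) (trans (sym (length≡∑ vs)) ∣vs∣)) ⟩
        n + I ∎

    Pair : V → Vec V 2 → Set
    Pair v (a ∷ b ∷ []) = T (E v a b)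

    dense-link : ∀ v → Dense (vecs vs 2) k64 (Pair v)
    dense-link v = dense-weaken {D = 3} ≤k64 $ dense t (λ { (a ∷ b ∷ []) → id }) (begin
      length (vecs vs 2)   ≡⟨ trans (length-vecs {xs = vs} 2) (trans (cong (λ m → m * (m * 1)) ∣vs∣) (cong (n *_) (*-identityʳ n))) ⟩
      n * n                ≤⟨ *-cancelˡ-≤ 7 (begin
          7 * (n * n) ≤⟨ deg v ⟩ 16 * S ≤⟨ *-monoˡ-≤ S (m≤m+n 16 5) ⟩ 21 * S ≡⟨ *-assoc 7 3 S ⟩ 7 * (3 * S) ∎) ⟩
      3 * S                ≡⟨ cong (3 *_) (sym (trans (∑-vecs-suc {xs = vs} 1 _) (∑-cong vs (λ a → trans (∑-vecs-suc {xs = vs} 0 _) (∑-cong vs (λ b → +-identityʳ _)))))) ⟩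
      3 * ∑ (vecs vs 2) (λ x → ⟦ t x ⟧) ∎)
      where
      open ≤-Reasoning
      S = ∑ vs (λ a → ∑ vs (λ b → ⟦ E v a b ⟧))
      t : Vec V 2 → Bool
      t (a ∷ b ∷ []) = E v a b

    -- The path is a x y z w v b, but the tuple follows the order of sampling: y in the shadow of a,
    -- w in the common shadow of y and b, and then the middle vertices of the three edges.
    Connector : V → V → Vec V 5 → Set
    Connector a b (y ∷ w ∷ x ∷ z ∷ v ∷ []) = T (E a x y) × T (E y z w) × T (E w v b)

    fubini : {B : Set} (ys : List B) {P : V → B → Set} → Dense vs k64 (λ x → Dense ys k64 (P x)) →
             Dense ys kF (λ y → Dense vs kF (λ x → P x y))
    fubini ys {P} d = subst (λ D → Dense ys D (λ y → Dense vs D (λ x → P x y))) kF≡ (dense-fubini vs ys 0<vs d)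

    dense-connector : ∀ a b → Dense (vecs vs 5) connectorD (Connector a b)
    dense-connector a b =
      dense-∷ (dense-mono (λ y sa → dense-∷ (dense-mono (λ w s →
      dense-∷ (dense-mono (λ x e₁ → dense-∷ (dense-mono (λ z e₂ →
      dense-vec1 (dense-mono (λ v e₃ → e₁ , e₂ , rev e₃) (proj₂ s))) (proj₁ s))) sa)) (dense-shadows y b))) (dense-shadow a))

    Gadget : V → V → Vec V 13 → Set
    Gadget p q (k ∷ s ∷ b ∷ b' ∷ v₁ ∷ u₁ ∷ r ∷ s' ∷ y ∷ w ∷ x ∷ z ∷ v ∷ []) =
      T (E p b v₁) × T (E q b' u₁) × T (E b k s) × T (E b' k s) × T (E s r s') ×
      Connector v₁ u₁ (y ∷ w ∷ x ∷ z ∷ v ∷ [])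

    -- b and b' are two independent samples of the same dense set, which makes their links share a dense set of pairs (k, s).
    dense-gadget : ∀ p q → Dense (vecs vs 13) gadgetD (Gadget p q)
    dense-gadget p q = dense-++ {xs = vs} 2 (dense-mono
      (λ { (k ∷ s ∷ []) d → dense-∷ (dense-mono (λ { b ((spb , _) , eb) →
        dense-∷ (dense-mono (λ { b' ((_ , sqb') , eb') →
        dense-∷ (dense-mono (λ v₁ e₁ →
        dense-∷ (dense-mono (λ u₁ e₂ →
        dense-++ {xs = vs} 2 (dense-mono (λ { (r ∷ s' ∷ []) e₅ →
          dense-mono (λ { (y ∷ w ∷ x ∷ z ∷ v ∷ []) c → flip₂₃ e₁ , flip₂₃ e₂ , eb , eb' , e₅ , c }) (dense-connector v₁ u₁) })
          (dense-link s))) sqb')) spb) }) d) }) d) })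
      (fubini (vecs vs 2) {P = λ b ks → (Shadow p b × Shadow q b) × Pair b ks}
        (dense-mono (λ b s → dense-mono (λ _ e → s , e) (dense-link b)) (dense-shadows p q))))

    Absorber : V → V → Vec V 33 → Set
    Absorber x y (v₄ ∷ h ∷ h' ∷ v₃ ∷ v₅ ∷ v₂ ∷ v₆ ∷ t) =
      T (E v₄ h h') × T (E v₄ h v₃) × T (E v₄ v₅ h') × T (E x v₂ v₄) × T (E y v₆ h') ×
      Gadget v₂ v₃ (Vec.take 13 t) × Gadget v₆ v₅ (Vec.drop 13 t)

    -- The vertices h' and v₃ are two draws from the same set: for fixed v₄ and h, both complete
    -- them to an edge. The exchange of order makes this set dense for many h. The remaining
    -- vertices complete pairs with a known shadow: v₄ with h' and with x, and h' with y.
    dense-absorber : ∀ x y → Dense (vecs vs 33) absorberD (Absorber x y)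
    dense-absorber x y =
      dense-∷ (dense-mono (λ v₄ sx →
      dense-∷ (dense-mono (λ h d →
      dense-∷ (dense-mono (λ { h' ((sy , s₄) , e₁) →
      dense-∷ (dense-mono (λ { v₃ (_ , e₂) →
      dense-∷ (dense-mono (λ v₅ e₃ →
      dense-∷ (dense-mono (λ v₂ e₄ →
      dense-∷ (dense-mono (λ v₆ e₅ →
      dense-++ {xs = vs} 13 (dense-mono (λ { (a₁ ∷ a₂ ∷ a₃ ∷ a₄ ∷ a₅ ∷ a₆ ∷ a₇ ∷ a₈ ∷ a₉ ∷ a₁₀ ∷ a₁₁ ∷ a₁₂ ∷ a₁₃ ∷ []) g₁ →
        dense-mono (λ u g₂ → e₁ , e₂ , e₃ , e₄ , e₅ , g₁ , g₂) (dense-gadget v₆ v₅) })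
        (dense-gadget v₂ v₃))) sy)) sx)) s₄) }) d) }) d))
      (fubini vs {P = λ h' h → (Shadow y h' × Shadow v₄ h') × T (E v₄ h h')}
        (dense-mono (λ h' s → dense-mono (λ _ e → s , e) (proj₂ s)) (dense-shadows y v₄)))))
      (dense-shadow x))

    -- Properly coloured absorbers and connectors, and the assembly of the cycle.

    module Gadgets (K : ℕ) (0<K : 0 < K)
      (sparse : ∀ w κ → K * ∑ (allFin n) (λ a → ∑ (allFin n) (λ b → Links.colourCount H w κ a b)) ≤ n * n) where

      -- Cells are single vertices here.
      open Sampling H n 1 0<n (λ j _ → j) (λ _ → id) using (Fresh; module Patterns)

      startPort endPort : Vec V 33 → Port
      startPort t = triple→ (Vec.lookup t) startIx
      endPort   t = triple→ (Vec.lookup t) endIx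

      before : Vec V 33 → List V
      before t = map (Vec.lookup t) beforeIx

      after : V → V → Vec V 33 → List V
      after x y t = afterWith x y (Vec.lookup t)

      record Absorbs (ρ : Vec V 2) (t : Vec V 33) : Set where
        constructor absorbing
        field
          startEdge  : IsEdge (startPort t)
          beforeLink : Link (startPort t) (before t) (endPort t)
          afterLink  : Link (startPort t) (after (Vec.lookup ρ (# 0)) (Vec.lookup ρ (# 1)) t) (endPort t)
      open Absorbs public

      abstract
        after↭ : ∀ x y t → after x y t ↭ x ∷ y ∷ before t
        after↭ x y t = map⁺ (Vec.lookup (x ∷ y ∷ t)) afterIx↭

        before↭ : ∀ t → corners (startPort t) ++ before t ↭ Vec.toList t
        before↭ t = ↭-trans (map⁺ (Vec.lookup t) beforeIx↭) (↭-reflexive (lookup-allFin t))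

        absorbs : Vec V 2 → Vec V 33 → Bool
        absorbs ρ t = ⌊ T? (E (Vec.lookup t (# 14)) (Vec.lookup t (# 13)) (Vec.lookup t (# 8))) ×-dec Link? (startPort t) (before t) (endPort t)
          ×-dec Link? (startPort t) (after (Vec.lookup ρ (# 0)) (Vec.lookup ρ (# 1)) t) (endPort t) ⌋

        absorbs-sound : ∀ ρ t → T (absorbs ρ t) → Absorbs ρ t
        absorbs-sound ρ t h with toWitness h
        ... | a , b , c = absorbing a b c

        absorbs-complete : ∀ ρ t → Absorbs ρ t → T (absorbs ρ t)
        absorbs-complete ρ t (absorbing a b c) = fromWitness (a , b , c)

      v̂ : Fin 33 → Tm 2 33 1
      v̂ i = var i zero

      module AbsorberPattern (ρ : Vec V 2) where

        open Patterns {2} {33} K (λ w κ _ _ → sparse w κ) ρ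

        patterns : List Pattern
        patterns = (triple→ v̂ startIx , map v̂ beforeIx , triple→ v̂ endIx)
                 ∷ (triple→ v̂ startIx , afterWith (con (# 0)) (con (# 1)) v̂ , triple→ v̂ endIx) ∷ []

        patterns-ok : All (λ P → Ok (proj₁ P) (proj₁ (proj₂ P))) patterns
        -- Separation concerns only the symbols of the pattern and is decided by evaluation.
        patterns-ok = toWitness {a? = Ok? (triple→ v̂ startIx) (map v̂ beforeIx)} tt
                    ∷ toWitness {a? = Ok? (triple→ v̂ startIx) (afterWith (con (# 0)) (con (# 1)) v̂)} tt ∷ []

        edges : ∀ t → Absorber (Vec.lookup ρ (# 0)) (Vec.lookup ρ (# 1)) t → All (LinkedT t) patterns
        edges (v₄ ∷ h ∷ h' ∷ v₃ ∷ v₅ ∷ v₂ ∷ v₆ ∷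
               k ∷ s ∷ b ∷ b' ∷ v₁ ∷ u₁ ∷ r ∷ s' ∷ y ∷ w ∷ x ∷ z ∷ v ∷
               k₂ ∷ s₂ ∷ b₂ ∷ b₂' ∷ v₁₂ ∷ u₁₂ ∷ r₂ ∷ s₂' ∷ y₂ ∷ w₂ ∷ x₂ ∷ z₂ ∷ v₀₂ ∷ [])
          (e₁ , e₂ , e₃ , e₄ , e₅ , (g₁ , g₂ , g₃ , g₄ , g₅ , c₁ , c₂ , c₃) , (G₁ , G₂ , G₃ , G₄ , G₅ , C₁ , C₂ , C₃)) =
          (rev g₅ , rev g₃ , flip₁₂ g₁ , c₁ , c₂ , c₃ , rev g₂ , rev e₂ , flip₂₃ e₃ , G₂ , rev C₃ , rev C₂ , rev C₁ , rot² G₁ , G₃ , G₅ , refl)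
          ∷ (rev g₅ , rev g₄ , flip₁₂ g₂ , rev c₃ , rev c₂ , rev c₁ , rev g₁ , flip₁₂ e₄ , e₁ , rot² e₅ , G₁ , C₁ , C₂ , C₃ , rot² G₂ , G₄ , G₅ , refl)
          ∷ []

      -- The list ends with the whole target port, so a connected tile or absorber adds only what
      -- follows its first edge.
      connection : Vec V 6 → Vec V 5 → List V
      connection (p ∷ q ∷ a ∷ b ∷ q' ∷ p' ∷ []) (y ∷ w ∷ x ∷ z ∷ v ∷ []) = x ∷ y ∷ z ∷ w ∷ v ∷ b ∷ q' ∷ p' ∷ []

      fromPort toPort : Vec V 6 → Port
      fromPort (p ∷ q ∷ a ∷ b ∷ q' ∷ p' ∷ []) = p , q , a
      toPort   (p ∷ q ∷ a ∷ b ∷ q' ∷ p' ∷ []) = b , q' , p'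

      request : Port → Port → Vec V 6
      request (p , q , a) (b , q' , p') = p ∷ q ∷ a ∷ b ∷ q' ∷ p' ∷ []

      connection↭ : ∀ ρ t → connection ρ t ↭ Vec.toList t ++ corners (toPort ρ)
      connection↭ (p ∷ q ∷ a ∷ b ∷ q' ∷ p' ∷ []) (y ∷ w ∷ x ∷ z ∷ v ∷ []) =
        map⁺ (Vec.lookup (y ∷ w ∷ x ∷ z ∷ v ∷ b ∷ q' ∷ p' ∷ []))
          (from-just (permutation _≟ᶠ_ (# 2 ∷ # 0 ∷ # 3 ∷ # 1 ∷ # 4 ∷ # 5 ∷ # 6 ∷ # 7 ∷ []) (allFin 8)))

      Connects : Vec V 6 → Vec V 5 → Set
      Connects ρ t = Link (fromPort ρ) (connection ρ t) (toPort ρ)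

      IsEdge? : ∀ e → Dec (IsEdge e)
      IsEdge? (a , b , c) = T? (E a b c)

      Connects? : ∀ ρ t → Dec (Connects ρ t)
      Connects? ρ t = Link? (fromPort ρ) (connection ρ t) (toPort ρ)

      abstract
        -- Requests whose ends are not edges are never made; they count as served.
        connects : Vec V 6 → Vec V 5 → Bool
        connects ρ t = ⌊ (¬? (IsEdge? (fromPort ρ)) ⊎-dec ¬? (IsEdge? (toPort ρ))) ⊎-dec Connects? ρ t ⌋

        connects-sound : ∀ ρ t → T (connects ρ t) → IsEdge (fromPort ρ) → IsEdge (toPort ρ) → Connects ρ t
        connects-sound ρ t h e f with toWitness {a? = (¬? (IsEdge? (fromPort ρ)) ⊎-dec ¬? (IsEdge? (toPort ρ))) ⊎-dec Connects? ρ t} h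
        ... | inj₁ (inj₁ ¬e) = contradiction e ¬e
        ... | inj₁ (inj₂ ¬f) = contradiction f ¬f
        ... | inj₂ c         = c

        connects-complete : ∀ ρ t → Connects ρ t → T (connects ρ t)
        connects-complete ρ t c = fromWitness {a? = (¬? (IsEdge? (fromPort ρ)) ⊎-dec ¬? (IsEdge? (toPort ρ))) ⊎-dec Connects? ρ t} (inj₂ c)

        connects-void : ∀ ρ t → ¬ (IsEdge (fromPort ρ) × IsEdge (toPort ρ)) → T (connects ρ t)
        connects-void ρ t h = fromWitness {a? = (¬? (IsEdge? (fromPort ρ)) ⊎-dec ¬? (IsEdge? (toPort ρ))) ⊎-dec Connects? ρ t} (inj₁ (go (IsEdge? (fromPort ρ))))
          where
          go : Dec (IsEdge (fromPort ρ)) → ¬ IsEdge (fromPort ρ) ⊎ ¬ IsEdge (toPort ρ)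
          go (yes e) = inj₂ (λ f → h (e , f))
          go (no ¬e) = inj₁ ¬e

      module ConnectorPattern (ρ : Vec V 6) where

        open Patterns {6} {5} K (λ w κ _ _ → sparse w κ) ρ

        ĉ : Fin 5 → Tm 6 5 1
        ĉ i = var i zero

        from to : PortT {6} {5} {1}
        from = con (# 0) , con (# 1) , con (# 2)
        to   = con (# 3) , con (# 4) , con (# 5)

        path : List (Tm 6 5 1)
        path = ĉ (# 2) ∷ ĉ (# 0) ∷ ĉ (# 3) ∷ ĉ (# 1) ∷ ĉ (# 4) ∷ con (# 3) ∷ con (# 4) ∷ con (# 5) ∷ []

        path-ok : Ok from path
        path-ok = toWitness {a? = Ok? from path} tt

        edges : ∀ t → IsEdge (evalP t from) → IsEdge (evalP t to) →
                Connector (Vec.lookup ρ (# 2)) (Vec.lookup ρ (# 3)) t → LinkedT t (from , path , to)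
        edges (y ∷ w ∷ x ∷ z ∷ v ∷ []) e f (c₁ , c₂ , c₃) = e , c₁ , c₂ , c₃ , f , refl

      abstract
        -- 62 = 30 + 32 is the total length of the two continuations, before and after absorption,
        -- each of which must be free of clashes.
        dense-absorbs : ∀ X → 4 * absorberD * (33 * (1 * (length X + 33 * 1))) ≤ n → 4 * absorberD * 62 ≤ K → ∀ ρ →
                        Dense (vecs vs 33) (2 * absorberD) (λ t → Fresh X t × T (absorbs ρ t))
        dense-absorbs X hn hK ρ = dense-mono
          (λ { t (fr , ((h , b) ∷ (_ , a) ∷ [])) → fr , absorbs-complete ρ t (absorbing h b a) })
          (dense-patterns patterns X patterns-ok 0<K hK hn (dense-mono edges (dense-absorber (Vec.lookup ρ (# 0)) (Vec.lookup ρ (# 1)))))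
          where
          open AbsorberPattern ρ
          open Patterns {2} {33} K (λ w κ _ _ → sparse w κ) ρ

        dense-connects : ∀ X → 4 * connectorD * (5 * (1 * (length X + 5 * 1))) ≤ n → 4 * connectorD * 8 ≤ K → ∀ ρ →
                         Dense (vecs vs 5) (2 * connectorD) (λ t → Fresh X t × T (connects ρ t))
        dense-connects X hn hK ρ@(p ∷ q ∷ a ∷ b ∷ q' ∷ p' ∷ []) = go (IsEdge? (fromPort ρ) ×-dec IsEdge? (toPort ρ))
          where
          open ConnectorPattern ρ
          open Patterns {6} {5} K (λ w κ _ _ → sparse w κ) ρ
          go : Dec (IsEdge (fromPort ρ) × IsEdge (toPort ρ)) → Dense (vecs vs 5) (2 * connectorD) (λ t → Fresh X t × T (connects ρ t))
          go (yes (e , f)) = dense-mono (λ { t@(_ ∷ _ ∷ _ ∷ _ ∷ _ ∷ []) (fr , ((_ , l) ∷ [])) → fr , connects-complete ρ t l })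
            (dense-patterns ((from , path , to) ∷ []) X (path-ok ∷ []) 0<K hK hn
              (dense-mono (λ { t c → edges t e f c ∷ [] }) (dense-connector a b)))
          -- A void request is served by anything, so the empty list of patterns suffices and only
          -- freshness is extracted.
          go (no ¬ef) = dense-mono (λ { t (fr , _) → fr , connects-void ρ t ¬ef })
            (dense-patterns [] X [] 0<K (≤-trans (≤-reflexive (*-zeroʳ (4 * connectorD))) z≤n) hn (dense-mono (λ _ _ → []) (dense-connector a b)))

      fresh-contents : ∀ {N} (X : List V) (t : Vec V N) → Fresh X t → Unique (Vec.toList t) × (∀ {v} → v ∈ Vec.toList t → v ∉ X)
      fresh-contents X []      _        = [] , λ ()
      fresh-contents X (j ∷ t) (f , fr) with fresh-contents X t fr
      ... | u , d = All.tabulate (λ m e → f (here (∈-++⁺ʳ X (subst (_∈ _) (sym e) (subst (_ ∈_) (sym (same t)) m))))) ∷ u ,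
                    λ { (here refl) m → f (here (∈-++⁺ˡ m)) ; (there m) → d m }
        where
        same : ∀ {N} (t : Vec V N) → concatMap (λ j → j ∷ []) (Vec.toList t) ≡ Vec.toList t
        same []      = refl
        same (j ∷ t) = cong (j ∷_) (same t)

      -- A path through F with vertices U, each of whose absorbers t ∈ F can still swallow two more vertices.
      data Flex : Port → List (Vec V 33) → List V → Port → Set where
        fixed : ∀ {e r f} → Link e r f → Flex e [] r f
        spot  : ∀ t → Link (startPort t) (before t) (endPort t) → Flex (startPort t) (t ∷ []) (before t) (endPort t)
        _▹_   : ∀ {e f g F F' U U'} → Flex e F U f → Flex f F' U' g → Flex e (F ++ F') (U ++ U') g

      freeze : ∀ {e F U f} → Flex e F U f → Link e U f
      freeze (fixed l)                  = l
      freeze (spot t l)                 = l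
      freeze (_▹_ {e} {U = U} {U'} p r) = Link-++ e U U' (freeze p) (freeze r)

      absorb : ∀ {e F U f} x y t → Flex e F U f → t ∈ F → T (absorbs (x ∷ y ∷ []) t) →
               ∃ λ F' → ∃ λ U' → Flex e F' U' f × F ↭ t ∷ F' × U' ↭ x ∷ y ∷ U
      absorb x y t (spot .t l) (here refl) h = [] , after x y t , fixed (afterLink (absorbs-sound (x ∷ y ∷ []) t h)) , ↭-refl , after↭ x y t
      absorb x y t (_▹_ {F = F} {F'} {U} {U'} p r) m h with ∈-++⁻ F m
      ... | inj₁ i with absorb x y t p i h
      ...   | G , W , p' , q₁ , q₂ = G ++ F' , W ++ U' , p' ▹ r , ++⁺ʳ F' q₁ , ++⁺ʳ U' q₂
      absorb x y t (_▹_ {F = F} {F'} {U} {U'} p r) m h | inj₂ i with absorb x y t r i h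
      ...   | G , W , r' , q₁ , q₂ = F ++ G , U ++ W , p ▹ r' , ↭-trans (++⁺ˡ F q₁) (shift t F G) , ↭-trans (++⁺ˡ U q₂) (shifts U (x ∷ y ∷ []))

      servings : {Q A : Set} (serves : Q → A → Bool) → Q → List A → ℕ
      servings serves q F = ∑ F (λ t → ⟦ serves q t ⟧)

      -- Removing the chosen element costs every request at most one server; thus a uniform supply
      -- allows that many greedy choices, whatever the requests turn out to be.
      choose : {Q A : Set} (serves : Q → A → Bool) (k : ℕ) (F : List A) → (∀ q → suc k ≤ servings serves q F) →
               ∀ q → ∃ λ t → ∃ λ F' → T (serves q t) × F ↭ t ∷ F' × (∀ q' → k ≤ servings serves q' F')
      choose serves k F h q with ∑-exceeds F (λ _ → 0) (λ t → ⟦ serves q t ⟧)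
                                   (subst (_< servings serves q F) (sym (trans (∑-const F 0) (*-zeroʳ (length F)))) (≤-trans (s≤s z≤n) (h q)))
      ... | t , m , p with ∈⇒↭ m
      ...   | F' , r = t , F' , 0<⟦⟧ p , r , λ q' → ≤-pred (≤-trans (h q') (≤-trans (≤-reflexive (∑-↭ (λ t → ⟦ serves q' t ⟧) r))
                         (+-monoˡ-≤ (servings serves q' F') (⟦⟧≤1 (serves q' t)))))

      absorbAll : ∀ k R → length R ≡ 2 * k → ∀ {e F U f} → Flex e F U f → (∀ ρ → k ≤ servings absorbs ρ F) →
                  ∃ λ U' → Link e U' f × U' ↭ R ++ U
      absorbAll zero    []          _ {U = U} p h = U , freeze p , ↭-refl
      absorbAll (suc k) []          ()
      absorbAll (suc k) (x ∷ [])    l p h = ⊥-elim (1≢ (trans l (*-suc 2 k)))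
        where
        1≢ : ∀ {j} → 1 ≢ suc (suc j)
        1≢ ()
      absorbAll (suc k) (x ∷ y ∷ R) l {e} {F} {U} {f} p h = go (choose absorbs k F h (x ∷ y ∷ []))
        where
        go : (∃ λ t → ∃ λ F' → T (absorbs (x ∷ y ∷ []) t) × F ↭ t ∷ F' × (∀ q' → k ≤ servings absorbs q' F')) → ∃ λ U' → Link e U' f × U' ↭ x ∷ y ∷ R ++ U
        go (t , F' , a , r , h') with absorb x y t p (∈-resp-↭ (↭-sym r) (here refl)) a
        ... | G , W , p' , q₁ , q₂ with absorbAll k R (suc-injective (suc-injective (trans l (*-suc 2 k)))) p'
                                          (λ ρ → subst (k ≤_) (∑-↭ (λ t → ⟦ absorbs ρ t ⟧) (drop-∷ (↭-trans (↭-sym r) q₁))) (h' ρ))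
        ...   | U' , lk , q₃ = U' , lk , ↭-trans q₃ (↭-trans (++⁺ˡ R q₂) (shifts R (x ∷ y ∷ [])))

      unfix : ∀ {e F U f} → Flex e (F ++ []) U f → Flex e F U f
      unfix {e} {F} {U} {f} = subst (λ Z → Flex e Z U f) (++-identityʳ F)

      attach : ∀ {e F U f} g t → Flex e F U f → IsEdge f → IsEdge g → T (connects (request f g) t) → Flex e F (U ++ connection (request f g) t) g
      attach {f = f} g t p hf hg c = unfix (p ▹ fixed (connects-sound (request f g) t c hf hg))

      flex-end-edge : ∀ {e F U f} → Flex e F U f → IsEdge e → IsEdge f
      flex-end-edge {e} {U = U} p h = Link-edge e U h (freeze p)

      module _ {q : ℕ} where

        -- One connector per tile and one more that leads back to the first edge `e`, whose three
        -- vertices enter the list only then.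
        closeUp : ∀ (Ts : List (Vec V q)) → All (λ t → IsTile q (Vec.toList t)) Ts → ∀ (C : List (Vec V 5)) {e F U f} → IsEdge e → Flex e F U f →
                  (∀ ρ → suc (length Ts) ≤ servings connects ρ C) →
                  ∃ λ U' → ∃ λ (C' : List (Vec V 5)) → Flex e F U' e × length C' ≤ length C × U' ++ cells C' ↭ (corners e ++ U) ++ cells Ts ++ cells C
        closeUp [] [] C {e} {F} {U} {f} he p h with choose connects 0 C h (request f e)
        ... | t , C' , s , r , _ = U ++ Z , C' , attach e t p (flex-end-edge p he) he s , ≤-trans (n≤1+n _) (≤-reflexive (sym (↭-length r))) , (begin
            (U ++ Z) ++ cells C'                              ≡⟨ ++-assoc U Z (cells C') ⟩
            U ++ Z ++ cells C'                                ↭⟨ ++⁺ˡ U (++⁺ʳ (cells C') (connection↭ (request f e) t)) ⟩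
            U ++ (Vec.toList t ++ corners e) ++ cells C'      ↭⟨ ++⁺ˡ U (++⁺ʳ (cells C') (++-comm (Vec.toList t) (corners e))) ⟩
            U ++ (corners e ++ Vec.toList t) ++ cells C'      ≡⟨ cong (U ++_) (++-assoc (corners e) (Vec.toList t) (cells C')) ⟩
            U ++ corners e ++ Vec.toList t ++ cells C'        ↭⟨ shifts U (corners e) ⟩
            corners e ++ U ++ cells (t ∷ C')                  ↭⟨ ++⁺ˡ (corners e) (++⁺ˡ U (cells-↭ (↭-sym r))) ⟩
            corners e ++ U ++ cells C                         ≡⟨ sym (++-assoc (corners e) U (cells C)) ⟩
            (corners e ++ U) ++ cells C                       ∎)
          where
          open PermutationReasoning hiding (start)
          Z = connection (request f e) t
        closeUp (T₁ ∷ Ts) (tile ∷ tiles) C {e} {F} {U} {f} he p h = go (choose connects (suc (length Ts)) C h (request f start))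
          where
          open IsTile tile
          open PermutationReasoning hiding (start)
          go : (∃ λ t → ∃ λ C' → T (connects (request f start) t) × C ↭ t ∷ C' × (∀ q' → suc (length Ts) ≤ servings connects q' C')) →
               ∃ λ U' → ∃ λ (C' : List (Vec V 5)) → Flex e F U' e × length C' ≤ length C × U' ++ cells C' ↭ (corners e ++ U) ++ cells (T₁ ∷ Ts) ++ cells C
          go (t , C' , s , r , h') = result (closeUp Ts tiles C' he (unfix (attach start t p (flex-end-edge p he) edge s ▹ fixed link)) h')
            where
            Z = connection (request f start) t
            result : (∃ λ U' → ∃ λ (C″ : List (Vec V 5)) → Flex e F U' e × length C″ ≤ length C' × U' ++ cells C″ ↭ (corners e ++ ((U ++ Z) ++ tail)) ++ cells Ts ++ cells C') →
                     ∃ λ U' → ∃ λ (C' : List (Vec V 5)) → Flex e F U' e × length C' ≤ length C × U' ++ cells C' ↭ (corners e ++ U) ++ cells (T₁ ∷ Ts) ++ cells C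
            result (U' , C″ , p' , l , q₁) = U' , C″ , p' , ≤-trans l (≤-trans (n≤1+n _) (≤-reflexive (sym (↭-length r)))) , (begin
              U' ++ cells C″                                             ↭⟨ q₁ ⟩
              (corners e ++ ((U ++ Z) ++ tail)) ++ cells Ts ++ cells C'  ↭⟨ ++⁺ʳ (cells Ts ++ cells C') (++⁺ˡ (corners e) piece) ⟩
              (corners e ++ (U ++ (τ ++ T′))) ++ cells Ts ++ cells C'    ≡⟨ assoc₁ (corners e) U τ T′ (cells Ts ++ cells C') ⟩
              (corners e ++ U) ++ (τ ++ (T′ ++ (cells Ts ++ cells C')))  ↭⟨ ++⁺ˡ (corners e ++ U) (↭-trans (shifts τ T′) (++⁺ˡ T′ (shifts τ (cells Ts)))) ⟩
              (corners e ++ U) ++ (T′ ++ (cells Ts ++ cells (t ∷ C')))   ↭⟨ ++⁺ˡ (corners e ++ U) (++⁺ˡ T′ (++⁺ˡ (cells Ts) (cells-↭ (↭-sym r)))) ⟩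
              (corners e ++ U) ++ (T′ ++ (cells Ts ++ cells C))          ≡⟨ cong ((corners e ++ U) ++_) (sym (++-assoc T′ (cells Ts) (cells C))) ⟩
              (corners e ++ U) ++ cells (T₁ ∷ Ts) ++ cells C             ∎)
              where
              τ = Vec.toList t
              T′ = Vec.toList T₁
              assoc₁ : ∀ (a b c d z : List V) → (a ++ (b ++ (c ++ d))) ++ z ≡ (a ++ b) ++ (c ++ (d ++ z))
              assoc₁ a b c d z = trans (cong (_++ z) (sym (++-assoc a b (c ++ d)))) (trans (++-assoc (a ++ b) (c ++ d) z) (cong ((a ++ b) ++_) (++-assoc c d z)))
              piece : (U ++ Z) ++ tail ↭ U ++ (τ ++ T′)
              piece = begin
                (U ++ Z) ++ tail                       ≡⟨ ++-assoc U Z tail ⟩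
                U ++ (Z ++ tail)                       ↭⟨ ++⁺ˡ U (++⁺ʳ tail (connection↭ (request f start) t)) ⟩
                U ++ ((τ ++ corners start) ++ tail)    ≡⟨ cong (U ++_) (++-assoc τ (corners start) tail) ⟩
                U ++ (τ ++ (corners start ++ tail))    ≡⟨ cong (λ z → U ++ (τ ++ z)) (sym split) ⟩
                U ++ (τ ++ T′)                         ∎

      Valid : Vec V 33 → Set
      Valid t = IsEdge (startPort t) × Link (startPort t) (before t) (endPort t)

      module _ (ξ : ℕ) (conn : ∀ X → length X ≤ ξ → ∀ ρ → ∃ λ t → Fresh X t × T (connects ρ t)) where

        -- The absorbers are few, so their connectors are picked one at a time, each avoiding the
        -- list `Z` of all vertices occupied so far.
        joinAll : ∀ Fs → All Valid Fs → ∀ {e F U f} Z → IsEdge e → Flex e F U f → Unique Z → length Z + length Fs * 5 ≤ ξ →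
          ∃ λ U' → ∃ λ f' → ∃ λ (Q : List (Vec V 5)) → Flex e (F ++ Fs) U' f' × length Q ≡ length Fs × Unique (Z ++ cells Q) × U' ↭ U ++ (cells Fs ++ cells Q)
        joinAll [] [] {e} {F} {U} {f} Z he p u h = U , f , [] , subst (λ G → Flex e G U f) (sym (++-identityʳ F)) p , refl ,
          subst Unique (sym (++-identityʳ Z)) u , ↭-reflexive (sym (++-identityʳ U))
        joinAll (t ∷ Fs) ((ht , lt) ∷ vs) {e} {F} {U} {f} Z he p u h = go (conn Z (≤-trans (m≤m+n (length Z) _) h) (request f (startPort t)))
          where
          open PermutationReasoning
          go : (∃ λ t₅ → Fresh Z t₅ × T (connects (request f (startPort t)) t₅)) →
            ∃ λ U' → ∃ λ f' → ∃ λ (Q : List (Vec V 5)) → Flex e (F ++ t ∷ Fs) U' f' × length Q ≡ suc (length Fs) × Unique (Z ++ cells Q) × U' ↭ U ++ (cells (t ∷ Fs) ++ cells Q)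
          go (t₅ , fr , c) = result (joinAll Fs vs (Z ++ τ) he (attach (startPort t) t₅ p (flex-end-edge p he) ht c ▹ spot t lt)
              (Unique-++⁺ u (proj₁ fc) (λ i j → proj₂ fc j i))
              (≤-trans (≤-reflexive (trans (cong (_+ length Fs * 5) (trans (length-++ Z) (cong (length Z +_) (length-toList t₅)))) (+-assoc (length Z) 5 (length Fs * 5)))) h))
            where
            τ = Vec.toList t₅
            Y = connection (request f (startPort t)) t₅
            fc = fresh-contents Z t₅ fr
            result : (∃ λ U' → ∃ λ f' → ∃ λ (Q : List (Vec V 5)) → Flex e ((F ++ t ∷ []) ++ Fs) U' f' × length Q ≡ length Fs × Unique ((Z ++ τ) ++ cells Q) ×
                       U' ↭ ((U ++ Y) ++ before t) ++ (cells Fs ++ cells Q)) →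
              ∃ λ U' → ∃ λ f' → ∃ λ (Q : List (Vec V 5)) → Flex e (F ++ t ∷ Fs) U' f' × length Q ≡ suc (length Fs) × Unique (Z ++ cells Q) × U' ↭ U ++ (cells (t ∷ Fs) ++ cells Q)
            result (U' , f' , Q , p' , l , u' , q₁) = U' , f' , t₅ ∷ Q , subst (λ G → Flex e G U' f') (++-assoc F (t ∷ []) Fs) p' , cong suc l ,
                subst Unique (++-assoc Z τ (cells Q)) u' , (begin
              U'                                                              ↭⟨ q₁ ⟩
              ((U ++ Y) ++ before t) ++ (cells Fs ++ cells Q)                 ≡⟨ trans (cong (_++ (cells Fs ++ cells Q)) (++-assoc U Y (before t))) (++-assoc U (Y ++ before t) (cells Fs ++ cells Q)) ⟩
              U ++ ((Y ++ before t) ++ (cells Fs ++ cells Q))                 ↭⟨ ++⁺ˡ U (++⁺ʳ (cells Fs ++ cells Q) piece) ⟩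
              U ++ ((τ ++ T′) ++ (cells Fs ++ cells Q))                       ≡⟨ cong (U ++_) (++-assoc τ T′ (cells Fs ++ cells Q)) ⟩
              U ++ (τ ++ (T′ ++ (cells Fs ++ cells Q)))                       ↭⟨ ++⁺ˡ U (↭-trans (shifts τ T′) (++⁺ˡ T′ (shifts τ (cells Fs)))) ⟩
              U ++ (T′ ++ (cells Fs ++ cells (t₅ ∷ Q)))                       ≡⟨ cong (U ++_) (sym (++-assoc T′ (cells Fs) (cells (t₅ ∷ Q)))) ⟩
              U ++ (cells (t ∷ Fs) ++ cells (t₅ ∷ Q))                         ∎)
              where
              T′ = Vec.toList t
              piece : Y ++ before t ↭ τ ++ T′
              piece = begin
                Y ++ before t                                   ↭⟨ ++⁺ʳ (before t) (connection↭ (request f (startPort t)) t₅) ⟩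
                (τ ++ corners (startPort t)) ++ before t        ≡⟨ ++-assoc τ (corners (startPort t)) (before t) ⟩
                τ ++ (corners (startPort t) ++ before t)        ↭⟨ ++⁺ˡ τ (before↭ t) ⟩
                τ ++ T′                                         ∎

        record AbsorbingPath (F : List (Vec V 33)) : Set where
          field
            e f    : Port
            U      : List V
            Q      : List (Vec V 5)
            edge   : IsEdge e
            flex   : Flex e F U f
            ∣Q∣    : length Q ≤ length F
            unique : Unique (cells F ++ cells Q)
            perm   : corners e ++ U ↭ cells F ++ cells Q

        absorbingPath : ∀ t F → All Valid (t ∷ F) → Unique (cells (t ∷ F)) → length (cells (t ∷ F)) + length F * 5 ≤ ξ → AbsorbingPath (t ∷ F)
        absorbingPath t F ((ht , lt) ∷ vs) u h = result (joinAll F vs (cells (t ∷ F)) ht (spot t lt) u h)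
          where
          open PermutationReasoning
          result : (∃ λ U' → ∃ λ f' → ∃ λ (Q : List (Vec V 5)) → Flex (startPort t) (t ∷ F) U' f' × length Q ≡ length F × Unique (cells (t ∷ F) ++ cells Q) ×
                     U' ↭ before t ++ (cells F ++ cells Q)) → AbsorbingPath (t ∷ F)
          result (U' , f' , Q , p , l , u' , q) = record
            { e = startPort t ; f = f' ; U = U' ; Q = Q ; edge = ht ; flex = p ; ∣Q∣ = ≤-trans (≤-reflexive l) (n≤1+n (length F)) ; unique = u' ; perm = begin
              corners (startPort t) ++ U'                                       ↭⟨ ++⁺ˡ (corners (startPort t)) q ⟩
              corners (startPort t) ++ (before t ++ (cells F ++ cells Q))       ≡⟨ sym (++-assoc (corners (startPort t)) (before t) (cells F ++ cells Q)) ⟩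
              (corners (startPort t) ++ before t) ++ (cells F ++ cells Q)       ↭⟨ ++⁺ʳ (cells F ++ cells Q) (before↭ t) ⟩
              Vec.toList t ++ (cells F ++ cells Q)                              ≡⟨ sym (++-assoc (Vec.toList t) (cells F) (cells Q)) ⟩
              cells (t ∷ F) ++ cells Q                                          ∎ }

      -- Fewer than w tiles need at most w connectors, and the second w in `TC` pays for the
      -- logarithm of the number of requests. Afterwards at most 5 `TC` vertices of idle connectors
      -- and w uncovered ones remain; `TA` is large enough to absorb these.
      module Assembly (w ξ TA TC q ℓ : ℕ) (0<w : 0 < w) (n^2≤ : n ^ 2 ≤ 2 ^ w) (n^6≤ : n ^ 6 ≤ 2 ^ w)
        (TC≡ : TC ≡ 2 * (2 * connectorD) * (w + w)) (TA≡ : TA ≡ 2 * (2 * absorberD) * (TC * 5 + w + w))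
        (hξ : TA * 33 + TA * 5 + TC * 5 ≤ ξ)
        (hA : 4 * absorberD * (33 * (1 * (ξ + 33 * 1))) ≤ n) (hAC : 4 * absorberD * 62 ≤ K)
        (hC : 4 * connectorD * (5 * (1 * (ξ + 5 * 1))) ≤ n) (hCC : 4 * connectorD * 8 ≤ K)
        (n≡ : n ≡ 2 * ℓ) (n<qw : n < q * w)
        (pack : ∀ X → Unique X → length X ≤ ξ → ∃ λ (Ts : List (Vec (Fin n) q)) → All (λ t → Tiles.IsTile H q (Vec.toList t)) Ts ×
           ∃ λ R → X ++ (cells Ts ++ R) ↭ allFin n × q * length R < n) where

        many-absorb : ∀ X → length X ≤ ξ → ∀ ρ → Dense (vecs vs 33) (2 * absorberD) (λ t → Fresh X t × T (absorbs ρ t))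
        many-absorb X h = dense-absorbs X (≤-trans (*-monoʳ-≤ (4 * absorberD) (*-monoʳ-≤ 33 (*-monoʳ-≤ 1 (+-monoˡ-≤ 33 h)))) hA) hAC

        many-connect : ∀ X → length X ≤ ξ → ∀ ρ → Dense (vecs vs 5) (2 * connectorD) (λ t → Fresh X t × T (connects ρ t))
        many-connect X h = dense-connects X (≤-trans (*-monoʳ-≤ (4 * connectorD) (*-monoʳ-≤ 5 (*-monoʳ-≤ 1 (+-monoˡ-≤ 5 h)))) hC) hCC

        conn : ∀ X → length X ≤ ξ → ∀ ρ → ∃ λ t → Fresh X t × T (connects ρ t)
        conn X h ρ = proj₁ d , proj₂ (proj₂ d)
          where
          d : ∃ λ t → t ∈ vecs vs 5 × Fresh X t × T (connects ρ t)
          d = dense-∃ (0<vecs {xs = vs} 0<vs 5) (many-connect X h ρ)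

        FreshFam : ∀ {N} → List V → List (Vec V N) → Set
        FreshFam X []      = ⊤
        FreshFam X (t ∷ F) = Fresh (X ++ cells F) t × FreshFam X F

        fresh-family : ∀ {N} X (F : List (Vec V N)) → FreshFam X F → Unique (cells F) × (∀ {v} → v ∈ cells F → v ∉ X)
        fresh-family X []      _         = [] , λ ()
        fresh-family X (t ∷ F) (fr , ff) = Unique-++⁺ (proj₁ fc) (proj₁ rec) (λ i j → proj₂ fc i (∈-++⁺ʳ X j)) , outside
          where
          fc = fresh-contents (X ++ cells F) t fr
          rec = fresh-family X F ff
          outside : ∀ {v} → v ∈ Vec.toList t ++ cells F → v ∉ X
          outside i with ∈-++⁻ (Vec.toList t) i
          ... | inj₁ j = λ k → proj₂ fc j (∈-++⁺ˡ k)
          ... | inj₂ j = proj₂ rec j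

        record Supply {N r : ℕ} (serves : Vec V r → Vec V N → Bool) (X : List V) (size usable : ℕ) : Set where
          field
            F       : List (Vec V N)
            ∣F∣     : length F ≡ size
            fresh   : FreshFam X F
            useful  : All (λ t → ∃ λ ρ → T (serves ρ t)) F
            enough  : ∀ ρ → usable ≤ servings serves ρ F

        pred2 : ∀ d → 0 < d → 2 * (2 * d) ≡ 1 + (2 * (2 * d) ∸ 1) × 0 < 2 * (2 * d) ∸ 1
        pred2 (suc d) _ = sym (m+[n∸m]≡n {1} {2 * (2 * suc d)} (s≤s z≤n)) , ≤-trans (s≤s z≤n) (∸-monoˡ-≤ {2} {2 * (2 * suc d)} 1 (*-mono-≤ {2} {2} {1} ≤-refl (s≤s z≤n)))

        module _ {N r : ℕ} (serves : Vec V r → Vec V N → Bool) (D : ℕ) (0<D : 0 < D)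
          (many : ∀ X → length X ≤ ξ → ∀ ρ → Dense (vecs vs N) (2 * D) (λ t → Fresh X t × T (serves ρ t))) where

          module F = Family (vecs vs N) (vecs vs r) serves Vec.toList Fresh N ξ (2 * D) (2 * (2 * D) ∸ 1)
            (proj₁ (pred2 D 0<D)) (proj₂ (pred2 D 0<D)) (0<vecs {xs = vs} 0<vs N) (0<vecs {xs = vs} 0<vs r) length-toList many

          toFreshFam : ∀ X F → F.FreshFamily X F → FreshFam X F
          toFreshFam X []      _       = tt
          toFreshFam X (t ∷ F) (f , r) = f , toFreshFam X F r

          supply : ∀ X m size → size ≡ 2 * (2 * D) * (m + w) → length X + size * N ≤ ξ → n ^ r ≤ 2 ^ w → Supply serves X size m
          supply X m .(2 * (2 * D) * (m + w)) refl hX hr = go (F.family X (m + w) w hX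
              (≤-trans (≤-reflexive (trans (length-vecs {xs = vs} r) (cong (_^ r) ∣vs∣))) hr))
            where
            go : (∃ λ F → length F ≡ 2 * (2 * D) * (m + w) × F.FreshFamily X F × All (λ t → ∃ λ q → T (serves q t)) F ×
                   (∀ {q} → q ∈ vecs vs r → m + w ≤ F.count q F + w)) → Supply serves X (2 * (2 * D) * (m + w)) m
            go (F , l , fr , us , en) = record { F = F ; ∣F∣ = l ; fresh = toFreshFam X F fr ; useful = us
                                               ; enough = λ ρ → +-cancelʳ-≤ w m _ (en (∈-vecs {xs = vs} ∈-allFin ρ)) }

        abstract
          absorbers : Supply absorbs [] TA (TC * 5 + w)
          absorbers = supply absorbs absorberD 0<absorberD many-absorb [] (TC * 5 + w) TA TA≡
            (≤-trans (≤-trans (m≤m+n (TA * 33) (TA * 5)) (m≤m+n (TA * 33 + TA * 5) (TC * 5))) hξ) n^2≤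

          connectors : ∀ X → length X + TC * 5 ≤ ξ → Supply connects X TC w
          connectors X hX = supply connects connectorD 0<connectorD many-connect X w TC TC≡ hX n^6≤

        Link-even : ∀ e r {f} → Link e r f → ∃ λ k → length r ≡ 2 * k
        Link-even e           []          _           = 0 , refl
        Link-even (a , b , c) (d ∷ x ∷ r) (_ , _ , l) with Link-even (c , d , x) r l
        ... | k , h = suc k , trans (cong (2 +_) h) (sym (*-suc 2 k))

        module Final (A : Supply absorbs [] TA (TC * 5 + w)) (P : AbsorbingPath ξ conn (Supply.F A)) where

          module A = Supply A
          module P = AbsorbingPath P

          XA : List V
          XA = cells A.F ++ cells P.Q

          ∣XA∣ : length XA ≤ TA * 33 + TA * 5
          ∣XA∣ = ≤-trans (≤-reflexive (trans (length-++ (cells A.F)) (cong₂ _+_ (∣cells∣ A.F) (∣cells∣ P.Q))))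
            (+-mono-≤ (≤-reflexive (cong (_* 33) A.∣F∣)) (*-monoˡ-≤ 5 (≤-trans P.∣Q∣ (≤-reflexive A.∣F∣))))

          module Rest (S : Supply connects XA TC w) where

            module S = Supply S

            X : List V
            X = XA ++ cells S.F

            X-unique : Unique X
            X-unique = Unique-++⁺ P.unique (proj₁ ff) (λ i j → proj₂ ff j i)
              where ff = fresh-family XA S.F S.fresh

            ∣X∣ : length X ≤ ξ
            ∣X∣ = ≤-trans (≤-reflexive (trans (length-++ XA) (cong (length XA +_) (trans (∣cells∣ S.F) (cong (_* 5) S.∣F∣)))))
              (≤-trans (+-monoˡ-≤ (TC * 5) ∣XA∣) hξ)

            finish : (∃ λ (Ts : List (Vec V q)) → All (λ t → IsTile q (Vec.toList t)) Ts × ∃ λ R → X ++ (cells Ts ++ R) ↭ allFin n × q * length R < n) → HamiltonCycle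
            finish (Ts , tiles , R , pm , hR) = absorbRest (closeUp Ts tiles S.F P.edge P.flex (λ ρ → ≤-trans Ts<w (S.enough ρ)))
              where
              open PermutationReasoning
              -- Bounds both the number of tiles and the number of uncovered vertices.
              small : ∀ k → q * k ≤ n → k < w
              small k h = *-cancelˡ-< q k w (≤-<-trans h n<qw)
              Ts<w : length Ts < w
              Ts<w = small (length Ts) (≤-trans (≤-reflexive (trans (*-comm q (length Ts)) (sym (∣cells∣ Ts))))
                (≤-trans (m≤m+n (length (cells Ts)) (length R)) (≤-trans (≤-reflexive (sym (length-++ (cells Ts)))) (≤-trans (m≤n+m _ (length X))
                  (≤-reflexive (trans (sym (length-++ X)) (trans (↭-length pm) (length-allFin n))))))))
              absorbRest : (∃ λ U' → ∃ λ (C' : List (Vec V 5)) → Flex P.e A.F U' P.e × length C' ≤ length S.F × U' ++ cells C' ↭ (corners P.e ++ P.U) ++ cells Ts ++ cells S.F) → HamiltonCycle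
              -- Parity: n is even and a closed link has even length, so the vertices that remain
              -- can be paired.
              absorbRest (U' , C' , fl , lC , q₁) = conclude (even-difference (length U') (length L) ℓ (trans (sym (length-++ U')) (trans (↭-length all) (trans (length-allFin n) n≡))) (Link-even P.e U' (freeze fl)))
                where
                L = cells C' ++ R
                all : U' ++ L ↭ allFin n
                all = begin
                  U' ++ (cells C' ++ R)                                  ≡⟨ sym (++-assoc U' (cells C') R) ⟩
                  (U' ++ cells C') ++ R                                  ↭⟨ ++⁺ʳ R (↭-trans q₁ (++⁺ʳ (cells Ts ++ cells S.F) P.perm)) ⟩
                  (XA ++ (cells Ts ++ cells S.F)) ++ R                   ↭⟨ ++⁺ʳ R (++⁺ˡ XA (++-comm (cells Ts) (cells S.F))) ⟩
                  (XA ++ (cells S.F ++ cells Ts)) ++ R                   ≡⟨ trans (cong (_++ R) (sym (++-assoc XA (cells S.F) (cells Ts)))) (++-assoc X (cells Ts) R) ⟩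
                  X ++ (cells Ts ++ R)                                   ↭⟨ pm ⟩
                  allFin n                                               ∎
                ∣L∣ : length L ≤ TC * 5 + w
                ∣L∣ = ≤-trans (≤-reflexive (trans (length-++ (cells C')) (cong (_+ length R) (∣cells∣ C'))))
                  (+-mono-≤ (*-monoˡ-≤ 5 (≤-trans lC (≤-reflexive S.∣F∣))) (<⇒≤ (small (length R) (<⇒≤ hR))))
                conclude : (∃ λ k → length L ≡ 2 * k) → HamiltonCycle
                conclude (k , lk) = done (absorbAll k L lk fl (λ ρ → ≤-trans (≤-trans (m≤m+n k (k + 0)) (≤-trans (≤-reflexive (sym lk)) ∣L∣)) (A.enough ρ)))
                  where
                  done : (∃ λ U″ → Link P.e U″ P.e × U″ ↭ L ++ U') → HamiltonCycle
                  done (U″ , lk , q₂) = record { base = P.e ; cycle = U″ ; closed = lk ; spans = ↭-trans q₂ (↭-trans (++-comm L U') all) }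

            result : HamiltonCycle
            result = finish (pack X X-unique ∣X∣)

          hamiltonCycle : HamiltonCycle
          hamiltonCycle = Rest.result (connectors XA (≤-trans (+-monoˡ-≤ (TC * 5) ∣XA∣) hξ))

        valid : ∀ t → (∃ λ ρ → T (absorbs ρ t)) → Valid t
        valid t (ρ , h) = startEdge a , beforeLink a
          where a = absorbs-sound ρ t h

        withAbsorbers : (A : Supply absorbs [] TA (TC * 5 + w)) → AbsorbingPath ξ conn (Supply.F A)
        withAbsorbers A = go (Supply.F A) (Supply.∣F∣ A) (Supply.useful A) (proj₁ (fresh-family [] (Supply.F A) (Supply.fresh A)))
          where
          0<TA : 0 < TA
          0<TA = subst (0 <_) (sym TA≡) (0<* (0<* {2} (s≤s z≤n) (0<* {2} (s≤s z≤n) 0<absorberD)) (≤-trans 0<w (m≤n+m w (TC * 5 + w))))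
          go : ∀ F → length F ≡ TA → All (λ t → ∃ λ ρ → T (absorbs ρ t)) F → Unique (cells F) → AbsorbingPath ξ conn F
          go []      l _  _ = contradiction (subst (0 <_) (sym l) 0<TA) (λ ())
          go (t ∷ F) l us u = absorbingPath ξ conn t F (All.map (λ {t} → valid t) us) u
            (≤-trans (+-mono-≤ (≤-reflexive (trans (∣cells∣ (t ∷ F)) (cong (_* 33) l))) (*-monoˡ-≤ 5 (≤-trans (n≤1+n (length F)) (≤-reflexive l))))
              (≤-trans (m≤m+n (TA * 33 + TA * 5) (TC * 5)) hξ))

        complete : Supply absorbs [] TA (TC * 5 + w) → HamiltonCycle
        complete A = Final.hamiltonCycle A (withAbsorbers A)

        hamilton : HamiltonCycle
        hamilton = complete absorbers

  -- The cyclic order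

  open import Defs
  open import Data.Bool using () renaming (_≟_ to _≟ᵇ_)
  open import Data.Fin.Subset using (Subset; ⁅_⁆; _∪_; _∩_; ∣_∣; Nonempty; inside; outside) renaming (_∈_ to _∈ˢ_)
  open import Data.Fin.Subset.Properties using (x∈p∪q⁻; x∈p∪q⁺; x∈⁅y⁆⇒x≡y; x∈⁅x⁆; x∈p∩q⁻; ∪-comm; ∪-assoc; ⊆-antisym; _∈?_)
  open import Data.Nat.DivMod using (n%n≡0; m*n/n≡m; /-monoˡ-≤)
  open import Function.Definitions using (Injective)
  open import Data.Vec using (here; there)

  -- Doubling that unfolds by two successors, in step with `Link`, which consumes two vertices per
  -- edge.
  db : ℕ → ℕ
  db zero    = zero
  db (suc j) = suc (suc (db j))

  db≡2* : ∀ j → db j ≡ 2 * j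
  db≡2* zero    = refl
  db≡2* (suc j) = trans (cong (2 +_) (db≡2* j)) (sym (*-suc 2 j))

  db-injective : ∀ {j k} → db j ≡ db k → j ≡ k
  db-injective {zero}  {zero}  e = refl
  db-injective {suc j} {suc k} e = cong suc (db-injective (suc-injective (suc-injective e)))

  db≢odd : ∀ j k → db j ≢ suc (db k)
  db≢odd (suc j) (suc k) e = db≢odd j k (suc-injective (suc-injective e))

  nth : {A : Set} → A → List A → ℕ → A
  nth d []       _       = d
  nth d (x ∷ xs) zero    = x
  nth d (x ∷ xs) (suc k) = nth d xs k

  nth-∈ : {A : Set} {d : A} (xs : List A) → ∀ k → k < length xs → nth d xs k ∈ xs
  nth-∈ (x ∷ xs) zero    _       = here refl
  nth-∈ (x ∷ xs) (suc k) (s≤s h) = there (nth-∈ xs k h)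

  nth-injective : {A : Set} {d : A} (xs : List A) → Unique xs → ∀ j k → j < length xs → k < length xs → nth d xs j ≡ nth d xs k → j ≡ k
  nth-injective (x ∷ xs) (h ∷ u) zero    zero    _       _       e = refl
  nth-injective (x ∷ xs) (h ∷ u) zero    (suc k) _       (s≤s l) e = ⊥-elim (∉-head h (subst (_∈ xs) (sym e) (nth-∈ xs k l)))
  nth-injective (x ∷ xs) (h ∷ u) (suc j) zero    (s≤s l) _       e = ⊥-elim (∉-head h (subst (_∈ xs) e (nth-∈ xs j l)))
  nth-injective (x ∷ xs) (h ∷ u) (suc j) (suc k) (s≤s l) (s≤s l') e = cong suc (nth-injective xs u j k l l' e)

  module CycleEdges {n : ℕ} (H : Coloured n) where

    open Links H

    edgeAt : V → V → List V → ℕ → Port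
    edgeAt d c U j = nth d (c ∷ U) (db j) , nth d (c ∷ U) (suc (db j)) , nth d (c ∷ U) (suc (suc (db j)))

    colour : Port → ℕ
    colour (a , b , c) = col a b c

    last₃ : Port → V
    last₃ (a , b , c) = c

    Link-edges : ∀ d e U {f} → Link e U f → ∀ j → db (suc j) ≤ length U → IsEdge (edgeAt d (last₃ e) U j)
    Link-edges d (a , b , c) (x ∷ y ∷ U) (h , _ , l) zero    _             = h
    Link-edges d (a , b , c) (x ∷ y ∷ U) (h , _ , l) (suc j) (s≤s (s≤s k)) = Link-edges d (c , x , y) U l j k

    Link-first : ∀ d e U {f} → Link e U f → 0 < length U → colour e ≢ colour (edgeAt d (last₃ e) U 0)
    Link-first d (a , b , c) (x ∷ y ∷ U) (_ , h , _) _ = h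

    Link-colours : ∀ d e U {f} → Link e U f → ∀ j → db (suc (suc j)) ≤ length U → colour (edgeAt d (last₃ e) U j) ≢ colour (edgeAt d (last₃ e) U (suc j))
    Link-colours d (a , b , c) (x ∷ y ∷ U) (_ , _ , l) zero    (s≤s (s≤s k)) = Link-first d (c , x , y) U l (≤-trans (s≤s z≤n) k)
    Link-colours d (a , b , c) (x ∷ y ∷ U) (_ , _ , l) (suc j) (s≤s (s≤s k)) = Link-colours d (c , x , y) U l j k

    Link-last : ∀ d e U {f} → Link e U f → ∀ j → length U ≡ db (suc j) → edgeAt d (last₃ e) U j ≡ f
    Link-last d (a , b , c) (x ∷ y ∷ [])    (_ , _ , l) zero    _ = l
    Link-last d (a , b , c) (x ∷ y ∷ z ∷ U) _           zero    ()
    Link-last d (a , b , c) (x ∷ y ∷ U)     (_ , _ , l) (suc j) h = Link-last d (c , x , y) U l j (suc-injective (suc-injective h))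

  module _ {n : ℕ} where

    triple-rot : (a b c : Fin n) → triple a b c ≡ triple b c a
    triple-rot a b c = trans (∪-comm ⁅ a ⁆ (⁅ b ⁆ ∪ ⁅ c ⁆)) (∪-assoc ⁅ b ⁆ ⁅ c ⁆ ⁅ a ⁆)

    triple-swap : (a b c : Fin n) → triple a b c ≡ triple a c b
    triple-swap a b c = cong (⁅ a ⁆ ∪_) (∪-comm ⁅ b ⁆ ⁅ c ⁆)

    ∈-triple⁻ : ∀ {v} (a b c : Fin n) → v ∈ˢ triple a b c → v ≡ a ⊎ v ≡ b ⊎ v ≡ c
    ∈-triple⁻ a b c m with x∈p∪q⁻ ⁅ a ⁆ (⁅ b ⁆ ∪ ⁅ c ⁆) m
    ... | inj₁ i = inj₁ (x∈⁅y⁆⇒x≡y a i)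
    ... | inj₂ i with x∈p∪q⁻ ⁅ b ⁆ ⁅ c ⁆ i
    ...   | inj₁ j = inj₂ (inj₁ (x∈⁅y⁆⇒x≡y b j))
    ...   | inj₂ j = inj₂ (inj₂ (x∈⁅y⁆⇒x≡y c j))

    ∈-triple₁ : (a b c : Fin n) → a ∈ˢ triple a b c
    ∈-triple₁ a b c = x∈p∪q⁺ (inj₁ (x∈⁅x⁆ a))

    ∈-triple₂ : (a b c : Fin n) → b ∈ˢ triple a b c
    ∈-triple₂ a b c = x∈p∪q⁺ {p = ⁅ a ⁆} (inj₂ (x∈p∪q⁺ (inj₁ (x∈⁅x⁆ b))))

    ∈-triple₃ : (a b c : Fin n) → c ∈ˢ triple a b c
    ∈-triple₃ a b c = x∈p∪q⁺ {p = ⁅ a ⁆} (inj₂ (x∈p∪q⁺ {p = ⁅ b ⁆} (inj₂ (x∈⁅x⁆ c))))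

    _≟ˢ_ : (p q : Subset n) → Dec (p ≡ q)
    _≟ˢ_ = ≡-decᵛ _≟ᵇ_

    _∈ᵉ?_ : (p : Subset n) (L : List (Subset n)) → Dec (p ∈ L)
    p ∈ᵉ? L = Any.any? (p ≟ˢ_) L

    fromGraph : ThreeGraph n → Colouring n → Coloured n
    fromGraph H φ = record
      { E = λ a b c → ⌊ triple a b c ∈ᵉ? edges H ⌋ ; col = λ a b c → φ (triple a b c)
      ; E-rot = λ a b c → cong (λ e → ⌊ e ∈ᵉ? edges H ⌋) (triple-rot a b c) ; E-swap = λ a b c → cong (λ e → ⌊ e ∈ᵉ? edges H ⌋) (triple-swap a b c)
      ; col-rot = λ a b c → cong φ (triple-rot a b c) ; col-swap = λ a b c → cong φ (triple-swap a b c) }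

  module CloseCycle {m : ℕ} (H : ThreeGraph (suc m)) (φ : Colouring (suc m)) (ℓ′ : ℕ) (n≡ : suc m ≡ db (suc ℓ′))
    (e : Links.Port (fromGraph H φ)) (U : List (Fin (suc m))) (lk : Links.Link (fromGraph H φ) e U e) (pm : U ↭ allFin (suc m)) where

    open Links (fromGraph H φ)
    open CycleEdges (fromGraph H φ)

    a : V
    a = last₃ e

    n : ℕ
    n = suc m

    y : ℕ → V
    -- The cycle unrolled to positions 0 to n; the base vertex stands at both ends, so the last edge
    -- is read off without reduction modulo n.
    y = nth a (a ∷ U)

    ∣U∣ : length U ≡ n
    ∣U∣ = trans (↭-length pm) (length-allFin n)

    ∣U∣db : length U ≡ db (suc ℓ′)
    ∣U∣db = trans ∣U∣ n≡

    U-unique : Unique U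
    U-unique = Unique-resp-↭ (↭-sym pm) (allFin⁺ n)

    lastEdge : edgeAt a a U ℓ′ ≡ e
    lastEdge = Link-last a e U lk ℓ′ ∣U∣db

    y-n : y n ≡ a
    y-n = trans (cong y n≡) (cong last₃ lastEdge)

    y-injective⁺ : ∀ j k → j < n → k < n → y (suc j) ≡ y (suc k) → j ≡ k
    y-injective⁺ j k h h' eq = nth-injective U U-unique j k (subst (j <_) (sym ∣U∣) h) (subst (k <_) (sym ∣U∣) h') eq

    y-equal : ∀ s t → s ≤ n → t ≤ n → y s ≡ y t → s ≡ t ⊎ (s ≡ 0 × t ≡ n) ⊎ (s ≡ n × t ≡ 0)
    y-equal zero    zero    _ _ _ = inj₁ refl
    y-equal zero    (suc t) _ h eq = inj₂ (inj₁ (refl , cong suc (y-injective⁺ t m h ≤-refl (trans (sym eq) (sym y-n)))))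
    y-equal (suc s) zero    h _ eq = inj₂ (inj₂ (cong suc (y-injective⁺ s m h ≤-refl (trans eq (sym y-n))) , refl))
    y-equal (suc s) (suc t) h h' eq = inj₁ (cong suc (y-injective⁺ s t h h' eq))

    σ : Fin n → Fin n
    σ i = y (toℕ i)

    σ-injective : Injective _≡_ _≡_ σ
    σ-injective {i} {j} eq with y-equal (toℕ i) (toℕ j) (<⇒≤ (toℕ<n i)) (<⇒≤ (toℕ<n j)) eq
    ... | inj₁ h              = toℕ-injective h
    ... | inj₂ (inj₁ (_ , h)) = contradiction h (<⇒≢ (toℕ<n j))
    ... | inj₂ (inj₂ (h , _)) = contradiction h (<⇒≢ (toℕ<n i))

    pos≡ : ∀ k → k ≤ n → pos σ k ≡ y k
    pos≡ k h with k <? n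
    ... | yes k<n = cong y (trans (toℕ-fromℕ< (m%n<n k n)) (m<n⇒m%n≡m k<n))
    ... | no  k≮n = trans (cong y (trans (toℕ-fromℕ< (m%n<n k n)) (trans (cong (_% n) k≡n) (n%n≡0 n)))) (trans (sym y-n) (cong y (sym k≡n)))
      where
      k≡n : k ≡ n
      k≡n = ≤-antisym h (≮⇒≥ k≮n)

    db≤ : ∀ j → j < suc ℓ′ → db (suc j) ≤ n
    db≤ j h = subst₂ _≤_ (sym (db≡2* (suc j))) (sym (trans n≡ (db≡2* (suc ℓ′)))) (*-monoʳ-≤ 2 h)

    edge≡ : ∀ j → j < suc ℓ′ → cycEdge σ j ≡ triple (y (db j)) (y (suc (db j))) (y (suc (suc (db j))))
    edge≡ j h = subst (λ z → triple (pos σ z) (pos σ (z + 1)) (pos σ (z + 2)) ≡ triple (y (db j)) (y (suc (db j))) (y (suc (suc (db j))))) (db≡2* j)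
      (cong₂ (λ u v → triple u (proj₁ v) (proj₂ v)) (pos≡ (db j) (≤-trans (≤-trans (n≤1+n _) (n≤1+n _)) (db≤ j h)))
        (cong₂ _,_ (trans (cong (pos σ) (+-comm (db j) 1)) (pos≡ (suc (db j)) (≤-trans (n≤1+n _) (db≤ j h))))
                   (trans (cong (pos σ) (+-comm (db j) 2)) (pos≡ (suc (suc (db j))) (db≤ j h)))))

    inH : ∀ j → j < suc ℓ′ → cycEdge σ j ∈ edges H
    inH j h = subst (_∈ edges H) (sym (edge≡ j h)) (toWitness (Link-edges a e U lk j (subst (db (suc j) ≤_) (sym ∣U∣) (db≤ j h))))

    Φ : ℕ → ℕ
    Φ j = colour (edgeAt a a U j)

    Φ-step : ∀ j → suc j < suc ℓ′ → Φ j ≢ Φ (suc j)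
    Φ-step j h = Link-colours a e U lk j (subst (db (suc (suc j)) ≤_) (sym ∣U∣) (db≤ (suc j) h))

    Φ-wrap : Φ ℓ′ ≢ Φ 0
    Φ-wrap eq = Link-first a e U lk (subst (0 <_) (sym ∣U∣) (s≤s z≤n)) (trans (cong colour (sym lastEdge)) eq)

    Near : ℕ → ℕ → Set
    Near j k = k ≡ suc j ⊎ j ≡ suc k ⊎ (j ≡ 0 × k ≡ ℓ′) ⊎ (j ≡ ℓ′ × k ≡ 0)

    zero-db : ∀ j → db j ≡ 0 → j ≡ 0
    zero-db zero _ = refl

    full-db : ∀ k β → k < suc ℓ′ → β ≤ 2 → β + db k ≡ n → k ≡ ℓ′
    full-db k β h hβ e = suc-injective (≤-antisym h (*-cancelˡ-≤ 2 (subst₂ _≤_ (trans (trans e n≡) (db≡2* (suc ℓ′))) (db≡2* (suc k)) (+-monoˡ-≤ (db k) hβ))))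

    -- Edge j occupies positions 2j to 2j + 2. Two edges share a position only at even ends, that is
    -- for neighbouring indices; the repeated base vertex adds the pair of the first and the last
    -- edge.
    meet : ∀ j k α β → j < suc ℓ′ → k < suc ℓ′ → j ≢ k → α ≤ 2 → β ≤ 2 → y (α + db j) ≡ y (β + db k) → Near j k
    meet j k α β hj hk j≢k hα hβ eq with y-equal (α + db j) (β + db k) (≤-trans (+-monoˡ-≤ (db j) hα) (db≤ j hj)) (≤-trans (+-monoˡ-≤ (db k) hβ) (db≤ k hk)) eq
    ... | inj₂ (inj₁ (s , t)) = inj₂ (inj₂ (inj₁ (zero-db j (m+n≡0⇒n≡0 α s) , full-db k β hk hβ t)))
    ... | inj₂ (inj₂ (s , t)) = inj₂ (inj₂ (inj₂ (full-db j α hj hα s , zero-db k (m+n≡0⇒n≡0 β t))))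
    ... | inj₁ s = cases α β hα hβ s
      where
      cases : ∀ α β → α ≤ 2 → β ≤ 2 → α + db j ≡ β + db k → Near j k
      cases 0 0 _ _ s = contradiction (db-injective s) j≢k
      cases 0 1 _ _ s = contradiction s (db≢odd j k)
      cases 0 2 _ _ s = inj₂ (inj₁ (db-injective s))
      cases 1 0 _ _ s = contradiction (sym s) (db≢odd k j)
      cases 1 1 _ _ s = contradiction (db-injective (suc-injective s)) j≢k
      cases 1 2 _ _ s = contradiction (suc-injective s) (db≢odd j k)
      cases 2 0 _ _ s = inj₁ (sym (db-injective s))
      cases 2 1 _ _ s = contradiction (sym (suc-injective s)) (db≢odd k j)
      cases 2 2 _ _ s = contradiction (db-injective (suc-injective (suc-injective s))) j≢k
      cases (suc (suc (suc _))) _ (s≤s (s≤s ())) _ _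
      cases _ (suc (suc (suc _))) _ (s≤s (s≤s ())) _

    near-colours : ∀ j k → j < suc ℓ′ → k < suc ℓ′ → Near j k → Φ j ≢ Φ k
    near-colours j k hj hk (inj₁ refl)                     = Φ-step j hk
    near-colours j k hj hk (inj₂ (inj₁ refl))              = λ eq → Φ-step k hj (sym eq)
    near-colours j k hj hk (inj₂ (inj₂ (inj₁ (refl , refl)))) = λ eq → Φ-wrap (sym eq)
    near-colours j k hj hk (inj₂ (inj₂ (inj₂ (refl , refl)))) = Φ-wrap

    corner : ∀ {v} j → j < suc ℓ′ → v ∈ˢ cycEdge σ j → ∃ λ α → α ≤ 2 × v ≡ y (α + db j)
    corner j h i with ∈-triple⁻ (y (db j)) (y (suc (db j))) (y (suc (suc (db j)))) (subst (_ ∈ˢ_) (edge≡ j h) i)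
    ... | inj₁ p        = 0 , z≤n , p
    ... | inj₂ (inj₁ p) = 1 , s≤s z≤n , p
    ... | inj₂ (inj₂ p) = 2 , ≤-refl , p

    proper : ∀ j k → j < suc ℓ′ → k < suc ℓ′ → j ≢ k → Nonempty (cycEdge σ j ∩ cycEdge σ k) → φ (cycEdge σ j) ≢ φ (cycEdge σ k)
    proper j k hj hk j≢k (v , i) eq with x∈p∩q⁻ (cycEdge σ j) (cycEdge σ k) i
    ... | i₁ , i₂ with corner j hj i₁ | corner k hk i₂
    ...   | α , hα , p | β , hβ , p' = near-colours j k hj hk (meet j k α β hj hk j≢k hα hβ (trans (sym p) p'))
            (trans (cong φ (sym (edge≡ j hj))) (trans eq (cong φ (edge≡ k hk))))

    result : HasPCLooseHamCycle (suc m) H φ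
    result = suc ℓ′ , trans n≡ (db≡2* (suc ℓ′)) , σ , σ-injective , inH , proper

  -- Degrees of the hypergraph as counts of ordered pairs.

  els : ∀ {n} → Subset n → List (Fin n)
  els []            = []
  els (inside  ∷ p) = zero ∷ map suc (els p)
  els (outside ∷ p) = map suc (els p)

  ∣els∣ : ∀ {n} (p : Subset n) → length (els p) ≡ ∣ p ∣
  ∣els∣ []            = refl
  ∣els∣ (inside  ∷ p) = cong suc (trans (length-map suc (els p)) (∣els∣ p))
  ∣els∣ (outside ∷ p) = trans (length-map suc (els p)) (∣els∣ p)

  ∈-els⁺ : ∀ {n} {p : Subset n} {x} → x ∈ˢ p → x ∈ els p
  ∈-els⁺ {p = inside  ∷ p} here      = here refl
  ∈-els⁺ {p = inside  ∷ p} (there m) = there (∈-map⁺ suc (∈-els⁺ m))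
  ∈-els⁺ {p = outside ∷ p} (there m) = ∈-map⁺ suc (∈-els⁺ m)

  ∈-els⁻ : ∀ {n} (p : Subset n) {x} → x ∈ els p → x ∈ˢ p
  ∈-els⁻ (inside  ∷ p) (here refl) = here
  ∈-els⁻ (inside  ∷ p) (there m) with ∈-map⁻ suc m
  ... | y , i , refl = there (∈-els⁻ p i)
  ∈-els⁻ (outside ∷ p) m with ∈-map⁻ suc m
  ... | y , i , refl = there (∈-els⁻ p i)

  els-unique : ∀ {n} (p : Subset n) → Unique (els p)
  els-unique []            = []
  els-unique (inside  ∷ p) = All.tabulate (λ m e → 0≢suc (∈-map⁻ suc m) e) ∷ Uniqueₚ.map⁺ (λ { refl → refl }) (els-unique p)
    where
    0≢suc : ∀ {x} → (∃ λ y → y ∈ els p × x ≡ suc y) → Fin.zero ≢ x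
    0≢suc (y , _ , refl) ()
  els-unique (outside ∷ p) = Uniqueₚ.map⁺ (λ { refl → refl }) (els-unique p)

  ∑-two : {A : Set} {xs : List A} (f : A → ℕ) {a b : A} → a ≢ b → a ∈ xs → b ∈ xs → f a + f b ≤ ∑ xs f
  ∑-two {xs = xs} f {a} {b} a≢b ma mb with ∈⇒↭ ma
  ... | ys , p with ∈-resp-↭ p mb
  ...   | here e  = contradiction (sym e) a≢b
  ...   | there m = ≤-trans (+-monoʳ-≤ (f a) (term≤∑ f m)) (≤-reflexive (sym (∑-↭ f p)))

  module Degrees {n : ℕ} (H : ThreeGraph n) (φ : Colouring n) where

    G : Coloured n
    G = fromGraph H φ

    open Links G using (E; col; colourCount)

    same : Fin n → Subset n → Fin n → Fin n → ℕ
    same v e a b = ⟦ ⌊ triple v a b ≟ˢ e ⌋ ⟧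

    same≡1 : ∀ v e a b → triple v a b ≡ e → 1 ≤ same v e a b
    same≡1 v e a b h = ≤-reflexive (sym (⟦T⟧ {⌊ triple v a b ≟ˢ e ⌋} (fromWitness h)))

    others : ∀ v e → v ∈ˢ e → ∣ e ∣ ≡ 3 → ∃ λ (a : Fin n) → ∃ λ (b : Fin n) → a ≢ b × triple v a b ≡ e
    others v e m h with ∈⇒↭ (∈-els⁺ m)
    ... | zs , p = go zs p (suc-injective (trans (sym (↭-length p)) (trans (∣els∣ e) h)))
      where
      go : ∀ zs → els e ↭ v ∷ zs → length zs ≡ 2 → ∃ λ (a : Fin n) → ∃ λ (b : Fin n) → a ≢ b × triple v a b ≡ e
      go (a ∷ b ∷ []) p _ = a , b , All.head (AllPairs.head (AllPairs.tail (Unique-resp-↭ p (els-unique e)))) , ⊆-antisym to from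
        where
        to : ∀ {x} → x ∈ˢ triple v a b → x ∈ˢ e
        to i with ∈-triple⁻ v a b i
        ... | inj₁ refl        = m
        ... | inj₂ (inj₁ refl) = ∈-els⁻ e (∈-resp-↭ (↭-sym p) (there (here refl)))
        ... | inj₂ (inj₂ refl) = ∈-els⁻ e (∈-resp-↭ (↭-sym p) (there (there (here refl))))
        from : ∀ {x} → x ∈ˢ e → x ∈ˢ triple v a b
        from i with ∈-resp-↭ p (∈-els⁺ i)
        ... | here refl                 = ∈-triple₁ v a b
        ... | there (here refl)         = ∈-triple₂ v a b
        ... | there (there (here refl)) = ∈-triple₃ v a b

    pairs≥2 : ∀ v e → v ∈ˢ e → ∣ e ∣ ≡ 3 → 2 ≤ ∑ (allFin n) (λ a → ∑ (allFin n) (λ b → same v e a b))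
    pairs≥2 v e m h with others v e m h
    ... | a , b , a≢b , eq = ≤-trans (+-mono-≤ (≤-trans (same≡1 v e a b eq) (term≤∑ (same v e a) (∈-allFin b)))
          (≤-trans (same≡1 v e b a (trans (triple-swap v b a) eq)) (term≤∑ (same v e b) (∈-allFin a))))
        (∑-two (λ a → ∑ (allFin n) (same v e a)) a≢b (∈-allFin a) (∈-allFin b))

    ∑-same≤ : ∀ t (L : List (Subset n)) → Unique L → ∑ L (λ e → ⟦ ⌊ t ≟ˢ e ⌋ ⟧) ≤ ⟦ ⌊ t ∈ᵉ? L ⌋ ⟧
    ∑-same≤ t [] _ = z≤n
    ∑-same≤ t (e ∷ L) (h ∷ u) = go (t ≟ˢ e)
      where
      go : (d : Dec (t ≡ e)) → ⟦ ⌊ d ⌋ ⟧ + ∑ L (λ e → ⟦ ⌊ t ≟ˢ e ⌋ ⟧) ≤ ⟦ ⌊ t ∈ᵉ? (e ∷ L) ⌋ ⟧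
      go (yes refl) = ≤-trans (s≤s (≤-trans (∑-mono-∈ L (λ m → absent m)) (≤-reflexive (trans (∑-const L 0) (*-zeroʳ (length L))))))
                        (≤-reflexive (sym (⟦T⟧ {⌊ t ∈ᵉ? (t ∷ L) ⌋} (fromWitness {a? = t ∈ᵉ? (t ∷ L)} (here refl)))))
        where
        absent : ∀ {e'} → e' ∈ L → ⟦ ⌊ t ≟ˢ e' ⌋ ⟧ ≤ 0
        absent {e'} m with t ≟ˢ e'
        ... | yes refl = ⊥-elim (∉-head h m)
        ... | no _     = z≤n
      go (no ¬p) = ≤-trans (∑-same≤ t L u) (⟦⟧-⇒ (λ w → fromWitness {a? = t ∈ᵉ? (e ∷ L)} (there (toWitness {a? = t ∈ᵉ? L} w))))

    -- An edge at v gives two ordered pairs, which cancels the factor 1/2 in the degree condition.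
    degree-lower : ∀ v → 2 * deg H v ≤ ∑ (allFin n) (λ a → ∑ (allFin n) (λ b → ⟦ E v a b ⟧))
    degree-lower v = begin
      2 * length F                                                       ≡⟨ *-comm 2 (length F) ⟩
      length F * 2                                                       ≡⟨ sym (∑-const F 2) ⟩
      ∑ F (λ _ → 2)                                                      ≤⟨ ∑-mono-∈ F (λ {e} m → let i = ∈-filter⁻ (v ∈?_) {xs = edges H} m in pairs≥2 v e (proj₂ i) (All.lookup (uniform H) (proj₁ i))) ⟩
      ∑ F (λ e → ∑ (allFin n) (λ a → ∑ (allFin n) (λ b → same v e a b))) ≡⟨ trans (∑-swap F (allFin n) _) (∑-cong (allFin n) (λ a → ∑-swap F (allFin n) _)) ⟩
      ∑ (allFin n) (λ a → ∑ (allFin n) (λ b → ∑ F (λ e → same v e a b))) ≤⟨ ∑-mono (allFin n) (λ a → ∑-mono (allFin n) (λ b → ≤-trans (∑-same≤ (triple v a b) F (Uniqueₚ.filter⁺ (v ∈?_) (unique H)))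
                                                                             (⟦⟧-⇒ (λ w → fromWitness {a? = triple v a b ∈ᵉ? edges H} (proj₁ (∈-filter⁻ (v ∈?_) {xs = edges H} (toWitness {a? = triple v a b ∈ᵉ? F} w))))))) ⟩
      ∑ (allFin n) (λ a → ∑ (allFin n) (λ b → ⟦ E v a b ⟧))              ∎
      where
      open ≤-Reasoning
      F = filter (v ∈?_) (edges H)

    occurs : Subset n → Fin n → ℕ
    occurs e a = ∑ (els e) (λ x → ⟦ ⌊ a ≟ᶠ x ⌋ ⟧)

    occurs≥1 : ∀ e a → a ∈ˢ e → 1 ≤ occurs e a
    occurs≥1 e a m = ≤-trans (≤-reflexive (sym (⟦T⟧ {⌊ a ≟ᶠ a ⌋} (fromWitness refl)))) (term≤∑ (λ x → ⟦ ⌊ a ≟ᶠ x ⌋ ⟧) (∈-els⁺ m))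

    ∑-occurs : ∀ e → ∑ (allFin n) (occurs e) ≤ ∣ e ∣
    ∑-occurs e = ≤-trans (≤-reflexive (∑-swap (allFin n) (els e) _)) (≤-trans (∑-≤const (els e) (λ x → ∑-unique≤1 id id x (allFin n) (allFin⁺ n)))
      (≤-reflexive (trans (*-identityʳ (length (els e))) (∣els∣ e))))

    same≤ : ∀ v e a b → same v e a b ≤ occurs e a * occurs e b
    same≤ v e a b with triple v a b ≟ˢ e
    ... | no _     = z≤n
    ... | yes refl = *-mono-≤ {1} {_} {1} (occurs≥1 e a (∈-triple₂ v a b)) (occurs≥1 e b (∈-triple₃ v a b))

    -- Both entries lie in e, which has three vertices. The crude 3 · 3 only affects the constant c.
    pairs≤9 : ∀ v e → ∣ e ∣ ≡ 3 → ∑ (allFin n) (λ a → ∑ (allFin n) (λ b → same v e a b)) ≤ 9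
    pairs≤9 v e h = begin
      ∑ (allFin n) (λ a → ∑ (allFin n) (λ b → same v e a b))             ≤⟨ ∑-mono (allFin n) (λ a → ∑-mono (allFin n) (λ b → same≤ v e a b)) ⟩
      ∑ (allFin n) (λ a → ∑ (allFin n) (λ b → occurs e a * occurs e b))  ≡⟨ ∑-cong (allFin n) (λ a → ∑-* (allFin n) (occurs e a) (occurs e)) ⟩
      ∑ (allFin n) (λ a → occurs e a * ∑ (allFin n) (occurs e))          ≡⟨ ∑-*ʳ (allFin n) (∑ (allFin n) (occurs e)) (occurs e) ⟩
      ∑ (allFin n) (occurs e) * ∑ (allFin n) (occurs e)                  ≤⟨ *-mono-≤ (≤-trans (∑-occurs e) (≤-reflexive h)) (≤-trans (∑-occurs e) (≤-reflexive h)) ⟩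
      9 ∎
      where open ≤-Reasoning

    degree-upper : ∀ v κ → ∑ (allFin n) (λ a → ∑ (allFin n) (λ b → colourCount v κ a b)) ≤ degCol H φ κ v * 9
    degree-upper v κ = begin
      ∑ (allFin n) (λ a → ∑ (allFin n) (λ b → colourCount v κ a b))      ≤⟨ ∑-mono (allFin n) (λ a → ∑-mono (allFin n) (λ b → hit a b (E v a b ∧ (col v a b ≡ᵇ κ)) refl)) ⟩
      ∑ (allFin n) (λ a → ∑ (allFin n) (λ b → ∑ F (λ e → same v e a b))) ≡⟨ sym (trans (∑-swap F (allFin n) _) (∑-cong (allFin n) (λ a → ∑-swap F (allFin n) _))) ⟩
      ∑ F (λ e → ∑ (allFin n) (λ a → ∑ (allFin n) (λ b → same v e a b))) ≤⟨ ∑-mono-∈ F (λ {e} m → pairs≤9 v e (All.lookup (uniform H) (proj₁ (∈-filter⁻ P? {xs = edges H} m)))) ⟩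
      ∑ F (λ _ → 9)                                                      ≡⟨ ∑-const F 9 ⟩
      length F * 9                                                       ∎
      where
      open ≤-Reasoning
      P? : ∀ e → Dec (v ∈ˢ e × φ e ≡ κ)
      P? e = (v ∈? e) ×-dec (φ e ≟ⁿ κ)
      F = filter P? (edges H)
      hit : ∀ a b c → c ≡ (E v a b ∧ (col v a b ≡ᵇ κ)) → ⟦ c ⟧ ≤ ∑ F (λ e → same v e a b)
      hit a b false _ = z≤n
      hit a b true eq with Equivalence.to (T-∧ {E v a b}) (subst T eq tt)
      ... | h₁ , h₂ = ≤-trans (same≡1 v (triple v a b) a b refl) (term≤∑ (λ e → same v e a b)
            (∈-filter⁺ P? (toWitness {a? = triple v a b ∈ᵉ? edges H} h₁) (∈-triple₁ v a b , ≡ᵇ⇒≡ (col v a b) κ h₂)))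

  -- Numerical inequalities and the choice of constants.

  u≤2^u : ∀ u → u ≤ 2 ^ u
  u≤2^u zero    = z≤n
  u≤2^u (suc u) = ≤-trans (+-mono-≤ (>-nonZero⁻¹ (2 ^ u) {{m^n≢0 2 u}}) (u≤2^u u)) (+-monoʳ-≤ (2 ^ u) (m≤m+n (2 ^ u) 0))

  -- With u = ⌊w/12⌋: n is at most 24Au ≤ u² ≤ 4^u, and the sixth power of 4^u is 2^(12u) ≤ 2^w. The
  -- exponent 6 is that of connection requests, which are six-tuples.
  power-bound : ∀ n A w → 0 < A → n ≤ A * w → 24 * A * 12 ≤ w → n ^ 6 ≤ 2 ^ w
  power-bound n A w 0<A n≤ h = begin
    n ^ 6                         ≤⟨ ^-monoˡ-≤ 6 (≤-trans n≤ (≤-trans (*-monoʳ-≤ A w≤) (≤-reflexive (lem A u)))) ⟩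
    (24 * A * u) ^ 6              ≤⟨ ^-monoˡ-≤ 6 (*-mono-≤ (≤-trans u≥ (u≤2^u u)) (u≤2^u u)) ⟩
    (2 ^ u * 2 ^ u) ^ 6           ≡⟨ cong (_^ 6) (sym (^-distribˡ-+-* 2 u u)) ⟩
    (2 ^ (u + u)) ^ 6             ≡⟨ ^-*-assoc 2 (u + u) 6 ⟩
    2 ^ ((u + u) * 6)             ≤⟨ ^-monoʳ-≤ 2 (≤-trans (≤-reflexive (lem₂ u)) (m/n*n≤m w 12)) ⟩
    2 ^ w                         ∎
    where
    open ≤-Reasoning
    u = w / 12
    lem : ∀ a u → a * (24 * u) ≡ 24 * a * u
    lem = solve-∀
    lem₂ : ∀ u → (u + u) * 6 ≡ u * 12
    lem₂ = solve-∀
    lem₄ : ∀ u → 12 * u + u * 12 ≡ 24 * u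
    lem₄ = solve-∀
    u≥ : 24 * A ≤ u
    u≥ = ≤-trans (≤-reflexive (sym (m*n/n≡m (24 * A) 12))) (/-monoˡ-≤ 12 h)
    1≤u : 1 ≤ u
    1≤u = ≤-trans (≤-trans 0<A (m≤m+n A (23 * A))) u≥
    w≤ : w ≤ 24 * u
    w≤ = begin
      w                       ≡⟨ m≡m%n+[m/n]*n w 12 ⟩
      w % 12 + u * 12         ≤⟨ +-monoˡ-≤ (u * 12) (<⇒≤ (m%n<n w 12)) ⟩
      12 + u * 12             ≤⟨ +-monoˡ-≤ (u * 12) (*-monoʳ-≤ 12 1≤u) ⟩
      12 * u + u * 12         ≡⟨ lem₄ u ⟩
      24 * u                  ∎

  -- With t = ms and k = mq one has 4t = k + m. Multiplied by 16g, the terms in gk² cancel as 7 + 1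
  -- = 8, the exact threshold. The excess 4k² must outweigh `P`, that is 6gkm + 32g(k + m): one half
  -- of it pays for each summand, by 3g ≤ q and m ≥ 32.
  eg-arith : ∀ g m s q e → 0 < g → 0 < m → suc q ≡ 4 * s → 3 * g ≤ q → 32 ≤ m →
    (7 * g + 4) * (m * q * (m * q)) ≤ 16 * g * e → 2 * (m * s * (m * q)) + 8 * (m * s) < e + m * s * (m * s)
  eg-arith g m s q e 0<g 0<m q≡ 3g≤q 32≤m h = *-cancelˡ-< (16 * g) (2 * (t * k) + 8 * t) (e + t * t) (+-cancelʳ-< Q (16 * g * (2 * (t * k) + 8 * t)) (16 * g * (e + t * t)) (begin-strict
    16 * g * (2 * (t * k) + 8 * t) + Q               ≡⟨ cong (_+ Q) (lem₁ g m s q) ⟩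
    g * (m * (4 * s * (8 * (m * q) + 32))) + Q       ≡⟨ cong (λ S → g * (m * (S * (8 * (m * q) + 32))) + Q) (sym q≡) ⟩
    g * (m * (suc q * (8 * (m * q) + 32))) + Q       ≡⟨ lem₂ g m q ⟩
    (7 * g + 4) * (k * k) + g * (m * suc q * (m * suc q)) + P ≡⟨ cong (λ S → (7 * g + 4) * (k * k) + g * (m * S * (m * S)) + P) q≡ ⟩
    (7 * g + 4) * (k * k) + g * (m * (4 * s) * (m * (4 * s))) + P ≡⟨ cong (λ z → (7 * g + 4) * (k * k) + z + P) (lem₃ g m s) ⟩
    (7 * g + 4) * (k * k) + 16 * g * (t * t) + P     ≤⟨ +-monoˡ-≤ P (+-monoˡ-≤ (16 * g * (t * t)) h) ⟩
    16 * g * e + 16 * g * (t * t) + P                ≡⟨ cong (_+ P) (sym (*-distribˡ-+ (16 * g) e (t * t))) ⟩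
    16 * g * (e + t * t) + P                         <⟨ +-monoʳ-< (16 * g * (e + t * t)) P<Q ⟩
    16 * g * (e + t * t) + Q                         ∎))
    where
    open ≤-Reasoning
    t = m * s
    k = m * q
    P = 6 * g * (m * (m * q)) + 32 * (g * (m * suc q))
    Q = 4 * (m * (m * (q * q))) + g * (m * m)
    lem₁ : ∀ g m s q → 16 * g * (2 * (m * s * (m * q)) + 8 * (m * s)) ≡ g * (m * (4 * s * (8 * (m * q) + 32)))
    lem₁ = solve-∀
    lem₂ : ∀ g m q → g * (m * ((1 + q) * (8 * (m * q) + 32))) + (4 * (m * (m * (q * q))) + g * (m * m))
         ≡ (7 * g + 4) * (m * q * (m * q)) + g * (m * (1 + q) * (m * (1 + q))) + (6 * g * (m * (m * q)) + 32 * (g * (m * (1 + q))))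
    lem₂ = solve-∀
    lem₃ : ∀ g m s → g * (m * (4 * s) * (m * (4 * s))) ≡ 16 * g * (m * s * (m * s))
    lem₃ = solve-∀
    lem₄ : ∀ g m q → 6 * g * (m * (m * q)) ≡ 2 * (m * (m * (3 * g * q)))
    lem₄ = solve-∀
    lem₅ : ∀ m q → 32 * (q * (m * (q + q))) ≡ 2 * (m * (32 * (q * q)))
    lem₅ = solve-∀
    lem₆ : ∀ x → 2 * x + 2 * x ≡ 4 * x
    lem₆ = solve-∀
    g≤q : g ≤ q
    g≤q = ≤-trans (m≤m+n g (g + (g + 0))) 3g≤q
    P<Q : P < Q
    P<Q = begin-strict
      P                                                             ≤⟨ +-mono-≤ (≤-trans (≤-reflexive (lem₄ g m q)) (*-monoʳ-≤ 2 (*-monoʳ-≤ m (*-monoʳ-≤ m (*-monoˡ-≤ q 3g≤q)))))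
                                                                         (≤-trans (*-monoʳ-≤ 32 (*-mono-≤ g≤q (*-monoʳ-≤ m (+-monoˡ-≤ q (≤-trans 0<g g≤q)))))
                                                                           (≤-trans (≤-reflexive (lem₅ m q)) (*-monoʳ-≤ 2 (*-monoʳ-≤ m (*-monoˡ-≤ (q * q) 32≤m))))) ⟩
      2 * (m * (m * (q * q))) + 2 * (m * (m * (q * q)))             ≡⟨ lem₆ (m * (m * (q * q))) ⟩
      4 * (m * (m * (q * q)))                                       <⟨ m<m+n (4 * (m * (m * (q * q)))) (*-mono-< 0<g (*-mono-< 0<m 0<m)) ⟩
      Q                                                             ∎

  scale-up : ∀ d k j Y Z w ξ n → ξ ≤ Y * w → 0 < w → d * (k * (1 * (Y + j * 1))) ≤ Z → Z * w ≤ n → d * (k * (1 * (ξ + j * 1))) ≤ n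
  scale-up d k j Y Z w ξ n hξ 0<w hZ hn = begin
    d * (k * (1 * (ξ + j * 1)))            ≤⟨ *-monoʳ-≤ d (*-monoʳ-≤ k (*-monoʳ-≤ 1 (+-mono-≤ hξ (≤-trans (≤-reflexive (sym (*-identityʳ (j * 1)))) (*-monoʳ-≤ (j * 1) 0<w))))) ⟩
    d * (k * (1 * (Y * w + j * 1 * w)))    ≡⟨ lem d k j Y w ⟩
    d * (k * (1 * (Y + j * 1))) * w        ≤⟨ *-monoˡ-≤ w hZ ⟩
    Z * w                                  ≤⟨ hn ⟩
    n                                      ∎
    where
    open ≤-Reasoning
    lem : ∀ d k j y w → d * (k * (1 * (y * w + j * 1 * w))) ≡ d * (k * (1 * (y + j * 1))) * w
    lem = solve-∀

  -- The order of choice: `Z`, the ratio n/w, depends on g only; the tile length `suc p` exceeds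
  -- 2`Z`; then come the blow-up constants `D₀` and `D`, the sparseness `K` among blocks, and `C`
  -- among vertices. `B` is the number of blocks that the weaving requires.
  record Constants (g : ℕ) : Set where
    field
      m s p K D D₀ C B Z Y tA tC : ℕ
      0<g   : 0 < g
      0<s   : 0 < s
      0<m   : 0 < m
      hm    : 7 * g + 12 ≤ 4 * m
      eg    : ∀ e → (7 * g + 4) * (m * suc p * (m * suc p)) ≤ 16 * g * e → 2 * (m * s * (m * suc p)) + 8 * (m * s) < e + m * s * (m * s)
      5t≤2k : 5 * (m * s) ≤ 2 * (m * suc p)
      t≤k   : m * s ≤ m * suc p
      q≡    : suc (suc p) ≡ 4 * s
      0<K   : 0 < K
      D₀≡   : D₀ ≡ 4 * g * (m * suc p * (m * suc p)) ^ suc (m * s)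
      D≡    : D ≡ blowupD (suc m) (suc (m * s) * (2 * s)) D₀
      hK    : 4 * D * (suc (m * s) * (4 * s)) ≤ K
      B≡    : B ≡ 4 * D * (suc m * (suc (m * s) * (2 * s)) * (suc (suc p) * (0 + suc m * (suc (m * s) * (2 * s)) * suc (suc p))))
      hC    : K * (2 * suc p * (2 * suc p)) ≤ C
      0<C   : 0 < C
      hAC   : 4 * absorberD * 62 ≤ C
      hCC   : 4 * connectorD * 8 ≤ C
      tC≡   : 2 * (2 * connectorD) * 2 ≡ tC
      tA≡   : 2 * (2 * absorberD) * (tC * 5 + 2) ≡ tA
      Y≡    : tA * 33 + tA * 5 + tC * 5 ≡ Y
      hZ₁   : 4 * absorberD * (33 * (1 * (Y + 33 * 1))) ≤ Z
      hZ₂   : 4 * connectorD * (5 * (1 * (Y + 5 * 1))) ≤ Z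
      hZ₃   : 8 * g * (Y + 1) ≤ Z
      0<Z   : 0 < Z
      hZq   : 2 * Z ≤ suc p

  module Core {g : ℕ} (R : Constants g) {n₁ : ℕ} (H : ThreeGraph (suc n₁)) (φ : Colouring (suc n₁)) (ℓ w : ℕ)
    (n≡ : suc n₁ ≡ 2 * ℓ) (Zw≤n : Constants.Z R * w ≤ suc n₁) (n<Zw : suc n₁ < Constants.Z R * suc w)
    (q≤w : suc (Constants.p R) ≤ w) (hw : 24 * (2 * Constants.Z R) * 12 ≤ w)
    (hB : 2 * suc (Constants.p R) * Constants.B R ≤ suc n₁)
    (degree : ∀ v → (7 * g + 16) * (suc n₁ * suc n₁) ≤ 16 * g * (2 * deg H v))
    (colours : ∀ κ v → Constants.C R * (degCol H φ κ v * 9) ≤ suc n₁ * suc n₁) where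

    open Constants R

    n : ℕ
    n = suc n₁

    G : Coloured n
    G = fromGraph H φ

    0<w : 0 < w
    0<w = ≤-trans (s≤s z≤n) q≤w

    degree′ : ∀ v → (7 * g + 16) * (n * n) ≤ 16 * g * ∑ (allFin n) (λ a → ∑ (allFin n) (λ b → ⟦ Coloured.E G v a b ⟧))
    degree′ v = ≤-trans (degree v) (*-monoʳ-≤ (16 * g) (Degrees.degree-lower H φ v))

    degree₇ : ∀ v → 7 * (n * n) ≤ 16 * ∑ (allFin n) (λ a → ∑ (allFin n) (λ b → ⟦ Coloured.E G v a b ⟧))
    degree₇ v = cancel g (n * n) (∑ (allFin n) (λ a → ∑ (allFin n) (λ b → ⟦ Coloured.E G v a b ⟧))) 0<g (degree′ v)
      where
      cancel : ∀ g x s → 0 < g → (7 * g + 16) * x ≤ 16 * g * s → 7 * x ≤ 16 * s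
      cancel g x s pos h = *-cancelˡ-≤ g {{>-nonZero pos}} (≤-trans (≤-trans (m≤m+n (g * (7 * x)) (16 * x)) (≤-reflexive (lem₁ g x))) (≤-trans h (≤-reflexive (lem₂ g s))))
        where
        lem₁ : ∀ g x → g * (7 * x) + 16 * x ≡ (7 * g + 16) * x
        lem₁ = solve-∀
        lem₂ : ∀ g s → 16 * g * s ≡ g * (16 * s)
        lem₂ = solve-∀

    sparse : ∀ v κ → C * ∑ (allFin n) (λ a → ∑ (allFin n) (λ b → Links.colourCount G v κ a b)) ≤ n * n
    sparse v κ = ≤-trans (*-monoʳ-≤ C (Degrees.degree-upper H φ v κ)) (colours κ v)

    TC TA ξ : ℕ
    -- One w of guaranteed services and one w lost to the logarithm of the number of requests.
    TC = 2 * (2 * connectorD) * (w + w)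
    TA = 2 * (2 * absorberD) * (TC * 5 + w + w)
    ξ  = TA * 33 + TA * 5 + TC * 5

    ξ≤ : ξ ≤ Y * w
    ξ≤ = ≤-reflexive (begin
      TA * 33 + TA * 5 + TC * 5                      ≡⟨ cong₂ (λ a c → a * 33 + a * 5 + c * 5) TA≡ TC≡ ⟩
      tA * w * 33 + tA * w * 5 + tC * w * 5          ≡⟨ lem₃ tA tC w ⟩
      (tA * 33 + tA * 5 + tC * 5) * w                ≡⟨ cong (_* w) Y≡ ⟩
      Y * w                                          ∎)
      where
      open ≡-Reasoning
      lem₁ : ∀ x w → x * (w + w) ≡ x * 2 * w
      lem₁ = solve-∀
      lem₂ : ∀ x c w → x * (c * w * 5 + w + w) ≡ x * (c * 5 + 2) * w
      lem₂ = solve-∀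
      lem₃ : ∀ a c w → a * w * 33 + a * w * 5 + c * w * 5 ≡ (a * 33 + a * 5 + c * 5) * w
      lem₃ = solve-∀
      TC≡ : TC ≡ tC * w
      TC≡ = trans (lem₁ (2 * (2 * connectorD)) w) (cong (_* w) tC≡)
      TA≡ : TA ≡ tA * w
      TA≡ = trans (cong (λ z → 2 * (2 * absorberD) * (z * 5 + w + w)) TC≡) (trans (lem₂ (2 * (2 * absorberD)) tC w) (cong (_* w) tA≡))

    n<2Zw : n < 2 * Z * w
    n<2Zw = <-≤-trans n<Zw (≤-trans (*-monoʳ-≤ Z (+-mono-≤ 0<w ≤-refl)) (≤-reflexive (lem Z w)))
      where
      lem : ∀ z w → z * (w + w) ≡ 2 * z * w
      lem = solve-∀

    n<qw : n < suc p * w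
    -- Tiles of length at least 2`Z` are fewer than w, so the supply of connectors, chosen before
    -- the tiling, suffices.
    n<qw = <-≤-trans n<2Zw (*-monoˡ-≤ w hZq)

    n^6≤ : n ^ 6 ≤ 2 ^ w
    n^6≤ = power-bound n (2 * Z) w (≤-trans 0<Z (m≤m+n Z (Z + 0))) (<⇒≤ n<2Zw) hw

    n^2≤ : n ^ 2 ≤ 2 ^ w
    n^2≤ = ≤-trans (^-monoʳ-≤ n {2} {6} (s≤s (s≤s z≤n))) n^6≤

    pack : ∀ X → Unique X → length X ≤ ξ → ∃ λ (Ts : List (Vec (Fin n) (suc p))) → All (λ t → Tiles.IsTile G (suc p) (Vec.toList t)) Ts ×
       ∃ λ R → X ++ (cells Ts ++ R) ↭ allFin n × suc p * length R < n
    pack X uX hX = unpack (Tiling.packing G g m s p 0<g 0<s 0<m hm eg 5t≤2k t≤k q≡ K D D₀ C B 0<K D₀≡ D≡ hK B≡ hC degree′ sparse X hX′ hB (s≤s z≤n) uX)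
      where
      hX′ : 8 * g * (length X + suc p) ≤ n
      hX′ = begin
        8 * g * (length X + suc p)   ≤⟨ *-monoʳ-≤ (8 * g) (+-mono-≤ (≤-trans hX ξ≤) q≤w) ⟩
        8 * g * (Y * w + w)          ≡⟨ lem (8 * g) Y w ⟩
        8 * g * (Y + 1) * w          ≤⟨ *-monoˡ-≤ w hZ₃ ⟩
        Z * w                        ≤⟨ Zw≤n ⟩
        n ∎
        where
        open ≤-Reasoning
        lem : ∀ x y w → x * (y * w + w) ≡ x * (y + 1) * w
        lem = solve-∀
      unpack : Rebuild.Packing G p X → ∃ λ (Ts : List (Vec (Fin n) (suc p))) → All (λ t → Tiles.IsTile G (suc p) (Vec.toList t)) Ts ×
               ∃ λ R → X ++ (cells Ts ++ R) ↭ allFin n × suc p * length R < n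
      unpack P = P.Ts , Rebuild.Tiled.areTiles P.tiled , P.R , P.perm , P.small
        where module P = Rebuild.Packing P

    hamiltonCycle : Tiles.HamiltonCycle G
    hamiltonCycle = Shadows.Gadgets.Assembly.hamilton G (s≤s z≤n) degree₇ C 0<C sparse w ξ TA TC (suc p) ℓ 0<w n^2≤ n^6≤ refl refl ≤-refl
      (scale-up (4 * absorberD) 33 33 Y Z w ξ n ξ≤ 0<w hZ₁ Zw≤n) hAC (scale-up (4 * connectorD) 5 5 Y Z w ξ n ξ≤ 0<w hZ₂ Zw≤n) hCC n≡ n<qw pack

    finish : ∀ ℓ → n ≡ 2 * ℓ → Tiles.HamiltonCycle G → HasPCLooseHamCycle n H φ
    finish (suc ℓ′) e h = CloseCycle.result H φ ℓ′ (trans e (sym (db≡2* (suc ℓ′)))) base cycle closed spans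
      where open Tiles.HamiltonCycle h

    theorem : HasPCLooseHamCycle n H φ
    theorem = finish ℓ n≡ hamiltonCycle

  -- m = 32 + 2g satisfies both lower bounds on m, and s = 1 + g + Z makes q = 4s - 1 exceed 3g and
  -- 2Z at once.
  constants : ∀ g → 0 < g → Constants g
  constants g 0<g = choose (32 + 2 * g) (1 + (g + Z)) (2 + 4 * (g + Z)) (m≤m+n 32 (2 * g)) (s≤s z≤n)
      (≤-trans (m≤m+n (7 * g + 12) (116 + g)) (≤-reflexive (lem₁ g))) (lem₄ (g + Z))
      (≤-trans (m≤m+n (3 * g) (3 + g + 4 * Z)) (≤-reflexive (lem₆ g Z))) (≤-trans (m≤m+n (2 * Z) (3 + 4 * g + 2 * Z)) (≤-reflexive (lem₅ g Z)))
    where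
    tC tA Y Z₁ Z₂ Z₃ Z : ℕ
    tC = 2 * (2 * connectorD) * 2
    tA = 2 * (2 * absorberD) * (tC * 5 + 2)
    Y  = tA * 33 + tA * 5 + tC * 5
    Z₁ = 4 * absorberD * (33 * (1 * (Y + 33 * 1)))
    Z₂ = 4 * connectorD * (5 * (1 * (Y + 5 * 1)))
    Z₃ = 8 * g * (Y + 1)
    Z  = Z₁ + (Z₂ + Z₃)
    lem₁ : ∀ g → 7 * g + 12 + (116 + g) ≡ 4 * (32 + 2 * g)
    lem₁ = solve-∀
    lem₄ : ∀ x → 4 + 4 * x ≡ 4 * (1 + x)
    lem₄ = solve-∀
    lem₅ : ∀ g z → 2 * z + (3 + 4 * g + 2 * z) ≡ 3 + 4 * (g + z)
    lem₅ = solve-∀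
    lem₆ : ∀ g z → 3 * g + (3 + g + 4 * z) ≡ 3 + 4 * (g + z)
    lem₆ = solve-∀
    choose : ∀ m s p → 32 ≤ m → 0 < s → 7 * g + 12 ≤ 4 * m → suc (suc p) ≡ 4 * s → 3 * g ≤ suc p → 2 * Z ≤ suc p → Constants g
    choose m s p 32≤m 0<s hm q≡ 3g≤q hZq = record
      { m = m ; s = s ; p = p ; K = K ; D = D ; D₀ = D₀ ; C = C ; B = B ; Z = Z ; Y = Y ; tA = tA ; tC = tC
      ; 0<g = 0<g ; 0<s = 0<s ; 0<m = 0<m ; hm = hm ; eg = λ e → eg-arith g m s (suc p) e 0<g 0<m q≡ 3g≤q 32≤m
      ; 5t≤2k = ≤-trans (≤-reflexive (lem₂ m s)) (≤-trans (*-monoʳ-≤ m 5s≤2q) (≤-reflexive (lem₃ m (suc p))))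
      ; t≤k = *-monoʳ-≤ m (*-cancelˡ-≤ 2 (≤-trans (*-monoˡ-≤ s (m≤m+n 2 3)) 5s≤2q))
      ; q≡ = q≡ ; 0<K = s≤s z≤n ; D₀≡ = refl ; D≡ = refl ; hK = n≤1+n (4 * D * (suc (m * s) * (4 * s))) ; B≡ = refl
      ; hC = ≤-trans (m≤m+n C₁ (C₂ + C₃)) (n≤1+n (C₁ + (C₂ + C₃))) ; 0<C = s≤s z≤n
      ; hAC = ≤-trans (≤-trans (m≤m+n C₂ C₃) (m≤n+m (C₂ + C₃) C₁)) (n≤1+n (C₁ + (C₂ + C₃)))
      ; hCC = ≤-trans (≤-trans (m≤n+m C₃ C₂) (m≤n+m (C₂ + C₃) C₁)) (n≤1+n (C₁ + (C₂ + C₃)))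
      ; tC≡ = refl ; tA≡ = refl ; Y≡ = refl
      ; hZ₁ = m≤m+n Z₁ (Z₂ + Z₃) ; hZ₂ = ≤-trans (m≤m+n Z₂ Z₃) (m≤n+m (Z₂ + Z₃) Z₁) ; hZ₃ = Z₃≤Z
      ; 0<Z = ≤-trans (0<* {8 * g} {Y + 1} (0<* {8} (s≤s z≤n) 0<g) (m≤n+m 1 Y)) Z₃≤Z
      ; hZq = hZq }
      where
      D₀ D K B C₁ C₂ C₃ C : ℕ
      D₀ = 4 * g * (m * suc p * (m * suc p)) ^ suc (m * s)
      D  = blowupD (suc m) (suc (m * s) * (2 * s)) D₀
      K  = suc (4 * D * (suc (m * s) * (4 * s)))
      B  = 4 * D * (suc m * (suc (m * s) * (2 * s)) * (suc (suc p) * (0 + suc m * (suc (m * s) * (2 * s)) * suc (suc p))))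
      C₁ = K * (2 * suc p * (2 * suc p))
      C₂ = 4 * absorberD * 62
      C₃ = 4 * connectorD * 8
      C  = suc (C₁ + (C₂ + C₃))
      0<m : 0 < m
      0<m = ≤-trans (s≤s z≤n) 32≤m
      Z₃≤Z : Z₃ ≤ Z
      Z₃≤Z = ≤-trans (m≤n+m Z₃ Z₂) (m≤n+m (Z₂ + Z₃) Z₁)
      lem₂ : ∀ m s → 5 * (m * s) ≡ m * (5 * s)
      lem₂ = solve-∀
      lem₃ : ∀ m q → m * (2 * q) ≡ 2 * (m * q)
      lem₃ = solve-∀
      5s≤2q : 5 * s ≤ 2 * suc p
      5s≤2q = +-cancelʳ-≤ 2 (5 * s) (2 * suc p) (begin
        5 * s + 2             ≤⟨ +-monoʳ-≤ (5 * s) (≤-trans (n≤1+n 2) (*-monoʳ-≤ 3 0<s)) ⟩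
        5 * s + 3 * s         ≡⟨ lem₇ s ⟩
        2 * (4 * s)           ≡⟨ cong (2 *_) (sym q≡) ⟩
        2 * suc (suc p)       ≡⟨ lem₈ (suc p) ⟩
        2 * suc p + 2         ∎)
        where
        open ≤-Reasoning
        lem₇ : ∀ s → 5 * s + 3 * s ≡ 2 * (4 * s)
        lem₇ = solve-∀
        lem₈ : ∀ q → 2 * (1 + q) ≡ 2 * q + 2
        lem₈ = solve-∀

  -- From rational hypotheses to inequalities of natural numbers.

  import Data.Integer as ℤ
  import Data.Integer.Properties as ℤ
  import Data.Rational as ℚ
  import Data.Rational.Properties as ℚ
  import Data.Rational.Unnormalised as ℚᵘ
  import Data.Rational.Unnormalised.Properties as ℚᵘ
  open import Data.Nat.Divisibility using (_∣_; divides)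

  threshold : ∀ {g} → Constants g → ℕ
  threshold R = suc (Z * (suc p + 24 * (2 * Z) * 12) + 2 * suc p * B)
    where open Constants R

  large-n : ∀ {g} (R : Constants g) n (H : ThreeGraph n) (φ : Colouring n) → 2 ∣ n → threshold R ≤ n →
            (∀ v → (7 * g + 16) * (n * n) ≤ 16 * g * (2 * deg H v)) →
            (∀ κ v → Constants.C R * (degCol H φ κ v * 9) ≤ n * n) → HasPCLooseHamCycle n H φ
  large-n R (suc n₁) H φ (divides ℓ eq) big degree colours =
    Core.theorem R H φ ℓ w (trans eq (*-comm ℓ 2)) Zw≤n n<Zw (≤-trans (m≤m+n (suc p) (24 * (2 * Z) * 12)) W≤w) (≤-trans (m≤n+m (24 * (2 * Z) * 12) (suc p)) W≤w)
      (≤-trans (≤-trans (m≤n+m (2 * suc p * B) (Z * W)) (n≤1+n _)) big) degree colours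
    where
    open Constants R
    instance
      Z≢0 : NonZero Z
      Z≢0 = >-nonZero 0<Z
    -- w is the integer part of n/Z; `W` collects the lower bounds that w must satisfy.
    W w : ℕ
    W = suc p + 24 * (2 * Z) * 12
    w = suc n₁ / Z
    Zw≤n : Z * w ≤ suc n₁
    Zw≤n = ≤-trans (≤-reflexive (*-comm Z w)) (m/n*n≤m (suc n₁) Z)
    n<Zw : suc n₁ < Z * suc w
    n<Zw = begin-strict
      suc n₁                     ≡⟨ m≡m%n+[m/n]*n (suc n₁) Z ⟩
      suc n₁ % Z + w * Z         <⟨ +-monoˡ-< (w * Z) (m%n<n (suc n₁) Z) ⟩
      suc w * Z                  ≡⟨ *-comm (suc w) Z ⟩
      Z * suc w                  ∎
      where open ≤-Reasoning
    W≤w : W ≤ w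
    W≤w = ≤-trans (≤-reflexive (sym (m*n/n≡m W Z))) (/-monoˡ-≤ Z (≤-trans (≤-reflexive (*-comm W Z)) (≤-trans (≤-trans (m≤m+n (Z * W) (2 * suc p * B)) (n≤1+n _)) big)))

  toℚᵘ-nat : ∀ k → ℚ.toℚᵘ (ℤ.+ k ℚ./ 1) ℚᵘ.≃ ℚᵘ.mkℚᵘ (ℤ.+ k) 0
  toℚᵘ-nat k = ℚ.toℚᵘ-fromℚᵘ (ℚᵘ.mkℚᵘ (ℤ.+ k) 0)

  -- A positive γ is at least the reciprocal of its denominator, so the denominator can serve as the
  -- parameter g; a numerator that is not positive contradicts 0 < γ.
  degree-ℕ : ∀ γ N x → ℚ.0ℚ ℚ.< γ → (((ℤ.+ 7 ℚ./ 16) ℚ.+ γ) ℚ.* ((ℤ.+ N ℚ./ 1) ℚ.* ℚ.½)) ℚ.≤ (ℤ.+ x ℚ./ 1) →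
             (7 * (1 + ℚ.ℚ.denominator-1 γ) + 16) * N ≤ 16 * (1 + ℚ.ℚ.denominator-1 γ) * (2 * x)
  degree-ℕ (ℚ.mkℚ (ℤ.+ zero) d c)   N x (ℚ.*<* (ℤ.+<+ ())) h
  degree-ℕ (ℚ.mkℚ ℤ.-[1+ k ] d c)   N x (ℚ.*<* ()) h
  degree-ℕ γ@(ℚ.mkℚ (ℤ.+ suc k) d c) N x _ h = ≤-trans (*-monoˡ-≤ N (+-monoʳ-≤ (7 * suc d) (*-monoˡ-≤ 16 {1} {suc k} (s≤s z≤n)))) (go (ℚᵘ.drop-*≤* step))
    where
    lhs : ℚ.toℚᵘ (((ℤ.+ 7 ℚ./ 16) ℚ.+ γ) ℚ.* ((ℤ.+ N ℚ./ 1) ℚ.* ℚ.½)) ℚᵘ.≃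
          (ℚᵘ.mkℚᵘ (ℤ.+ 7) 15 ℚᵘ.+ ℚᵘ.mkℚᵘ (ℤ.+ suc k) d) ℚᵘ.* (ℚᵘ.mkℚᵘ (ℤ.+ N) 0 ℚᵘ.* ℚᵘ.mkℚᵘ (ℤ.+ 1) 1)
    lhs = ℚᵘ.≃-trans (ℚ.toℚᵘ-homo-* ((ℤ.+ 7 ℚ./ 16) ℚ.+ γ) ((ℤ.+ N ℚ./ 1) ℚ.* ℚ.½))
      (ℚᵘ.*-cong (ℚ.toℚᵘ-homo-+ (ℤ.+ 7 ℚ./ 16) γ) (ℚᵘ.≃-trans (ℚ.toℚᵘ-homo-* (ℤ.+ N ℚ./ 1) ℚ.½) (ℚᵘ.*-cong (toℚᵘ-nat N) ℚᵘ.≃-refl)))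
    step : (ℚᵘ.mkℚᵘ (ℤ.+ 7) 15 ℚᵘ.+ ℚᵘ.mkℚᵘ (ℤ.+ suc k) d) ℚᵘ.* (ℚᵘ.mkℚᵘ (ℤ.+ N) 0 ℚᵘ.* ℚᵘ.mkℚᵘ (ℤ.+ 1) 1) ℚᵘ.≤ ℚᵘ.mkℚᵘ (ℤ.+ x) 0
    step = ℚᵘ.≤-respˡ-≃ lhs (ℚᵘ.≤-respʳ-≃ (toℚᵘ-nat x) (ℚ.toℚᵘ-mono-≤ h))
    go : ((ℤ.+ 7 ℤ.* ℤ.+ suc d ℤ.+ ℤ.+ suc k ℤ.* ℤ.+ 16) ℤ.* (ℤ.+ N ℤ.* ℤ.+ 1)) ℤ.* ℤ.+ 1 ℤ.≤ ℤ.+ x ℤ.* ℤ.+ (16 * suc d * 2) →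
         (7 * suc d + suc k * 16) * N ≤ 16 * suc d * (2 * x)
    go i = ≤-trans (≤-reflexive (lem₁ (7 * suc d) (suc k * 16) N)) (≤-trans (ℤ.drop‿+≤+ (subst₂ ℤ._≤_ l r i)) (≤-reflexive (lem₂ x (16 * suc d))))
      where
      l : ((ℤ.+ 7 ℤ.* ℤ.+ suc d ℤ.+ ℤ.+ suc k ℤ.* ℤ.+ 16) ℤ.* (ℤ.+ N ℤ.* ℤ.+ 1)) ℤ.* ℤ.+ 1 ≡ ℤ.+ ((7 * suc d + suc k * 16) * (N * 1) * 1)
      l = trans (cong (ℤ._* ℤ.+ 1) (trans (cong₂ ℤ._*_ (cong₂ ℤ._+_ (sym (ℤ.pos-* 7 (suc d))) (sym (ℤ.pos-* (suc k) 16))) (sym (ℤ.pos-* N 1)))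
            (sym (ℤ.pos-* (7 * suc d + suc k * 16) (N * 1))))) (sym (ℤ.pos-* ((7 * suc d + suc k * 16) * (N * 1)) 1))
      r : ℤ.+ x ℤ.* ℤ.+ (16 * suc d * 2) ≡ ℤ.+ (x * (16 * suc d * 2))
      r = sym (ℤ.pos-* x (16 * suc d * 2))
      lem₁ : ∀ a b n → (a + b) * n ≡ (a + b) * (n * 1) * 1
      lem₁ = solve-∀
      lem₂ : ∀ x y → x * (y * 2) ≡ y * (2 * x)
      lem₂ = solve-∀

  colour-ℕ : ∀ k x N → (ℤ.+ x ℚ./ 1) ℚ.≤ (ℤ.+ 1 ℚ./ suc k) ℚ.* (ℤ.+ N ℚ./ 1) → x * suc k ≤ N
  colour-ℕ k x N h = go (ℚᵘ.drop-*≤* step)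
    where
    step : ℚᵘ.mkℚᵘ (ℤ.+ x) 0 ℚᵘ.≤ ℚᵘ.mkℚᵘ (ℤ.+ 1) k ℚᵘ.* ℚᵘ.mkℚᵘ (ℤ.+ N) 0
    step = ℚᵘ.≤-respˡ-≃ (toℚᵘ-nat x) (ℚᵘ.≤-respʳ-≃ (ℚᵘ.≃-trans (ℚ.toℚᵘ-homo-* (ℤ.+ 1 ℚ./ suc k) (ℤ.+ N ℚ./ 1))
      (ℚᵘ.*-cong (ℚ.toℚᵘ-fromℚᵘ (ℚᵘ.mkℚᵘ (ℤ.+ 1) k)) (toℚᵘ-nat N))) (ℚ.toℚᵘ-mono-≤ h))
    go : ℤ.+ x ℤ.* ℤ.+ (suc k * 1) ℤ.≤ (ℤ.+ 1 ℤ.* ℤ.+ N) ℤ.* ℤ.+ 1 → x * suc k ≤ N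
    go i = ≤-trans (≤-reflexive (cong (x *_) (sym (*-identityʳ (suc k))))) (≤-trans (ℤ.drop‿+≤+ (subst₂ ℤ._≤_ (sym (ℤ.pos-* x (suc k * 1))) r i)) ≤-refl)
      where
      r : (ℤ.+ 1 ℤ.* ℤ.+ N) ℤ.* ℤ.+ 1 ≡ ℤ.+ N
      r = trans (ℤ.*-identityʳ (ℤ.+ 1 ℤ.* ℤ.+ N)) (ℤ.*-identityˡ (ℤ.+ N))

  properHamilton : (γ : ℚ.ℚ) → ℚ.0ℚ ℚ.< γ → Σ ℚ.ℚ λ c → (ℚ.0ℚ ℚ.< c) × Σ ℕ λ n₀ → (n₀ > 0) ×
    ((n : ℕ) → (H : ThreeGraph n) → (φ : Colouring n) → 2 ∣ n → n ≥ n₀ →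
      ((v : Fin n) → ((ℤ.+ 7 ℚ./ 16) ℚ.+ γ) ℚ.* ((ℤ.+ (n * n) ℚ./ 1) ℚ.* ℚ.½) ℚ.≤ (ℤ.+ deg H v ℚ./ 1)) →
      ((i : ℕ) → (v : Fin n) → (ℤ.+ degCol H φ i v ℚ./ 1) ℚ.≤ c ℚ.* (ℤ.+ (n * n) ℚ./ 1)) → HasPCLooseHamCycle n H φ)
  properHamilton γ 0<γ = choose (constants (1 + ℚ.ℚ.denominator-1 γ) (s≤s z≤n))
    where
    choose : Constants (1 + ℚ.ℚ.denominator-1 γ) → Σ ℚ.ℚ λ c → (ℚ.0ℚ ℚ.< c) × Σ ℕ λ n₀ → (n₀ > 0) ×
      ((n : ℕ) → (H : ThreeGraph n) → (φ : Colouring n) → 2 ∣ n → n ≥ n₀ →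
        ((v : Fin n) → ((ℤ.+ 7 ℚ./ 16) ℚ.+ γ) ℚ.* ((ℤ.+ (n * n) ℚ./ 1) ℚ.* ℚ.½) ℚ.≤ (ℤ.+ deg H v ℚ./ 1)) →
        ((i : ℕ) → (v : Fin n) → (ℤ.+ degCol H φ i v ℚ./ 1) ℚ.≤ c ℚ.* (ℤ.+ (n * n) ℚ./ 1)) → HasPCLooseHamCycle n H φ)
    choose R = (ℤ.+ 1 ℚ./ suc k) , ℚ.positive⁻¹ (ℤ.+ 1 ℚ./ suc k) {{ℚ.normalize-pos 1 (suc k)}} , threshold R , s≤s z≤n ,
        λ n H φ 2∣n n≥ degree colours → large-n R n H φ 2∣n n≥ (λ v → degree-ℕ γ (n * n) (deg H v) 0<γ (degree v))
          (λ κ v → ≤-trans (scaled (degCol H φ κ v)) (colour-ℕ k (degCol H φ κ v) (n * n) (colours κ v)))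
      where
      open Constants R using (C)
      k : ℕ
      -- c = 1/(9C + 1): the 9 comes from counting ordered pairs, and the 1 keeps the denominator
      -- positive by its form.
      k = C * 9
      scaled : ∀ x → C * (x * 9) ≤ x * suc k
      scaled x = ≤-trans (≤-reflexive (lem C x)) (*-monoʳ-≤ x (n≤1+n k))
        where
        lem : ∀ c x → c * (x * 9) ≡ x * (c * 9)
        lem = solve-∀

open import Defs
open import Data.Nat using (ℕ; _≥_; _>_)
open import Data.Nat.Divisibility using (_∣_)
open import Data.Fin using (Fin)
open import Data.Product using (Σ; _×_)
open import Data.Integer using (+_)
open import Data.Rational using (ℚ; _/_; _+_; _*_; _≤_; _<_; 0ℚ; ½)

theorem1p4 : (γ : ℚ) → 0ℚ < γ →
    Σ ℚ λ c → (0ℚ < c) × Σ ℕ λ n₀ → (n₀ > 0) ×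
    ((n : ℕ) → (H : ThreeGraph n) → (φ : Colouring n) →
    2 ∣ n → n ≥ n₀ →
    ((v : Fin n) → ((+ 7 / 16) + γ) * ((+ (n Data.Nat.* n) / 1) * ½) ≤ (+ deg H v / 1)) →
    ((i : ℕ) → (v : Fin n) → (+ degCol H φ i v / 1) ≤ c * (+ (n Data.Nat.* n) / 1)) →
    HasPCLooseHamCycle n H φ)
theorem1p4 = Development.properHamilton
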